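{- Let $n\ge1$ and let $T$ be a good tree on the vertex set $[n+1]$. Let $c(n,l)$ be the number of noncrossing alternating spanning trees $T_m$ of $\overline{T}$ with $|S_T(T_m)|=l$. Then $$(1-x)^{n+1}J(\mathcal{P}(T),x)=\sum_{l=1}^n c(n,l-1)\,x^{l-1}.$$
   Context: Graphs have vertex set $[n+1]=\{1,\ldots,n+1\}$; an edge joining $i<j$ is written $(i,j)$, and $(i,j)_a$ is the edge $(i,j)$ with label $a$. A graph is noncrossing if there are no $i<j<k<l$ with $(i,k),(j,l)$ both edges; alternating if there are no $i<j<k$ with $(i,j),(j,k)$ both edges. The transitive closure $\overline{G}$ has as edges all $(i,j)$ for which there are edges $(i,i_1),(i_1,i_2),\ldots,(i_r,j)$ of $G$ with $i<i_1<\cdots<i_r<j$ (edges of $G$ included). A spanning tree of $\overline{T}$ is a tree with vertex set $[n+1]$ with all edges in $\overline{T}$. A forest $H$ on $[n+1]$ with $k$ edges labeled $1,\ldots,k$ is good if: (i) if $(i,j)_a,(j,k)_b$ are edges, $i<j<k$, then $a<b$; (ii) if $(i,j)_a,(i,k)_b$ are edges with $i<j<k$, then $a>b$; (iii) if $(i,j)_a,(k,j)_b$ are edges with $i<k<j$, then $a>b$; (iv) $H$ is noncrossing. A good tree is a good forest that is a tree. Let $e_1,\ldots,e_{n+1}$ be the coordinate vectors of $\mathbb{R}^{n+1}$. $\mathcal{P}(A_n^+)$ is the convex hull of the origin and the points $e_i-e_j$, $1\le i<j\le n+1$; $\mathcal{C}(G)$ is the cone of nonnegative combinations of the $e_i-e_j$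 with $(i,j)\in E(G)$, $i<j$; and $\mathcal{P}(G)=\mathcal{P}(A_n^+)\cap\mathcal{C}(G)$. The Ehrhart polynomial of an integer polytope $\mathcal{P}\subset\mathbb{R}^{n+1}$ is $L_{\mathcal{P}}(t)=\#(t\mathcal{P}\cap\mathbb{Z}^{n+1})$, and $J(\mathcal{P},x)=1+\sum_{t=1}^\infty L_{\mathcal{P}}(t)x^t$. Let $T_m$ be a noncrossing alternating spanning tree of $\overline{T}$. $L(T_m)$ is the set of left vertices of $T_m$: the vertices which are the smaller vertex of each edge of $T_m$ incident to them. $S(T_m)=\{(i,j)\mid i\in L(T_m)$ and $j$ is the largest vertex adjacent to $i$ in $T_m\}$. For $(i,j)\in S(T_m)\setminus\{(1,n+1)\}$ define $f_{T_m}((i,j))=(i',j')$, where $i'$ is the biggest vertex of $T_m$ smaller than $i$ such that $(i',j)\in E(T_m)$, and $j'$ is the biggest vertex of $T_m$ smaller than $j$ such that $(i,j')\in E(T_m)$, or $j'=i$ if $(i,j)$ is the only edge of $T_m$ incident to $i$. Finally, $S_T(T_m)=\{(i,j)\in S(T_m)\setminus\{(1,n+1)\}\mid f_{T_m}((i,j))\in E(\overline{T})\}$. -}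

module Defs where

open import Data.Bool.Base using (if_then_else_)
open import Data.Fin.Base using (Fin; zero; suc; toℕ; fromℕ; _<_; _≤_)
open import Data.Fin.Induction using (>-wellFounded)
open import Data.Fin.Properties as Fin using (any?)
open import Data.Integer.Base as ℤ using (ℤ; 0ℤ; 1ℤ; +_)
open import Data.Integer.Properties as ℤ using ()
open import Data.List.Base using (List; _∷_; _∷ʳ_; length)
open import Data.List.Relation.Unary.Linked using (Linked)
open import Data.List.Relation.Unary.Unique.Propositional using (Unique)
open import Data.Nat.Base as ℕ using (ℕ; zero; suc)
open import Data.Nat.Properties as ℕ using ()
open import Data.Product.Base using (Σ; Σ-syntax; ∃; ∃-syntax; _×_; _,_; proj₁; proj₂)
open import Data.Rational.Base as ℚ using (ℚ; 0ℚ; 1ℚ; ½; ∣_∣)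
open import Data.Rational.Properties as ℚ using ()
open import Data.Rational.Solver using (module +-*-Solver)
open import Data.Sum.Base using (_⊎_; inj₁; inj₂)
open import Data.Vec.Functional using (Vector; foldr)
import Data.Vec.Functional.Relation.Binary.Equality.Setoid as VecSetoid
open import Data.Vec.Functional.Relation.Binary.Pointwise using (Pointwise)
open import Function.Base using (_∘_)
open import Function.Bundles using (Bijection; _⇔_)
open import Function.Construct.Composition using (_⇔-∘_)
open import Function.Construct.Identity using (⇔-id)
open import Function.Construct.Symmetry using (⇔-sym)
open import Induction.WellFounded using (Acc; acc)
open import Level using (Level; 0ℓ; _⊔_) renaming (suc to lsuc)
open import Relation.Binary.Bundles using (Setoid)
open import Relation.Binary.Core using (Rel; _⇒_)
open import Relation.Binary.Definitions using (Decidable)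
open import Relation.Binary.Construct.Closure.ReflexiveTransitive using (Star)
open import Relation.Binary.Construct.Closure.Symmetric using (SymClosure)
open import Relation.Binary.Construct.Closure.Transitive using (TransClosure; [_]; _∷_)
import Relation.Binary.Construct.On as On
open import Relation.Binary.PropositionalEquality as ≡
  using (_≡_; _≢_; refl; sym; cong; subst)
open import Relation.Nullary.Decidable using (Dec; yes; no; does; _⊎-dec_; map′)
open import Relation.Nullary.Negation using (¬_)
open import Relation.Unary using (Pred; _∈_; _∩_)

private
  variable
    a ℓ p : Level
    n N : ℕ

-- Elements of { x ∈ S | P x } are compared by the equality of S only.
restrict : (S : Setoid a ℓ) → Pred (Setoid.Carrier S) p → Setoid (a ⊔ p) ℓ
restrict S P = On.setoid S (proj₁ {B = P})

HasSize : (S : Setoid a ℓ) → Pred (Setoid.Carrier S) p → ℕ → Set (a ⊔ ℓ ⊔ p)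
HasSize S P m = Bijection (≡.setoid (Fin m)) (restrict S P)

-- The vertices 1, …, N are the elements of Fin N in order, and
-- E G i j holds only for i < j.
record Graph (N : ℕ) : Set₁ where
  field
    E   : Rel (Fin N) 0ℓ
    E⇒< : E ⇒ _<_
    E?  : Decidable E

open Graph public

Graph-setoid : ℕ → Setoid (lsuc 0ℓ) 0ℓ
Graph-setoid N = record
  { Carrier       = Graph N
  ; _≈_           = λ G H → ∀ i j → E G i j ⇔ E H i j
  ; isEquivalence = record
    { refl  = λ i j → ⇔-id _
    ; sym   = λ p i j → ⇔-sym (p i j)
    ; trans = λ p q i j → q i j ⇔-∘ p i j
    }
  }

Pair-setoid : ℕ → Setoid 0ℓ 0ℓ
Pair-setoid N = ≡.setoid (Fin N × Fin N)

Edge : Graph N → Pred (Fin N × Fin N) 0ℓ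
Edge G (i , j) = E G i j

Adj : Graph N → Rel (Fin N) 0ℓ
Adj G = SymClosure (E G)

Noncrossing : Graph N → Set
Noncrossing G = ∀ {i j k l} → i < j → j < k → k < l → ¬ (E G i k × E G j l)

Alternating : Graph N → Set
Alternating G = ∀ {i j k} → ¬ (E G i j × E G j k)

IsCycle : Graph N → Fin N → List (Fin N) → Set
IsCycle G v vs = 2 ℕ.≤ length vs × Unique (v ∷ vs) × Linked (Adj G) ((v ∷ vs) ∷ʳ v)

IsForest : Graph N → Set
IsForest G = ∀ v vs → ¬ IsCycle G v vs

Connected : Graph N → Set
Connected G = ∀ u v → Star (Adj G) u v

IsTree : Graph N → Set
IsTree G = Connected G × IsForest G

TransClosure? : (G : Graph N) → Decidable (TransClosure (E G))
TransClosure? G i j = go i (>-wellFounded i)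
  where
  go : ∀ i → Acc (λ u v → v < u) i → Dec (TransClosure (E G) i j)
  go i (acc rs) = map′ to from (E? G i j ⊎-dec any? step?)
    where
    step? : ∀ k → Dec (E G i k × TransClosure (E G) k j)
    step? k with E? G i k
    ... | no ¬e = no (¬e ∘ proj₁)
    ... | yes e = map′ (e ,_) proj₂ (go k (rs (E⇒< G e)))

    to : E G i j ⊎ (∃ λ k → E G i k × TransClosure (E G) k j) → TransClosure (E G) i j
    to (inj₁ e)           = [ e ]
    to (inj₂ (k , e , c)) = e ∷ c

    from : TransClosure (E G) i j → E G i j ⊎ (∃ λ k → E G i k × TransClosure (E G) k j)
    from [ e ]   = inj₁ e
    from (e ∷ c) = inj₂ (_ , e , c)

closure : Graph N → Graph N
closure G = record
  { E   = TransClosure (E G)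
  ; E⇒< = closure⇒<
  ; E?  = TransClosure? G
  }
  where
  closure⇒< : TransClosure (E G) ⇒ _<_
  closure⇒< [ e ]   = E⇒< G e
  closure⇒< (e ∷ c) = Fin.<-trans (E⇒< G e) (closure⇒< c)

IsSpanningTreeOf : Graph N → Graph N → Set
IsSpanningTreeOf G H = IsTree H × E H ⇒ E G

record IsGoodForest (G : Graph N) : Set where
  field
    forest : IsForest G
    #edges : ℕ
    -- The edge with label a is the image of a; labels start at 0, and only
    -- their order is used.
    labelling : HasSize (Pair-setoid N) (Edge G) #edges

  HasLabel : Fin N → Fin N → Fin #edges → Set
  HasLabel i j a = proj₁ (Bijection.to labelling a) ≡ (i , j)

  field
    path        : ∀ {i j k a b} → i < j → j < k →
                  HasLabel i j a → HasLabel j k b → a < b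
    left        : ∀ {i j k a b} → i < j → j < k →
                  HasLabel i j a → HasLabel i k b → b < a
    right       : ∀ {i j k a b} → i < k → k < j →
                  HasLabel i j a → HasLabel k j b → b < a
    noncrossing : Noncrossing G

IsGoodTree : Graph N → Set
IsGoodTree G = IsGoodForest G × IsTree G

IsBiggest : Pred (Fin N) 0ℓ → Pred (Fin N) 0ℓ
IsBiggest P m = P m × (∀ k → P k → k ≤ m)

LeftVertex : Graph N → Pred (Fin N) 0ℓ
LeftVertex Tm i = ∀ j → Adj Tm i j → i < j

S : Graph N → Pred (Fin N × Fin N) 0ℓ
S Tm (i , j) = LeftVertex Tm i × IsBiggest (Adj Tm i) j

-- f_{T_m}((i , j)) = (i′ , j′), as a relation. The two cases for j′ exclude
-- each other.
IsImage : Graph N → Rel (Fin N × Fin N) 0ℓ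
IsImage Tm (i , j) (i′ , j′) =
  IsBiggest (λ v → v < i × E Tm v j) i′ ×
  (IsBiggest (λ v → v < j × E Tm i v) j′ ⊎
   (∀ v → Adj Tm i v → v ≡ j) × j′ ≡ i)

-- S[ T ] Tm is the set S_T(T_m); zero and fromℕ n are the vertices 1 and n + 1.
S[_] : Graph (suc n) → Graph (suc n) → Pred (Fin (suc n) × Fin (suc n)) 0ℓ
S[_] {n} T Tm e =
  e ∈ S Tm × e ≢ (zero , fromℕ n) ×
  ∃ λ e′ → IsImage Tm e e′ × Edge (closure T) e′

NoncrossingAlternatingTree : Graph N → Pred (Graph N) 0ℓ
NoncrossingAlternatingTree T Tm =
  IsSpanningTreeOf (closure T) Tm × Noncrossing Tm × Alternating Tm

-- Cauchy sequences of rationals; equality of reals is _≈ℝ_, not _≡_.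
record ℝ : Set where
  constructor mkℝ
  field
    seq    : ℕ → ℚ
    cauchy : ∀ ε → 0ℚ ℚ.< ε →
             ∃[ M ] ∀ m n → M ℕ.≤ m → M ℕ.≤ n → ∣ seq m ℚ.- seq n ∣ ℚ.< ε

open ℝ public

infix 4 _≈ℝ_ _≤ℝ_

_≈ℝ_ : Rel ℝ 0ℓ
x ≈ℝ y = ∀ ε → 0ℚ ℚ.< ε → ∃[ M ] ∀ n → M ℕ.≤ n → ∣ seq x n ℚ.- seq y n ∣ ℚ.< ε

_≤ℝ_ : Rel ℝ 0ℓ
x ≤ℝ y = ∀ ε → 0ℚ ℚ.< ε → ∃[ M ] ∀ n → M ℕ.≤ n → seq x n ℚ.< seq y n ℚ.+ ε

private
  split : ∀ m n {k} → m ℕ.⊔ n ℕ.≤ k → m ℕ.≤ k × n ℕ.≤ k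
  split m n m⊔n≤k = ℕ.m⊔n≤o⇒m≤o m n m⊔n≤k , ℕ.m⊔n≤o⇒n≤o m n m⊔n≤k

  half< : ∀ {ε} → 0ℚ ℚ.< ε → 0ℚ ℚ.< ½ ℚ.* ε
  half< {ε} 0<ε = subst (ℚ._< ½ ℚ.* ε) (ℚ.*-zeroʳ ½) (ℚ.*-monoʳ-<-pos ½ 0<ε)

  halves : ∀ ε → ½ ℚ.* ε ℚ.+ ½ ℚ.* ε ≡ ε
  halves ε = ≡.trans (sym (ℚ.*-distribʳ-+ ε ½ ½)) (ℚ.*-identityˡ ε)

  +-diff : ∀ p q r s → (p ℚ.+ q) ℚ.- (r ℚ.+ s) ≡ (p ℚ.- r) ℚ.+ (q ℚ.- s)
  +-diff = solve 4 (λ p q r s → (p :+ q) :- (r :+ s) := (p :- r) :+ (q :- s)) refl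
    where open +-*-Solver

  neg-diff : ∀ p q → ℚ.- p ℚ.- ℚ.- q ≡ ℚ.- (p ℚ.- q)
  neg-diff = solve 2 (λ p q → :- p :- :- q := :- (p :- q)) refl
    where open +-*-Solver

  *-diff : ∀ p q r s → (p ℚ.* q) ℚ.- (r ℚ.* s) ≡ p ℚ.* (q ℚ.- s) ℚ.+ s ℚ.* (p ℚ.- r)
  *-diff = solve 4 (λ p q r s → (p :* q) :- (r :* s) := p :* (q :- s) :+ s :* (p :- r)) refl
    where open +-*-Solver

  cancel : ∀ p q → (p ℚ.- q) ℚ.+ q ≡ p
  cancel = solve 2 (λ p q → (p :- q) :+ q := p) refl
    where open +-*-Solver

  open ℚ.≤-Reasoning

  bounded : (x : ℝ) → ∃[ B ] ∃[ M ] 0ℚ ℚ.< B × (∀ n → M ℕ.≤ n → ∣ seq x n ∣ ℚ.≤ B)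
  bounded x = B , M , 0<B , ≤B
    where
    M = proj₁ (cauchy x 1ℚ (ℚ.positive⁻¹ 1ℚ))
    B = 1ℚ ℚ.+ ∣ seq x M ∣

    0<B : 0ℚ ℚ.< B
    0<B = ℚ.+-mono-<-≤ (ℚ.positive⁻¹ 1ℚ) (ℚ.0≤∣p∣ (seq x M))

    ≤B : ∀ n → M ℕ.≤ n → ∣ seq x n ∣ ℚ.≤ B
    ≤B n M≤n = begin
      ∣ seq x n ∣                                 ≡⟨ cong ∣_∣ (cancel (seq x n) (seq x M)) ⟨
      ∣ (seq x n ℚ.- seq x M) ℚ.+ seq x M ∣       ≤⟨ ℚ.∣p+q∣≤∣p∣+∣q∣ (seq x n ℚ.- seq x M) (seq x M) ⟩
      ∣ seq x n ℚ.- seq x M ∣ ℚ.+ ∣ seq x M ∣     ≤⟨ ℚ.+-monoˡ-≤ ∣ seq x M ∣ (ℚ.<⇒≤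
                                                     (proj₂ (cauchy x 1ℚ (ℚ.positive⁻¹ 1ℚ)) n M M≤n ℕ.≤-refl)) ⟩
      B                                           ∎

  scaled : ∀ B ε → 0ℚ ℚ.< B → 0ℚ ℚ.< ε → ∃[ δ ] 0ℚ ℚ.< δ × B ℚ.* δ ≡ ε
  scaled B ε 0<B 0<ε = B⁻¹ ℚ.* ε , 0<δ , eq
    where
    instance
      pos = ℚ.positive 0<B
      nonZero = ℚ.pos⇒nonZero B
    B⁻¹ = ℚ.1/ B
    instance
      pos⁻¹ = ℚ.1/pos⇒pos B
    0<δ : 0ℚ ℚ.< B⁻¹ ℚ.* ε
    0<δ = subst (ℚ._< B⁻¹ ℚ.* ε) (ℚ.*-zeroʳ B⁻¹) (ℚ.*-monoʳ-<-pos B⁻¹ 0<ε)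
    eq : B ℚ.* (B⁻¹ ℚ.* ε) ≡ ε
    eq = ≡.trans (sym (ℚ.*-assoc B B⁻¹ ε))
        (≡.trans (cong (ℚ._* ε) (ℚ.*-inverseʳ B)) (ℚ.*-identityˡ ε))

  product-bound : ∀ {p q B ε} → 0ℚ ℚ.< B → ∣ p ∣ ℚ.≤ B →
                  (∃[ δ ] ∣ q ∣ ℚ.< δ × B ℚ.* δ ≡ ε) → ∣ p ℚ.* q ∣ ℚ.< ε
  product-bound {p} {q} {B} {ε} 0<B p≤B (δ , q<δ , eq) = begin-strict
    ∣ p ℚ.* q ∣        ≡⟨ ℚ.∣p*q∣≡∣p∣*∣q∣ p q ⟩
    ∣ p ∣ ℚ.* ∣ q ∣    ≤⟨ ℚ.*-monoʳ-≤-nonNeg ∣ q ∣ {{ℚ.nonNegative (ℚ.0≤∣p∣ q)}} p≤B ⟩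
    B ℚ.* ∣ q ∣        <⟨ ℚ.*-monoʳ-<-pos B {{ℚ.positive 0<B}} q<δ ⟩
    B ℚ.* δ            ≡⟨ eq ⟩
    ε                  ∎

  sum-bound : ∀ {p q ε} → ∣ p ∣ ℚ.< ½ ℚ.* ε → ∣ q ∣ ℚ.< ½ ℚ.* ε → ∣ p ℚ.+ q ∣ ℚ.< ε
  sum-bound {p} {q} {ε} p< q< = begin-strict
    ∣ p ℚ.+ q ∣             ≤⟨ ℚ.∣p+q∣≤∣p∣+∣q∣ p q ⟩
    ∣ p ∣ ℚ.+ ∣ q ∣         <⟨ ℚ.+-mono-< p< q< ⟩
    ½ ℚ.* ε ℚ.+ ½ ℚ.* ε     ≡⟨ halves ε ⟩
    ε                       ∎

fromℚ : ℚ → ℝ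
fromℚ q = mkℝ (λ _ → q) λ ε 0<ε → 0 , λ _ _ _ _ →
  subst (λ d → ∣ d ∣ ℚ.< ε) (sym (ℚ.+-inverseʳ q)) 0<ε

fromℤ : ℤ → ℝ
fromℤ z = fromℚ (z ℚ./ 1)

0ℝ 1ℝ : ℝ
0ℝ = fromℤ 0ℤ
1ℝ = fromℤ 1ℤ

infixl 6 _+ℝ_ _-ℝ_
infixl 7 _*ℝ_
infix  8 -ℝ_

_+ℝ_ : ℝ → ℝ → ℝ
x +ℝ y = mkℝ (λ n → seq x n ℚ.+ seq y n) λ ε 0<ε →
  let (M , x<) = cauchy x (½ ℚ.* ε) (half< 0<ε)
      (K , y<) = cauchy y (½ ℚ.* ε) (half< 0<ε)
  in M ℕ.⊔ K , λ m n m≥ n≥ →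
    let (m≥M , m≥K) = split M K m≥
        (n≥M , n≥K) = split M K n≥
    in subst (λ d → ∣ d ∣ ℚ.< ε)
      (sym (+-diff (seq x m) (seq y m) (seq x n) (seq y n)))
      (sum-bound {seq x m ℚ.- seq x n} {seq y m ℚ.- seq y n}
        (x< m n m≥M n≥M) (y< m n m≥K n≥K))

-ℝ_ : ℝ → ℝ
-ℝ x = mkℝ (λ n → ℚ.- seq x n) λ ε 0<ε →
  let (M , x<) = cauchy x ε 0<ε
  in M , λ m n m≥ n≥ →
    subst (ℚ._< ε)
      (sym (≡.trans (cong ∣_∣ (neg-diff (seq x m) (seq x n)))
                    (ℚ.∣-p∣≡∣p∣ (seq x m ℚ.- seq x n))))
      (x< m n m≥ n≥)

_-ℝ_ : ℝ → ℝ → ℝ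
x -ℝ y = x +ℝ -ℝ y

_*ℝ_ : ℝ → ℝ → ℝ
x *ℝ y = mkℝ (λ n → seq x n ℚ.* seq y n) λ ε 0<ε →
  let (B , M₁ , 0<B , x≤B) = bounded x
      (C , M₂ , 0<C , y≤C) = bounded y
      (δ , 0<δ , Bδ) = scaled B (½ ℚ.* ε) 0<B (half< 0<ε)
      (η , 0<η , Cη) = scaled C (½ ℚ.* ε) 0<C (half< 0<ε)
      (M₃ , y<) = cauchy y δ 0<δ
      (M₄ , x<) = cauchy x η 0<η
  in (M₁ ℕ.⊔ M₂) ℕ.⊔ (M₃ ℕ.⊔ M₄) , λ m n m≥ n≥ →
    let (m≥₁₂ , m≥₃₄) = split (M₁ ℕ.⊔ M₂) (M₃ ℕ.⊔ M₄) m≥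
        (n≥₁₂ , n≥₃₄) = split (M₁ ℕ.⊔ M₂) (M₃ ℕ.⊔ M₄) n≥
        (m≥₁ , _)     = split M₁ M₂ m≥₁₂
        (_ , n≥₂)     = split M₁ M₂ n≥₁₂
        (m≥₃ , m≥₄)   = split M₃ M₄ m≥₃₄
        (n≥₃ , n≥₄)   = split M₃ M₄ n≥₃₄
    in subst (λ d → ∣ d ∣ ℚ.< ε)
      (sym (*-diff (seq x m) (seq y m) (seq x n) (seq y n)))
      (sum-bound {seq x m ℚ.* (seq y m ℚ.- seq y n)} {seq y n ℚ.* (seq x m ℚ.- seq x n)}
        (product-bound {seq x m} {seq y m ℚ.- seq y n}
          0<B (x≤B m m≥₁) (δ , y< m n m≥₃ n≥₃ , Bδ))
        (product-bound {seq y n} {seq x m ℚ.- seq x n}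
          0<C (y≤C n n≥₂) (η , x< m n m≥₄ n≥₄ , Cη)))

ℝ^ : ℕ → Set
ℝ^ N = Vector ℝ N

infix 4 _≋_

_≋_ : Rel (ℝ^ N) 0ℓ
_≋_ = Pointwise _≈ℝ_

sumℝ : ∀ {m} → Vector ℝ m → ℝ
sumℝ = foldr _+ℝ_ 0ℝ

combination : ∀ {m} → Vector ℝ m → Vector (ℝ^ N) m → ℝ^ N
combination c v k = sumℝ (λ a → c a *ℝ v a k)

ConvexHull : Pred (ℝ^ N) 0ℓ → Pred (ℝ^ N) 0ℓ
ConvexHull {N} X x =
  Σ[ m ∈ ℕ ] Σ[ c ∈ Vector ℝ m ] Σ[ v ∈ Vector (ℝ^ N) m ]
    (∀ a → v a ∈ X) × (∀ a → 0ℝ ≤ℝ c a) × sumℝ c ≈ℝ 1ℝ × x ≋ combination c v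

Cone : Pred (ℝ^ N) 0ℓ → Pred (ℝ^ N) 0ℓ
Cone {N} X x =
  Σ[ m ∈ ℕ ] Σ[ c ∈ Vector ℝ m ] Σ[ v ∈ Vector (ℝ^ N) m ]
    (∀ a → v a ∈ X) × (∀ a → 0ℝ ≤ℝ c a) × x ≋ combination c v

Dilate : ℕ → Pred (ℝ^ N) 0ℓ → Pred (ℝ^ N) 0ℓ
Dilate t P x = ∃[ y ] y ∈ P × x ≋ (λ k → fromℤ (+ t) *ℝ y k)

origin : ℝ^ N
origin _ = 0ℝ

e : Fin N → ℝ^ N
e i k = if does (i Fin.≟ k) then 1ℝ else 0ℝ

PositiveRoot : Pred (ℝ^ N) 0ℓ
PositiveRoot x = ∃[ i ] ∃[ j ] i < j × x ≋ (λ k → e i k -ℝ e j k)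

EdgeRoot : Graph N → Pred (ℝ^ N) 0ℓ
EdgeRoot G x = ∃[ i ] ∃[ j ] E G i j × x ≋ (λ k → e i k -ℝ e j k)

𝒫A⁺ : Pred (ℝ^ N) 0ℓ
𝒫A⁺ = ConvexHull (λ x → x ≋ origin ⊎ PositiveRoot x)

𝒞 : Graph N → Pred (ℝ^ N) 0ℓ
𝒞 G = Cone (EdgeRoot G)

𝒫 : Graph N → Pred (ℝ^ N) 0ℓ
𝒫 G = 𝒫A⁺ ∩ 𝒞 G

ℤ^-setoid : ℕ → Setoid 0ℓ 0ℓ
ℤ^-setoid = VecSetoid.≋-setoid (≡.setoid ℤ)

LatticePoint : Pred (ℝ^ N) 0ℓ → Pred (Vector ℤ N) 0ℓ
LatticePoint P z = (fromℤ ∘ z) ∈ P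

IsEhrhartFunction : Pred (ℝ^ N) 0ℓ → (ℕ → ℕ) → Set
IsEhrhartFunction {N} P L =
  ∀ t → HasSize (ℤ^-setoid N) (LatticePoint (Dilate t P)) (L t)

Series : Set
Series = ℕ → ℤ

infixl 6 _⊕_ _⊖_
infixl 7 _⊛_ _·_
infixr 8 _^ˢ_ X^_

X^_ : ℕ → Series
(X^ l) k = if does (l ℕ.≟ k) then 1ℤ else 0ℤ

0ˢ 1ˢ : Series
0ˢ _ = 0ℤ
1ˢ = X^ 0

_⊕_ _⊖_ _⊛_ : Series → Series → Series
(f ⊕ g) k = f k ℤ.+ g k
(f ⊖ g) k = f k ℤ.- g k
(f ⊛ g) k = foldr ℤ._+_ 0ℤ (λ (i : Fin (suc k)) → f (toℕ i) ℤ.* g (k ℕ.∸ toℕ i))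

_·_ : ℤ → Series → Series
(z · f) k = z ℤ.* f k

_^ˢ_ : Series → ℕ → Series
f ^ˢ zero  = 1ˢ
f ^ˢ suc m = f ⊛ (f ^ˢ m)

sumˢ : ∀ {m} → Vector Series m → Series
sumˢ = foldr _⊕_ 0ˢ

-- J(P, x) for a polytope with Ehrhart function L; the constant term is 1 by
-- definition, not L 0.
J : (ℕ → ℕ) → Series
J L zero        = 1ℤ
J L t@(suc _) = + L t

{-# OPTIONS --safe #-}

-- Heights on the gaps between consecutive vertices define a noncrossing
-- alternating tree, whose arcs correspond to the gaps between two vertices
-- (the nodes of the Cartesian tree of the heights), and every noncrossing
-- alternating tree arises in this way. The prefix sums W of a lattice point z of
-- the cone of T are such heights, up to ties; ties are broken by adding a small
-- multiple of an interior direction ω of the cone. The resulting tree Tm lies in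
-- the closure of T, and z is the combination of the roots of its arcs in which
-- the arc of the gap q has the coefficient W q - W (parent q). The points z with
-- a given Tm are those for which these coefficients are natural numbers, positive
-- whenever ω q < ω (parent q), and the latter holds precisely for the arcs in
-- S_T(Tm). Hence the lattice points of t 𝒫(T) are partitioned into those of
-- t-fold dilated unimodular simplices with |S_T(Tm)| facets removed, each of
-- which contributes x^|S_T(Tm)| / (1 - x)^(n+1) to the generating function.
module Submission where

open import Defs
open import Algebra.Bundles using (CommutativeRing)
open import Data.Bool.Base using (Bool; true; false; if_then_else_)
open import Data.Empty using (⊥; ⊥-elim)
open import Data.Fin.Base as Fin using (Fin; zero; suc; toℕ; fromℕ; fromℕ<)
import Data.Fin.Properties as Fin
open import Data.Integer.Base as ℤ using (ℤ; 0ℤ; 1ℤ; +_)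
import Data.Integer.Properties as ℤ
import Data.Integer.Tactic.RingSolver as ℤSolver
open import Data.List.Base using (List; []; _∷_; _∷ʳ_; _++_; length; replicate; lookup; map; concatMap; filter; allFin; deduplicate; tabulate)
open import Data.List.Membership.Propositional using (find; lose) renaming (_∈_ to _∈ˡ_)
open import Data.List.Membership.Propositional.Properties using (∈-map⁺; ∈-++⁺ˡ; ∈-++⁺ʳ; ∈-concat⁺′; ∈-allFin; ∈-filter⁺)
import Data.List.Membership.Setoid.Properties as Membership
import Data.List.Properties as List
open import Data.List.Relation.Unary.All as All using (All; []; _∷_)
import Data.List.Relation.Unary.All.Properties as All
open import Data.List.Relation.Unary.AllPairs as AllPairs using (AllPairs; []; _∷_)
import Data.List.Relation.Unary.AllPairs.Properties as AllPairs
open import Data.List.Relation.Unary.Any using (here; index)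
open import Data.List.Relation.Unary.Any.Properties using (lookup-index)
open import Data.List.Relation.Unary.Linked using (Linked; _∷_)
import Data.List.Relation.Unary.Unique.DecSetoid.Properties as Unique
open import Data.List.Relation.Unary.Unique.Propositional using (Unique)
open import Data.List.Relation.Unary.Unique.Propositional.Properties using (allFin⁺)
open import Data.Nat.Base as ℕ using (ℕ; zero; suc; _+_; _*_; _∸_; _^_; _≤_; _<_; z≤n; s≤s; z<s)
open import Data.Nat.DivMod using (_%_; m%n<n; [m+kn]%n≡m%n; m<n⇒m%n≡m; n%n≡0)
open import Data.Nat.Induction using (<-wellFounded)
import Data.Nat.Properties as ℕ
open import Data.Product.Base using (Σ; Σ-syntax; ∃; ∃₂; _×_; _,_; proj₁; proj₂)
open import Data.Rational.Base as ℚ using (ℚ; 0ℚ; 1ℚ; ½; ∣_∣)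
import Data.Rational.Properties as ℚ
open import Data.Rational.Solver using (module +-*-Solver)
open import Data.Rational.Unnormalised.Base as ℚᵘ using (mkℚᵘ; *≡*; *<*)
import Data.Rational.Unnormalised.Properties as ℚᵘ
open import Data.Sum.Base using (_⊎_; inj₁; inj₂)
open import Data.Vec.Base as Vec using (Vec; []; _∷_)
open import Data.Vec.Functional using (Vector)
import Data.Vec.Properties as Vec
open import Function.Base using (_∘_; id)
open import Function.Bundles using (_⇔_; mk⇔; Equivalence; Bijection)
open import Induction.WellFounded using (Acc; acc)
open import Level using (0ℓ)
open import Relation.Binary.Bundles using (Setoid; DecSetoid)
open import Relation.Binary.Construct.Closure.ReflexiveTransitive using (Star; _◅_; _◅◅_; reverse) renaming (ε to done)
open import Relation.Binary.Construct.Closure.Symmetric using (fwd; bwd; symmetric)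
open import Relation.Binary.Construct.Closure.Transitive using (TransClosure; [_]; _∷_)
open import Relation.Binary.Core using (Rel; _⇒_)
open import Relation.Binary.Definitions using (tri<; tri≈; tri>)
open import Relation.Binary.PropositionalEquality using (_≡_; _≢_; _≗_; refl; sym; trans; cong; cong₂; subst; subst₂)
open import Relation.Nullary.Decidable using (Dec; yes; no; does; dec-true; _×-dec_; _→-dec_; ¬?; map′; decidable-stable)
open import Relation.Nullary.Negation using (¬_; contradiction)
open import Relation.Unary using (Pred; _∈_)
open import Algebra.Properties.AbelianGroup ℤ.+-0-abelianGroup using (∙-cancelˡ)
open import Algebra.Properties.CommutativeMonoid.Sum ℕ.+-0-commutativeMonoid using (sum; sum-cong-≗)
open import Algebra.Properties.CommutativeSemigroup ℕ.+-commutativeSemigroup using (interchange; xy∙z≈xz∙y; x∙yz≈y∙xz)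
import Algebra.Properties.Semiring.Sum ℤ.+-*-semiring as ℤΣ
import Algebra.Properties.Semiring.Sum (CommutativeRing.semiring ℚ.+-*-commutativeRing) as ℚΣ

-- Height functions and Cartesian trees

-- A point shared by several simplices goes to the one that contains it after a small push along ω,
-- and a simplex loses exactly those facets for which ω has a negative coefficient. Any generic
-- interior direction yields such a partition; the difficulty is to make the lost facets agree with
-- `S[ T ] Tm` tree by tree. Over the block of vertices between two gaps `p < q`, the difference ω q
-- - ω p is the weight of the edges of `T` leaving the block to the right minus the weight of those
-- entering it from the left. Entering edges start to the left of `p`, leaving ones do not, so
-- weights that decay fast enough in the left endpoint make the sign of the difference depend on a
-- single question: does some edge enter? Noncrossing forces paths of `T` through the endpoints of
-- such an edge, which turns the answer into the increasing path that membership in `S[ T ] Tm`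
-- demands.
--
-- The bound by `t` comes from a 0/1-valued functional attached to each tree: it is 1 on all arcs of
-- the tree and at most 1 on all roots. Real points are examined only through pairings with integer
-- functionals like this one.

lastBefore : {P : ℕ → Set} → (∀ p → Dec (P p)) → P 0 → ∀ {q} → 0 < q →
             ∃ λ p → p < q × P p × (∀ {r} → p < r → r < q → ¬ P r)
lastBefore P? P0 {suc q} _ with P? q
... | yes Pq = q , ℕ.≤-refl , Pq , λ q<r r<1+q → contradiction (ℕ.≤-pred r<1+q) (ℕ.<⇒≱ q<r)
lastBefore P? P0 {suc zero}    _ | no ¬P0 = contradiction P0 ¬P0
lastBefore P? P0 {suc (suc q)} _ | no ¬Pq with lastBefore P? P0 {suc q} z<s
... | p , p<q , Pp , none = p , ℕ.m≤n⇒m≤1+n p<q , Pp , none′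
  where
  none′ : ∀ {r} → p < r → r < suc (suc q) → ¬ _
  none′ p<r r<2+q with ℕ.m≤n⇒m<n∨m≡n (ℕ.≤-pred r<2+q)
  ... | inj₁ r<1+q = none p<r r<1+q
  ... | inj₂ refl  = ¬Pq

firstAfter : {P : ℕ → Set} → (∀ p → Dec (P p)) → ∀ {N} → P N → ∀ {q} → q < N →
             ∃ λ r → q < r × r ≤ N × P r × (∀ {s} → q < s → s < r → ¬ P s)
firstAfter {P} P? {N} PN {q} q<N = go (N ∸ suc q) q (ℕ.m∸n+n≡m q<N)
  where
  go : ∀ d q → d + suc q ≡ N → ∃ λ r → q < r × r ≤ N × P r × (∀ {s} → q < s → s < r → ¬ P s)
  go d q eq with P? (suc q)
  ... | yes Pq = suc q , ℕ.≤-refl , ℕ.m+n≤o⇒n≤o d (ℕ.≤-reflexive eq) , Pq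
               , λ q<s s≤q → contradiction (ℕ.≤-pred s≤q) (ℕ.<⇒≱ q<s)
  go zero    q eq | no ¬Pq = contradiction (subst P (sym eq) PN) ¬Pq
  go (suc d) q eq | no ¬Pq with go d (suc q) (trans (ℕ.+-suc d (suc q)) eq)
  ... | r , q<r , r≤N , Pr , none = r , ℕ.<⇒≤ q<r , r≤N , Pr , none′
    where
    none′ : ∀ {s} → q < s → s < r → ¬ P s
    none′ q<s s<r with ℕ.m≤n⇒m<n∨m≡n q<s
    ... | inj₁ 1+q<s = none 1+q<s s<r
    ... | inj₂ refl  = ¬Pq

argmin : ∀ (V : ℕ → ℕ) {i j} → i < j →
         ∃ λ q → i < q × q ≤ j × (∀ {r} → i < r → r ≤ j → V q ≤ V r)
argmin V {i} {suc j} i<1+j with ℕ.m≤n⇒m<n∨m≡n (ℕ.≤-pred i<1+j)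
... | inj₂ refl = suc j , ℕ.≤-refl , ℕ.≤-refl , λ j<r r≤1+j → ℕ.≤-reflexive (cong V (ℕ.≤-antisym j<r r≤1+j))
... | inj₁ i<j with argmin V i<j
... | q , i<q , q≤j , min with V q ℕ.≤? V (suc j)
...   | yes Vq≤ = q , i<q , ℕ.m≤n⇒m≤1+n q≤j , min′
  where
  min′ : ∀ {r} → i < r → r ≤ suc j → V q ≤ V r
  min′ i<r r≤ with ℕ.m≤n⇒m<n∨m≡n r≤
  ... | inj₁ r<  = min i<r (ℕ.≤-pred r<)
  ... | inj₂ refl = Vq≤
...   | no Vq≰ = suc j , i<1+j , ℕ.≤-refl , min′
  where
  min′ : ∀ {r} → i < r → r ≤ suc j → V (suc j) ≤ V r
  min′ i<r r≤ with ℕ.m≤n⇒m<n∨m≡n r≤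
  ... | inj₁ r<  = ℕ.≤-trans (ℕ.<⇒≤ (ℕ.≰⇒> Vq≰)) (min i<r (ℕ.≤-pred r<))
  ... | inj₂ refl = ℕ.≤-refl

Inner : ℕ → ℕ → Set
Inner n q = 0 < q × q ≤ n

-- The two outermost gaps are sentinels for the searches to the left and right. Their heights may
-- coincide: for prefix sums both are 0.
record Generic (n : ℕ) (V : ℕ → ℕ) : Set where
  field
    injective : ∀ {p q} → Inner n p → Inner n q → V p ≡ V q → p ≡ q
    first     : ∀ {q} → Inner n q → V 0 < V q
    last      : ∀ {q} → Inner n q → V (suc n) < V q

-- A height function V on the n + 2 gaps before, between and after the vertices
-- 0, …, n joins i to j when the two outer gaps of the block i, …, j are lower
-- than all its inner gaps.
Arc : (ℕ → ℕ) → ℕ → ℕ → Set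
Arc V i j = i < j × (∀ {q} → i < q → q ≤ j → V i < V q × V (suc j) < V q)

-- Each of the gaps `j` and `suc k` is an inner gap of one block and an outer gap of the other, so
-- their heights would be ordered both ways.
arc-noncrossing : ∀ V {i j k l} → i < j → j < k → k < l → Arc V i k → Arc V j l → ⊥
arc-noncrossing V i<j j<k k<l (_ , ik) (_ , jl) =
  ℕ.<-asym (proj₂ (ik i<j (ℕ.<⇒≤ j<k)))
           (ℕ.<-≤-trans (proj₁ (jl (ℕ.m≤n⇒m≤1+n j<k) k<l)) ℕ.≤-refl)

-- The height rises across the left endpoint of an arc and falls across its right endpoint; no
-- vertex can be both.
arc-alternating : ∀ V {i j k} → Arc V i j → Arc V j k → ⊥
arc-alternating V (i<j , ij) (j<k , jk) =
  ℕ.<-asym (proj₂ (ij i<j ℕ.≤-refl)) (proj₁ (jk ℕ.≤-refl j<k))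

Covers : ℕ → ℕ → ℕ → Set
Covers i j q = i < q × q ≤ j

-- The higher outer gap of the block i, …, j: the parent, in the Cartesian tree
-- of V, of the lowest inner gap.
parent : (ℕ → ℕ) → ℕ → ℕ → ℕ
parent V i j with V (suc j) ℕ.≤? V i
... | yes _ = i
... | no  _ = suc j

module Cartesian {n : ℕ} {V : ℕ → ℕ} (generic : Generic n V) where
  open Generic generic

  -- Cells match inner gaps with arcs: `q` determines the block, which extends on either side to the
  -- nearest lower gap, and the block determines `q` as its lowest inner gap.
  record Cell (q i j : ℕ) : Set where
    field
      i<q    : i < q
      q≤j    : q ≤ j
      j≤n    : j ≤ n
      low    : V i < V q
      high   : V (suc j) < V q
      lowest : ∀ {r} → i < r → r ≤ j → r ≢ q → V q < V r

    lowest≤ : ∀ {r} → i < r → r ≤ j → V q ≤ V r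
    lowest≤ {r} i<r r≤j with r ℕ.≟ q
    ... | yes refl = ℕ.≤-refl
    ... | no  r≢q  = ℕ.<⇒≤ (lowest i<r r≤j r≢q)

    inner : Inner n q
    inner = ℕ.≤-<-trans z≤n i<q , ℕ.≤-trans q≤j j≤n

    arc : Arc V i j
    arc = ℕ.<-≤-trans i<q q≤j , λ i<r r≤j →
      ℕ.<-≤-trans low (lowest≤ i<r r≤j) , ℕ.<-≤-trans high (lowest≤ i<r r≤j)

  open Cell public

  cell : ∀ {q} → Inner n q → ∃₂ (Cell q)
  cell {q} inq@(0<q , q≤n)
    with lastBefore (λ p → V p ℕ.<? V q) (first inq) 0<q
       | firstAfter (λ p → V p ℕ.<? V q) (last inq) (s≤s q≤n)
  ... | i , i<q , Vi<Vq , before | suc j , s≤s q≤j , s≤s j≤n , Vj<Vq , after =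
    i , j , record { i<q = i<q ; q≤j = q≤j ; j≤n = j≤n ; low = Vi<Vq ; high = Vj<Vq ; lowest = lowest′ }
    where
    lowest′ : ∀ {r} → i < r → r ≤ j → r ≢ q → V q < V r
    lowest′ {r} i<r r≤j r≢q with ℕ.<-cmp (V q) (V r) | ℕ.<-cmp r q
    ... | tri< Vq<Vr _ _ | _            = Vq<Vr
    ... | tri≈ _ Vq≡Vr _ | _            =
      contradiction (sym (injective inq (ℕ.≤-<-trans z≤n i<r , ℕ.≤-trans r≤j j≤n) Vq≡Vr)) r≢q
    ... | tri> _ _ Vr<Vq | tri< r<q _ _ = contradiction Vr<Vq (before i<r r<q)
    ... | tri> _ _ Vr<Vq | tri≈ _ r≡q _ = contradiction r≡q r≢q
    ... | tri> _ _ Vr<Vq | tri> _ _ q<r = contradiction Vr<Vq (after q<r (s≤s r≤j))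

  arc⇒cell : ∀ {i j} → j ≤ n → Arc V i j → ∃ λ q → Cell q i j
  arc⇒cell {i} {j} j≤n (i<j , ij) with argmin V i<j
  ... | q , i<q , q≤j , min = q , record
    { i<q = i<q ; q≤j = q≤j ; j≤n = j≤n ; low = proj₁ (ij i<q q≤j) ; high = proj₂ (ij i<q q≤j)
    ; lowest = λ i<r r≤j r≢q → ℕ.≤∧≢⇒< (min i<r r≤j) λ eq →
        r≢q (sym (injective (inn i<q q≤j) (inn i<r r≤j) eq))
    }
    where
    inn : ∀ {r} → i < r → r ≤ j → Inner n r
    inn i<r r≤j = ℕ.≤-<-trans z≤n i<r , ℕ.≤-trans r≤j j≤n

  cell-gap-unique : ∀ {q q′ i j} → Cell q i j → Cell q′ i j → q ≡ q′
  cell-gap-unique {q} {q′} c c′ with q ℕ.≟ q′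
  ... | yes q≡q′ = q≡q′
  ... | no  q≢q′ = contradiction (lowest c (i<q c′) (q≤j c′) (q≢q′ ∘ sym))
                                 (ℕ.≤⇒≯ (lowest≤ c′ (i<q c) (q≤j c)))

  private
    left≮ : ∀ {q i j i′ j′} → Cell q i j → Cell q i′ j′ → ¬ i < i′
    left≮ c c′ i<i′ = ℕ.<-irrefl refl (ℕ.<-≤-trans (low c′)
      (lowest≤ c i<i′ (ℕ.≤-trans (ℕ.<⇒≤ (i<q c′)) (q≤j c))))

    right≮ : ∀ {q i j i′ j′} → Cell q i j → Cell q i′ j′ → ¬ j′ < j
    right≮ c c′ j′<j = ℕ.<-irrefl refl (ℕ.<-≤-trans (high c′)
      (lowest≤ c (ℕ.<-≤-trans (i<q c) (ℕ.m≤n⇒m≤1+n (q≤j c′))) j′<j))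

  cell-arc-unique : ∀ {q i j i′ j′} → Cell q i j → Cell q i′ j′ → i ≡ i′ × j ≡ j′
  cell-arc-unique c c′ =
    ℕ.≤-antisym (ℕ.≮⇒≥ (left≮ c′ c)) (ℕ.≮⇒≥ (left≮ c c′)) ,
    ℕ.≤-antisym (ℕ.≮⇒≥ (right≮ c c′)) (ℕ.≮⇒≥ (right≮ c′ c))

  -- When the parent is the left outer gap `i`, its block cannot stop before `j`, since the gap
  -- there would be lower than `q`, nor go beyond `j`, since the gap `suc j` is not higher than `i`.
  -- So the parent arc shares the right endpoint, and its left endpoint is the vertex `i′` of the
  -- image of an arc.
  ascend-left : ∀ {q i j} → Cell q i j → V (suc j) ≤ V i →
                (i ≡ 0 × j ≡ n) ⊎ (∃ λ h → Cell i h j)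
  ascend-left {i = zero} {j} c j≤i with ℕ.m≤n⇒m<n∨m≡n (j≤n c)
  ... | inj₁ j<n = contradiction (first (z<s , j<n)) (ℕ.≤⇒≯ j≤i)
  ... | inj₂ j≡n = inj₁ (refl , j≡n)
  ascend-left {q} {i@(suc _)} {j} c j≤i
    with cell {i} (z<s , ℕ.<⇒≤ (ℕ.<-≤-trans (i<q c) (proj₂ (inner c))))
  ... | h , k , d with ℕ.<-cmp k j
  ... | tri≈ _ refl _ = inj₂ (h , d)
  ... | tri< k<j _ _  = contradiction (ℕ.<-trans (high d) (low c))
                          (ℕ.≤⇒≯ (lowest≤ c (s≤s (q≤j d)) k<j))
  ... | tri> _ _ j<k  = contradiction
    (lowest d (ℕ.<-≤-trans (i<q d) (ℕ.m≤n⇒m≤1+n (ℕ.<⇒≤ (ℕ.<-≤-trans (i<q c) (q≤j c))))) j<k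
      λ { refl → ℕ.<-irrefl refl (ℕ.<-≤-trans (i<q c) (ℕ.m≤n⇒m≤1+n (q≤j c))) })
    (ℕ.≤⇒≯ j≤i)

  ascend-right : ∀ {q i j} → Cell q i j → V i < V (suc j) →
                 (i ≡ 0 × j ≡ n) ⊎ (∃ λ k → Cell (suc j) i k)
  ascend-right {q} {i} {j} c i<j with ℕ.m≤n⇒m<n∨m≡n (j≤n c)
  ascend-right {q} {zero}  {j} c i<j | inj₂ j≡n = inj₁ (refl , j≡n)
  ascend-right {q} {suc i} {j} c i<j | inj₂ refl =
    contradiction (last (z<s , ℕ.<⇒≤ (ℕ.<-≤-trans (i<q c) (proj₂ (inner c))))) (ℕ.<-asym i<j)
  ascend-right {q} {i} {j} c i<j | inj₁ j<n with cell {suc j} (z<s , j<n)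
  ... | h , k , d with ℕ.<-cmp h i
  ... | tri≈ _ refl _ = inj₂ (k , d)
  ... | tri< h<i _ _  = contradiction i<j (ℕ.≤⇒≯ (lowest≤ d h<i
                          (ℕ.≤-trans (ℕ.<⇒≤ (ℕ.<-≤-trans (i<q c) (q≤j c))) (ℕ.<⇒≤ (q≤j d)))))
  ... | tri> _ _ i<h  = contradiction (ℕ.<-trans (low d) (high c))
                          (ℕ.≤⇒≯ (lowest≤ c i<h (ℕ.≤-pred (i<q d))))

  -- A certificate that the arc is a bridge. It serves for acyclicity and also to show that a
  -- connected subgraph of the arcs contains the arc.
  record Cut (i j : ℕ) : Set₁ where
    field
      Side    : ℕ → Set
      Side?   : ∀ v → Dec (Side v)
      i∈      : Side i
      j∉      : ¬ Side j
      leaving  : ∀ {a b} → Arc V a b → b ≤ n → Side a → ¬ Side b → a ≡ i × b ≡ j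
      entering : ∀ {a b} → Arc V a b → b ≤ n → ¬ Side a → Side b → ⊥

  private
    block? : ∀ i q v → Dec (i ≤ v × v < q)
    block? i q v with i ℕ.≤? v | v ℕ.<? q
    ... | yes a | yes b = yes (a , b)
    ... | no ¬a | _     = no (¬a ∘ proj₁)
    ... | _     | no ¬b = no (¬b ∘ proj₂)

    block?-co : ∀ q j v → Dec (q ≤ v → j < v)
    block?-co q j v with q ℕ.≤? v | j ℕ.<? v
    ... | _      | yes b = yes λ _ → b
    ... | no ¬a  | _     = yes λ a → contradiction a ¬a
    ... | yes a  | no ¬b = no λ f → ¬b (f a)

  -- The lowest inner gap q splits the block i, …, j; the half next to the
  -- higher outer gap meets the other vertices only through the arc i, j.
  cut : ∀ {q i j} → Cell q i j → Cut i j
  cut {q} {i} {j} c with V (suc j) ℕ.≤? V i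
  ... | yes j≤i = record
    { Side = λ v → i ≤ v × v < q ; Side? = block? i q
    ; i∈ = ℕ.≤-refl , i<q c
    ; j∉ = λ { (_ , j<q) → ℕ.<-irrefl refl (ℕ.<-≤-trans j<q (q≤j c)) }
    ; leaving = leaving′
    ; entering = λ { {a} {b} (a<b , ab) _ a∉ (i≤b , b<q) → entering′ a<b ab a∉ i≤b b<q }
    }
    where
    leaving′ : ∀ {a b} → Arc V a b → b ≤ n → i ≤ a × a < q → ¬ (i ≤ b × b < q) → a ≡ i × b ≡ j
    leaving′ {a} {b} (a<b , ab) b≤n (i≤a , a<q) b∉ with ℕ.m≤n⇒m<n∨m≡n i≤a
    ... | inj₁ i<a = contradiction (proj₁ (ab a<q q≤b))
                       (ℕ.≤⇒≯ (lowest≤ c i<a (ℕ.≤-trans (ℕ.<⇒≤ a<q) (q≤j c))))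
      where q≤b = ℕ.≮⇒≥ λ b<q → b∉ (ℕ.≤-trans i≤a (ℕ.<⇒≤ a<b) , b<q)
    ... | inj₂ refl = refl , eq
      where
      q≤b = ℕ.≮⇒≥ λ b<q → b∉ (ℕ.≤-trans i≤a (ℕ.<⇒≤ a<b) , b<q)
      eq : b ≡ j
      eq with ℕ.<-cmp b j
      ... | tri≈ _ b≡j _ = b≡j
      ... | tri< b<j _ _ = contradiction (proj₂ (ab a<q q≤b))
                             (ℕ.≤⇒≯ (lowest≤ c (s≤s (ℕ.<⇒≤ a<b)) b<j))
      ... | tri> _ _ j<b = contradiction (proj₁ (ab (s≤s (ℕ.<⇒≤ (proj₁ (arc c)))) j<b)) (ℕ.≤⇒≯ j≤i)

    entering′ : ∀ {a b} → a < b → (∀ {q} → a < q → q ≤ b → V a < V q × V (suc b) < V q) →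
                ¬ (i ≤ a × a < q) → i ≤ b → b < q → ⊥
    entering′ {a} {b} a<b ab a∉ i≤b b<q =
      ℕ.<-irrefl refl (ℕ.<-≤-trans (ℕ.<-trans (proj₂ (ab a<i i≤b)) (low c))
        (lowest≤ c (s≤s i≤b) (ℕ.≤-trans b<q (q≤j c))))
      where a<i = ℕ.≰⇒> λ i≤a → a∉ (i≤a , ℕ.<-trans a<b b<q)
  -- `Side` is the complement of the half `q, …, j`, so that `i` is inside and `j` outside here as
  -- well.
  ... | no j≰i = record
    { Side = λ v → q ≤ v → j < v ; Side? = block?-co q j
    ; i∈ = λ q≤i → contradiction q≤i (ℕ.<⇒≱ (i<q c))
    ; j∉ = λ f → ℕ.<-irrefl refl (f (q≤j c))
    ; leaving = leaving′
    ; entering = entering′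
    }
    where
    i<j = ℕ.≰⇒> j≰i
    leaving′ : ∀ {a b} → Arc V a b → b ≤ n → (q ≤ a → j < a) → ¬ (q ≤ b → j < b) → a ≡ i × b ≡ j
    leaving′ {a} {b} (a<b , ab) b≤n a∈ b∉ with q ℕ.≤? b | b ℕ.≤? j
    ... | no q≰b  | _       = ⊥-elim (b∉ λ q≤b → contradiction q≤b q≰b)
    ... | yes q≤b | no b≰j  = ⊥-elim (b∉ λ _ → ℕ.≰⇒> b≰j)
    ... | yes q≤b | yes b≤j = eq-a , eq-b
      where
      a<q : a < q
      a<q = ℕ.≰⇒> λ q≤a → ℕ.<⇒≱ (a∈ q≤a) (ℕ.≤-trans (ℕ.<⇒≤ a<b) b≤j)
      eq-b : b ≡ j
      eq-b with ℕ.m≤n⇒m<n∨m≡n b≤j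
      ... | inj₂ b≡j = b≡j
      ... | inj₁ b<j = contradiction (proj₂ (ab a<q q≤b))
                         (ℕ.≤⇒≯ (lowest≤ c (ℕ.<-≤-trans (i<q c) (ℕ.m≤n⇒m≤1+n q≤b)) b<j))
      eq-a : a ≡ i
      eq-a with ℕ.<-cmp a i
      ... | tri≈ _ a≡i _ = a≡i
      ... | tri> _ _ i<a = contradiction (proj₁ (ab a<q q≤b))
                             (ℕ.≤⇒≯ (lowest≤ c i<a (ℕ.≤-trans (ℕ.<⇒≤ a<q) (q≤j c))))
      ... | tri< a<i _ _ = contradiction (subst (λ b → V (suc b) < V i) eq-b
                             (proj₂ (ab a<i (ℕ.≤-trans (ℕ.<⇒≤ (i<q c)) q≤b)))) (ℕ.<-asym i<j)
    entering′ : ∀ {a b} → Arc V a b → b ≤ n → ¬ (q ≤ a → j < a) → (q ≤ b → j < b) → ⊥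
    entering′ {a} {b} (a<b , ab) b≤n a∉ b∈ with q ℕ.≤? a | a ℕ.≤? j
    ... | no q≰a  | _       = a∉ λ q≤a → contradiction q≤a q≰a
    ... | yes q≤a | no a≰j  = a∉ λ _ → ℕ.≰⇒> a≰j
    ... | yes q≤a | yes a≤j = ℕ.<-asym (ℕ.<-≤-trans (high c) (lowest≤ c (ℕ.<-≤-trans (i<q c) q≤a) a≤j))
                                (proj₁ (ab (s≤s a≤j) (b∈ (ℕ.≤-trans q≤a (ℕ.<⇒≤ a<b)))))

  -- The left child in the Cartesian tree. Its right end `p` is the vertex `j′` of the image of an
  -- arc, whether the child is an arc or the single vertex `i`.
  cell-left : ∀ {p i j} → Cell (suc p) i j → i ≡ p ⊎ Arc V i p
  cell-left c with ℕ.m≤n⇒m<n∨m≡n (ℕ.≤-pred (i<q c))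
  ... | inj₂ i≡p = inj₁ i≡p
  ... | inj₁ i<p = inj₂ (i<p , λ i<r r≤p →
    proj₁ (proj₂ (arc c) i<r (ℕ.≤-trans r≤p (ℕ.<⇒≤ (q≤j c)))) ,
    lowest c i<r (ℕ.≤-trans r≤p (ℕ.<⇒≤ (q≤j c))) λ { refl → ℕ.<-irrefl refl r≤p })

  cell-right : ∀ {q i j} → Cell q i j → q ≡ j ⊎ Arc V q j
  cell-right c with ℕ.m≤n⇒m<n∨m≡n (q≤j c)
  ... | inj₂ q≡j = inj₁ q≡j
  ... | inj₁ q<j = inj₂ (q<j , λ q<r r≤j →
    lowest c (ℕ.<-trans (i<q c) q<r) r≤j (λ { refl → ℕ.<-irrefl refl q<r }) ,
    proj₂ (proj₂ (arc c) (ℕ.<-trans (i<q c) q<r) r≤j))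

  parent-low : ∀ {q i j} → Cell q i j → V (parent V i j) < V q
  parent-low {q} {i} {j} c with V (suc j) ℕ.≤? V i
  ... | yes _ = low c
  ... | no  _ = high c

  parent-inner : ∀ {q i j} → Cell q i j → parent V i j ≡ 0 ⊎ parent V i j ≡ suc n ⊎ Inner n (parent V i j)
  parent-inner {q} {i} {j} c with V (suc j) ℕ.≤? V i
  parent-inner {q} {zero}  {j} c | yes _ = inj₁ refl
  parent-inner {q} {suc i} {j} c | yes _ =
    inj₂ (inj₂ (z<s , ℕ.<⇒≤ (ℕ.<-≤-trans (i<q c) (proj₂ (inner c)))))
  parent-inner {q} {i} {j} c | no _ with ℕ.m≤n⇒m<n∨m≡n (j≤n c)
  ... | inj₁ j<n  = inj₂ (inj₂ (z<s , j<n))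
  ... | inj₂ refl = inj₂ (inj₁ refl)

  covers-self : ∀ {q i j} → Cell q i j → Covers i j q
  covers-self c = i<q c , q≤j c

  parent-uncovered : ∀ {q i j} → Cell q i j → ¬ Covers i j (parent V i j)
  parent-uncovered {q} {i} {j} c with V (suc j) ℕ.≤? V i
  ... | yes _ = λ { (i<i , _) → ℕ.<-irrefl refl i<i }
  ... | no  _ = λ { (_ , j<j) → ℕ.<-irrefl refl j<j }

  private
    covered-lower : ∀ {m a b q} → Cell m a b → m ≢ q → Covers a b q → V m < V q
    covered-lower d m≢q (a<q , q≤b) = lowest d a<q q≤b (m≢q ∘ sym)

  -- The gap `m` is lower than `q`, hence outside the block of `q`; comparing heights then pushes
  -- `a` and `b` beyond the higher outer gap of that block. With `parent-covers`, the blocks around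
  -- `q` are its own and those around its parent, which makes `level` telescope along the parent
  -- relation.
  covers-parent : ∀ {q i j m a b} → Cell q i j → Cell m a b → m ≢ q →
                  Covers a b q → Covers a b (parent V i j)
  covers-parent {q} {i} {j} {m} {a} {b} c d m≢q cov@(a<q , q≤b) with V (suc j) ℕ.≤? V i
  ... | yes j≤i = a<i , ℕ.≤-trans (ℕ.<⇒≤ (i<q c)) q≤b
    where
    Vm<Vq = covered-lower d m≢q cov
    m∉ : i < m → m ≤ j → ⊥
    m∉ i<m m≤j = ℕ.<⇒≱ Vm<Vq (lowest≤ c i<m m≤j)
    a<i : a < i
    a<i with ℕ.<-cmp a i
    ... | tri< a<i _ _ = a<i
    ... | tri> _ _ i<a = ⊥-elim (ℕ.<-asym Vm<Vq (ℕ.≤-<-trans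
            (lowest≤ c i<a (ℕ.≤-trans (ℕ.<⇒≤ a<q) (q≤j c))) (low d)))
    ... | tri≈ _ refl _ = ⊥-elim (ℕ.<-irrefl refl (ℕ.≤-<-trans
            (ℕ.≤-trans (lowest≤ d (s≤s (ℕ.<⇒≤ (proj₁ (arc c)))) (ℕ.≤-trans j<m (q≤j d))) j≤i) (low d)))
      where j<m = ℕ.≰⇒> (m∉ (i<q d))
  ... | no j≰i = ℕ.<-≤-trans a<q (ℕ.m≤n⇒m≤1+n (q≤j c)) , j<b
    where
    i<j = ℕ.≰⇒> j≰i
    Vm<Vq = covered-lower d m≢q cov
    m∉ : i < m → m ≤ j → ⊥
    m∉ i<m m≤j = ℕ.<⇒≱ Vm<Vq (lowest≤ c i<m m≤j)
    j<b : j < b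
    j<b with ℕ.<-cmp b j
    ... | tri> _ _ j<b = j<b
    ... | tri< b<j _ _ = ⊥-elim (ℕ.<-asym Vm<Vq (ℕ.≤-<-trans
            (lowest≤ c (ℕ.<-≤-trans (i<q c) (ℕ.m≤n⇒m≤1+n q≤b)) b<j) (high d)))
    ... | tri≈ _ refl _ = ⊥-elim (ℕ.<-asym i<j (ℕ.<-≤-trans (high d)
            (lowest≤ d (ℕ.<-≤-trans (i<q d) m≤i) (ℕ.<⇒≤ (proj₁ (arc c))))))
      where m≤i = ℕ.≮⇒≥ λ i<m → m∉ i<m (q≤j d)

  parent-covers : ∀ {q i j m a b} → Cell q i j → Cell m a b →
                  Covers a b (parent V i j) → Covers a b q
  parent-covers {q} {i} {j} {m} {a} {b} c d (a<p , p≤b) with V (suc j) ℕ.≤? V i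
  ... | yes _ = ℕ.<-trans a<p (i<q c) , ℕ.≮⇒≥ λ b<q →
    ℕ.<-irrefl refl (ℕ.<-≤-trans (ℕ.<-trans (ℕ.<-≤-trans (high d) (lowest≤ d a<p p≤b)) (low c))
      (lowest≤ c (s≤s p≤b) (ℕ.≤-trans b<q (q≤j c))))
  ... | no _ = (ℕ.≰⇒> λ q≤a →
    ℕ.<-irrefl refl (ℕ.<-≤-trans (ℕ.<-trans (ℕ.<-≤-trans (low d) (lowest≤ d a<p p≤b)) (high c))
      (lowest≤ c (ℕ.<-≤-trans (i<q c) q≤a) (ℕ.≤-pred a<p)))) ,
    ℕ.≤-trans (q≤j c) (ℕ.<⇒≤ p≤b)

  gap-induction : (P : ℕ → Set) → P 0 → P (suc n) →
                  (∀ {q i j} → Cell q i j → P (parent V i j) → P q) →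
                  ∀ {q} → Inner n q → P q
  gap-induction P P0 PN step {q} inq = go inq (<-wellFounded (V q))
    where
    go : ∀ {q} → Inner n q → Acc _<_ (V q) → P q
    go {q} inq (acc rs) with cell inq
    ... | i , j , c with parent-inner c
    ... | inj₁ eq          = step c (subst P (sym eq) P0)
    ... | inj₂ (inj₁ eq)   = step c (subst P (sym eq) PN)
    ... | inj₂ (inj₂ inp)  = step c (go inp (rs (parent-low c)))

  module _ {V′ : ℕ → ℕ} (generic′ : Generic n V′)
           (respects : ∀ {q i j} → Cell q i j → V′ (parent V i j) < V′ q) where
    private
      module ′ = Generic generic′

      -- The hypothesis compares `q` only with its higher outer gap. The lower one is also an outer
      -- gap of the parent's block, so its comparison is inherited through the parent.
      ends : ∀ {q i j} → Acc _<_ (V q) → Cell q i j → V′ i < V′ q × V′ (suc j) < V′ q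
      ends {q} {i} {j} (acc rs) c with V (suc j) ℕ.≤? V i | respects c
      ... | yes j≤i | lt with ascend-left c j≤i
      ...   | inj₁ (refl , refl) = lt , ′.last (inner c)
      ...   | inj₂ (h , d)       = lt , ℕ.<-trans (proj₂ (ends (rs (low c)) d)) lt
      ends {q} {i} {j} (acc rs) c | no j≰i | lt with ascend-right c (ℕ.≰⇒> j≰i)
      ...   | inj₁ (refl , refl) = ′.first (inner c) , lt
      ...   | inj₂ (k , d)       = ℕ.<-trans (proj₁ (ends (rs (high c)) d)) lt , lt

      -- Climb from `q` to the outer gap of its cell that lies on the side of `m`: this gap is lower
      -- and still inside the block, so the ascent ends at `m`.
      between : ∀ {m i j} → Cell m i j → ∀ {q} → Acc _<_ (V q) → i < q → q ≤ j →
                V′ i < V′ q × V′ (suc j) < V′ q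
      between {m} {i} {j} c {q} (acc rs) i<q′ q≤j′ with ℕ.<-cmp q m
      ... | tri≈ _ refl _ = ends (<-wellFounded (V q)) c
      ... | tri< q<m _ _ with cell {q} (ℕ.≤-<-trans z≤n i<q′ , ℕ.≤-trans q≤j′ (j≤n c))
      ...   | a , b , d = ℕ.<-trans (proj₁ rec) hi , ℕ.<-trans (proj₂ rec) hi
        where
        hi = proj₂ (ends (<-wellFounded (V q)) d)
        b<m : b < m
        b<m = ℕ.≰⇒> λ m≤b → ℕ.<⇒≱ (lowest c i<q′ q≤j′ (ℕ.<⇒≢ q<m))
                (lowest≤ d (ℕ.<-trans (i<q d) q<m) m≤b)
        rec = between c (rs (high d)) (ℕ.<-≤-trans i<q′ (ℕ.m≤n⇒m≤1+n (q≤j d))) (ℕ.≤-trans b<m (q≤j c))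
      between {m} {i} {j} c {q} (acc rs) i<q′ q≤j′ | tri> _ _ m<q
        with cell {q} (ℕ.≤-<-trans z≤n i<q′ , ℕ.≤-trans q≤j′ (j≤n c))
      ... | a , b , d = ℕ.<-trans (proj₁ rec) lo , ℕ.<-trans (proj₂ rec) lo
        where
        lo = proj₁ (ends (<-wellFounded (V q)) d)
        m≤a : m ≤ a
        m≤a = ℕ.≮⇒≥ λ a<m → ℕ.<⇒≱ (lowest c i<q′ q≤j′ (ℕ.<⇒≢ m<q ∘ sym))
                (lowest≤ d a<m (ℕ.≤-trans (ℕ.<⇒≤ m<q) (q≤j d)))
        rec = between c (rs (low d)) (ℕ.<-≤-trans (i<q c) m≤a) (ℕ.≤-trans (ℕ.<⇒≤ (i<q d)) q≤j′)

    -- Together with `arc⇒respects`, this reduces the many inequalities behind the arcs to one per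
    -- inner gap, the comparison with its parent. These are the facet inequalities of a simplicial
    -- cone.
    respects⇒arc : ∀ {i j} → j ≤ n → Arc V i j → Arc V′ i j
    respects⇒arc j≤n ij@(i<j , _) with arc⇒cell j≤n ij
    ... | m , c = i<j , λ i<q q≤j → between c (<-wellFounded _) i<q q≤j

  arc⇒respects : ∀ {V′ : ℕ → ℕ} → (∀ {i j} → j ≤ n → Arc V i j → Arc V′ i j) →
                 ∀ {q i j} → Cell q i j → V′ (parent V i j) < V′ q
  arc⇒respects sub {q} {i} {j} c with V (suc j) ℕ.≤? V i | proj₂ (sub (j≤n c) (arc c)) (i<q c) (q≤j c)
  ... | yes _ | lt , _ = lt
  ... | no  _ | _ , lt = lt

-- Noncrossing alternating trees

sum-≤ : ∀ {m} {f g : Fin m → ℕ} {c} → (∀ v → f v ≤ c + g v) → sum f ≤ m * c + sum g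
sum-≤ {zero}  f≤ = z≤n
sum-≤ {suc m} {f} {g} {c} f≤ = ℕ.≤-trans (ℕ.+-mono-≤ (f≤ zero) (sum-≤ (f≤ ∘ suc)))
  (ℕ.≤-reflexive (interchange c (g zero) (m * c) (sum (g ∘ suc))))

sum-<-at : ∀ {m} {f g : Fin m → ℕ} {c d} → (∀ v → f v ≤ c + g v) →
           ∀ v₀ → f v₀ + d ≤ c + g v₀ → sum f + d ≤ m * c + sum g
sum-<-at {suc m} {f} {g} {c} {d} f≤ zero f₀≤ = ℕ.≤-trans
  (ℕ.≤-reflexive (xy∙z≈xz∙y (f zero) (sum (f ∘ suc)) d))
  (ℕ.≤-trans (ℕ.+-mono-≤ f₀≤ (sum-≤ (f≤ ∘ suc)))
  (ℕ.≤-reflexive (interchange c (g zero) (m * c) (sum (g ∘ suc)))))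
sum-<-at {suc m} {f} {g} {c} {d} f≤ (suc v₀) f₀≤ = ℕ.≤-trans
  (ℕ.≤-reflexive (ℕ.+-assoc (f zero) (sum (f ∘ suc)) d))
  (ℕ.≤-trans (ℕ.+-mono-≤ (f≤ zero) (sum-<-at (f≤ ∘ suc) v₀ f₀≤))
  (ℕ.≤-reflexive (interchange c (g zero) (m * c) (sum (g ∘ suc)))))

sum-zero : ∀ {m} {f : Fin m → ℕ} → (∀ v → f v ≡ 0) → sum f ≡ 0
sum-zero {zero}  f≡0 = refl
sum-zero {suc m} f≡0 = cong₂ _+_ (f≡0 zero) (sum-zero (f≡0 ∘ suc))

Covers? : ∀ i j q → Dec (Covers i j q)
Covers? i j q = i ℕ.<? q ×-dec q ℕ.≤? j

indicator : ∀ {P : Set} → Dec P → ℕ → ℕ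
indicator d x = if does d then x else 0

indicator-yes : ∀ {P : Set} (d : Dec P) {x} → P → indicator d x ≡ x
indicator-yes (yes _) _ = refl
indicator-yes (no ¬p) p = contradiction p ¬p

indicator-no : ∀ {P : Set} (d : Dec P) {x} → ¬ P → indicator d x ≡ 0
indicator-no (yes p) ¬p = contradiction p ¬p
indicator-no (no _)  _  = refl

module Load {N : ℕ} (G : Graph N) (w : Fin N → ℕ) where

  Over : ℕ → Fin N → Fin N → Set
  Over p u v = E G u v × Covers (toℕ u) (toℕ v) p

  Over? : ∀ p u v → Dec (Over p u v)
  Over? p u v = E? G u v ×-dec Covers? (toℕ u) (toℕ v) p

  term : ℕ → Fin N → Fin N → ℕ
  term p u v = indicator (Over? p u v) (w u)

  -- The prefix sum at the gap `p` of the combination of the roots of `G` in which the edge from `u`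
  -- to `v` has the coefficient `w u`.
  load : ℕ → ℕ
  load p = sum λ u → sum λ v → term p u v

  load-zero : ∀ p → (∀ {u v} → ¬ Over p u v) → load p ≡ 0
  load-zero p none = sum-zero λ u → sum-zero λ v → indicator-no (Over? p u v) none

  -- The crude slack `N * (N * c)` charges `c` to every pair of vertices. The rapidly decaying
  -- weights used for `T` are chosen to absorb it; with `c = 0` it disappears.
  load-exceeds : ∀ p q {c} → (∀ {u v} → Over p u v → ¬ Over q u v → w u ≤ c) →
                 ∀ {u v} → Over q u v → ¬ Over p u v → load p + w u ≤ N * (N * c) + load q
  load-exceeds p q {c} bound {u₀} {v₀} o ¬o =
    sum-<-at (λ u → sum-≤ (pointwise u)) u₀ (sum-<-at (pointwise u₀) v₀ at)
    where
    pointwise : ∀ u v → term p u v ≤ c + term q u v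
    pointwise u v = weigh (Over? p u v) (Over? q u v)
      where
      weigh : (dp : Dec (Over p u v)) (dq : Dec (Over q u v)) →
              indicator dp (w u) ≤ c + indicator dq (w u)
      weigh (no _)   _        = z≤n
      weigh (yes _)  (yes _)  = ℕ.m≤n+m (w u) c
      weigh (yes op) (no ¬oq) = ℕ.m≤n⇒m≤n+o 0 (bound op ¬oq)
    at : term p u₀ v₀ + w u₀ ≤ c + term q u₀ v₀
    at = subst₂ (λ a b → a + w u₀ ≤ c + b) (sym (indicator-no (Over? p u₀ v₀) ¬o))
           (sym (indicator-yes (Over? q u₀ v₀) o)) (ℕ.m≤n+m (w u₀) c)

  load-< : ∀ p q → (∀ {u v} → Over p u v → Over q u v) →
           ∀ {u v} → 0 < w u → Over q u v → ¬ Over p u v → load p < load q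
  load-< p q sub {u} 0<w o ¬o = ℕ.<-≤-trans (ℕ.m<m+n (load p) 0<w)
    (ℕ.≤-trans (load-exceeds p q {c = 0} (λ op ¬oq → contradiction (sub op) ¬oq) o ¬o)
    (ℕ.≤-reflexive (cong (_+ load q) (trans (cong (N *_) (ℕ.*-zeroʳ N)) (ℕ.*-zeroʳ N)))))

star-crossing : ∀ {A : Set} {R : Rel A 0ℓ} {Q : A → Set} → (∀ x → Dec (Q x)) →
                ∀ {x y} → Star R x y → Q x → ¬ Q y → ∃₂ λ a b → R a b × Q a × ¬ Q b
star-crossing Q? done Qx ¬Qy = contradiction Qx ¬Qy
star-crossing Q? (_◅_ {j = z} r rs) Qx ¬Qy with Q? z
... | yes Qz = star-crossing Q? rs Qz ¬Qy
... | no ¬Qz = _ , z , r , Qx , ¬Qz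

-- A cycle through y, v would have to leave Q a second time.
no-cycle : ∀ {A : Set} {R : Rel A 0ℓ} {Q : A → Set} → (∀ x → Dec (Q x)) → ∀ {y v} → Q y → ¬ Q v →
           (∀ {a b} → R a b → Q a → ¬ Q b → a ≡ y × b ≡ v) →
           ∀ {r rs} → Unique (v ∷ y ∷ r ∷ rs) → ¬ Linked R ((y ∷ r ∷ rs) ∷ʳ v)
no-cycle {A} {R} {Q} Q? {y} {v} Qy ¬Qv only {r} {rs} ((_ ∷ v≢r ∷ _) ∷ (y≢r ∷ y∉rs) ∷ _) (y-r ∷ rest)
  with Q? r
... | no ¬Qr = v≢r (sym (proj₂ (only y-r Qy ¬Qr)))
... | yes Qr = trapped Qr (y≢r ∷ y∉rs) rest
  where
  trapped : ∀ {x xs} → Q x → All (y ≢_) (x ∷ xs) → ¬ Linked R ((x ∷ xs) ∷ʳ v)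
  trapped {x} {[]}     Qx (y≢x ∷ _)   (x-v ∷ _)   = y≢x (sym (proj₁ (only x-v Qx ¬Qv)))
  trapped {x} {z ∷ zs} Qx (y≢x ∷ y∉) (x-z ∷ lnk) with Q? z
  ... | yes Qz = trapped Qz y∉ lnk
  ... | no ¬Qz = y≢x (sym (proj₁ (only x-z Qx ¬Qz)))

toℕ≤ : ∀ {n} (i : Fin (suc n)) → toℕ i ≤ n
toℕ≤ i = ℕ.≤-pred (Fin.toℕ<n i)

Represents : ∀ {n} → (ℕ → ℕ) → Graph (suc n) → Set
Represents V G = ∀ i j → E G i j ⇔ Arc V (toℕ i) (toℕ j)

module Represented {n : ℕ} {V : ℕ → ℕ} (generic : Generic n V)
                   (G : Graph (suc n)) (rep : Represents V G) where
  open Cartesian generic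

  edge→arc : ∀ {i j} → E G i j → Arc V (toℕ i) (toℕ j)
  edge→arc = Equivalence.to (rep _ _)

  arc→edge : ∀ {i j} → Arc V (toℕ i) (toℕ j) → E G i j
  arc→edge = Equivalence.from (rep _ _)

  noncrossing : Noncrossing G
  noncrossing i<j j<k k<l (ik , jl) = arc-noncrossing V i<j j<k k<l (edge→arc ik) (edge→arc jl)

  alternating : Alternating G
  alternating (ij , jk) = arc-alternating V (edge→arc ij) (edge→arc jk)

  edge-cut : ∀ {i j} → E G i j → Cut (toℕ i) (toℕ j)
  edge-cut {j = j} ij = cut (proj₂ (arc⇒cell (toℕ≤ j) (edge→arc ij)))

  forest : IsForest G
  forest v []          (() , _)
  forest v (y ∷ [])    (s≤s () , _)
  forest v (y ∷ r ∷ rs) (_ , uniq , fwd vy ∷ rest) =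
    -- Here `v` is the left endpoint and lies in `Side`, whereas `Q` has to contain `y`: the
    -- complement is taken.
    no-cycle {Q = ¬_ ∘ Side ∘ toℕ} (¬? ∘ Side? ∘ toℕ) j∉ (λ ¬i∈ → ¬i∈ i∈) only uniq rest
    where
    open Cut (edge-cut vy)
    only : ∀ {a b} → Adj G a b → ¬ Side (toℕ a) → ¬ ¬ Side (toℕ b) → a ≡ y × b ≡ v
    only {a} {b} (fwd ab) a∉ b∈ =
      ⊥-elim (entering (edge→arc ab) (toℕ≤ b) a∉ (decidable-stable (Side? (toℕ b)) b∈))
    only {a} {b} (bwd ba) a∉ b∈ with leaving (edge→arc ba) (toℕ≤ a) (decidable-stable (Side? (toℕ b)) b∈) a∉
    ... | b≡ , a≡ = Fin.toℕ-injective a≡ , Fin.toℕ-injective b≡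
  forest v (y ∷ r ∷ rs) (_ , uniq , bwd yv ∷ rest) =
    no-cycle {Q = Side ∘ toℕ} (Side? ∘ toℕ) i∈ j∉ only uniq rest
    where
    open Cut (edge-cut yv)
    only : ∀ {a b} → Adj G a b → Side (toℕ a) → ¬ Side (toℕ b) → a ≡ y × b ≡ v
    only {a} {b} (fwd ab) a∈ b∉ with leaving (edge→arc ab) (toℕ≤ b) a∈ b∉
    ... | a≡ , b≡ = Fin.toℕ-injective a≡ , Fin.toℕ-injective b≡
    only {a} {b} (bwd ba) a∈ b∉ = ⊥-elim (entering (edge→arc ba) (toℕ≤ a) b∉ a∈)

  private
    Conn : ℕ → ℕ → Set
    Conn a b = ∀ {x y : Fin (suc n)} → toℕ x ≡ a → toℕ y ≡ b → Star (Adj G) x y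

    conn-trans : ∀ {a b c} → b ≤ n → Conn a b → Conn b c → Conn a c
    conn-trans b≤n ab bc x≡ y≡ = ab x≡ (Fin.toℕ-fromℕ< (s≤s b≤n)) ◅◅ bc (Fin.toℕ-fromℕ< (s≤s b≤n)) y≡

    conn-sym : ∀ {a b} → Conn a b → Conn b a
    conn-sym ab x≡ y≡ = reverse (symmetric (E G)) (ab y≡ x≡)

    conn-refl : ∀ {a} → Conn a a
    conn-refl x≡ y≡ with refl ← Fin.toℕ-injective (trans x≡ (sym y≡)) = done

    -- Both halves around the lowest gap are connected by recursion, and the arc from `i` to `j`
    -- joins them.
    block : ∀ {i j} → Acc _<_ (j ∸ i) → i ≡ j ⊎ Arc V i j → j ≤ n → ∀ {v} → i ≤ v → v ≤ j → Conn i v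
    block _ (inj₁ refl) _ i≤v v≤j with refl ← ℕ.≤-antisym i≤v v≤j = conn-refl
    block {i} {j} (acc rs) (inj₂ ij) j≤n′ {v} i≤v v≤j with arc⇒cell j≤n′ ij
    ... | suc p , c with v ℕ.≤? p
    ...   | yes v≤p = block (rs (ℕ.∸-monoˡ-< (q≤j c) (ℕ.≤-pred (i<q c)))) (cell-left c)
                        (ℕ.≤-trans (ℕ.<⇒≤ (q≤j c)) j≤n′) i≤v v≤p
    ...   | no v≰p = conn-trans j≤n′ edge (conn-trans (proj₂ (inner c)) (conn-sym (right (q≤j c) ℕ.≤-refl)) (right (ℕ.≰⇒> v≰p) v≤j))
      where
      edge : Conn i j
      edge refl refl = fwd (arc→edge ij) ◅ done
      right : ∀ {v} → suc p ≤ v → v ≤ j → Conn (suc p) v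
      right = block (rs (ℕ.∸-monoʳ-< (i<q c) (q≤j c))) (cell-right c) j≤n′

  whole : 0 < n → Arc V 0 n
  whole 0<n = 0<n , λ 0<q q≤n → Generic.first generic (0<q , q≤n) , Generic.last generic (0<q , q≤n)

  connected : Connected G
  connected u v = reverse (symmetric (E G)) (from-first u) ◅◅ from-first v
    where
    from-first : ∀ v → Star (Adj G) zero v
    from-first v with ℕ.m≤n⇒m<n∨m≡n (z≤n {n})
    ... | inj₁ 0<n = block (<-wellFounded _) (inj₂ (whole 0<n)) ℕ.≤-refl z≤n (toℕ≤ v) refl refl
    ... | inj₂ 0≡n = block (<-wellFounded _) (inj₁ 0≡n) ℕ.≤-refl z≤n (toℕ≤ v) refl refl

-- Removing an arc disconnects the arcs of V, so a connected subgraph has them all.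
connected-arcs : ∀ {n} {V : ℕ → ℕ} → Generic n V → (G : Graph (suc n)) → Connected G →
                 (∀ {i j} → E G i j → Arc V (toℕ i) (toℕ j)) → Represents V G
connected-arcs {n} {V} generic G conn sub i j = mk⇔ sub from
  where
  open Cartesian generic
  from : Arc V (toℕ i) (toℕ j) → E G i j
  from ij with star-crossing (Side? ∘ toℕ) (conn i j) i∈ j∉
    where open Cut (cut (proj₂ (arc⇒cell (toℕ≤ j) ij)))
  ... | a , b , fwd ab , a∈ , b∉ = subst₂ (E G) (Fin.toℕ-injective (proj₁ eq)) (Fin.toℕ-injective (proj₂ eq)) ab
    where eq = Cut.leaving (cut (proj₂ (arc⇒cell (toℕ≤ j) ij))) (sub ab) (toℕ≤ b) a∈ b∉
  ... | a , b , bwd ba , a∈ , b∉ =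
    ⊥-elim (Cut.entering (cut (proj₂ (arc⇒cell (toℕ≤ j) ij))) (sub ba) (toℕ≤ a) b∉ a∈)

module Height {n : ℕ} (G : Graph (suc n)) where
  open Load G (λ _ → 1)

  -- The term q % (n + 1) only breaks ties.
  height : ℕ → ℕ
  height q = q % suc n + load q * suc n

  height-first : height 0 ≡ 0
  height-first = cong (λ l → 0 % suc n + l * suc n) (load-zero 0 λ { (_ , () , _) })

  -- The remainder modulo `suc n` separates the inner gaps and yet vanishes at both outermost ones.
  height-last : height (suc n) ≡ 0
  height-last = cong₂ (λ a l → a + l * suc n) (n%n≡0 (suc n))
    (load-zero (suc n) λ { {v = v} (_ , _ , N≤v) → ℕ.<⇒≱ (Fin.toℕ<n v) N≤v })

  height-inner : ∀ q → Inner n q → height q % suc n ≡ q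
  height-inner q (_ , q≤n) = trans ([m+kn]%n≡m%n (q % suc n) (load q) (suc n))
    (trans (cong (_% suc n) q%) q%)
    where q% = m<n⇒m%n≡m (s≤s q≤n)

  height-positive : ∀ q → Inner n q → 0 < height q
  height-positive q (0<q , q≤n) =
    ℕ.<-≤-trans 0<q (ℕ.m≤n⇒m≤n+o (load q * suc n) (ℕ.≤-reflexive (sym (m<n⇒m%n≡m (s≤s q≤n)))))

  height-generic : Generic n height
  height-generic = record
    { injective = λ {p} {q} inp inq eq → trans (sym (height-inner p inp)) (trans (cong (_% suc n) eq) (height-inner q inq))
    ; first     = λ {q} inq → subst (_< height q) (sym height-first) (height-positive q inq)
    ; last      = λ {q} inq → subst (_< height q) (sym height-last) (height-positive q inq)
    }

  height-< : ∀ p q → load p < load q → height p < height q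
  height-< p q lt = ℕ.<-≤-trans (ℕ.+-monoˡ-< (load p * suc n) (m%n<n p (suc n)))
    (ℕ.≤-trans (ℕ.*-monoˡ-≤ (suc n) lt) (ℕ.m≤n+m (load q * suc n) (q % suc n)))

  module _ (nc : Noncrossing G) (alt : Alternating G) where

    -- An edge over the gap `i` reaches at least to `j`: ending at `i` would contradict alternation,
    -- and ending strictly between would cross the edge from `i` to `j`. So it also passes over
    -- every inner gap, where the edge from `i` to `j` adds to the load. The right side is
    -- symmetric.
    edge⇒arc : ∀ {i j} → E G i j → Arc height (toℕ i) (toℕ j)
    edge⇒arc {i} {j} ij = E⇒< G ij , λ {q} i<q q≤j →
      height-< (toℕ i) q (load-< (toℕ i) q (left i<q q≤j) z<s (ij , i<q , q≤j) λ { (_ , i<i , _) → ℕ.<-irrefl refl i<i }) ,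
      height-< (suc (toℕ j)) q (load-< (suc (toℕ j)) q (right i<q q≤j) z<s (ij , i<q , q≤j) λ { (_ , _ , j<j) → ℕ.<-irrefl refl j<j })
      where
      left : ∀ {q} → toℕ i < q → q ≤ toℕ j → ∀ {a b} → Over (toℕ i) a b → Over q a b
      left i<q q≤j {a} {b} (ab , a<i , i≤b) with ℕ.m≤n⇒m<n∨m≡n i≤b | toℕ b ℕ.<? toℕ j
      ... | inj₂ i≡b | _       with refl ← Fin.toℕ-injective i≡b = ⊥-elim (alt (ab , ij))
      ... | inj₁ i<b | yes b<j = ⊥-elim (nc a<i i<b b<j (ab , ij))
      ... | inj₁ i<b | no b≮j  = ab , ℕ.<-trans a<i i<q , ℕ.≤-trans q≤j (ℕ.≮⇒≥ b≮j)

      right : ∀ {q} → toℕ i < q → q ≤ toℕ j → ∀ {a b} → Over (suc (toℕ j)) a b → Over q a b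
      right i<q q≤j {a} {b} (ab , s≤s a≤j , j<b) with ℕ.m≤n⇒m<n∨m≡n a≤j | toℕ i ℕ.<? toℕ a
      ... | inj₂ a≡j | _       with refl ← Fin.toℕ-injective a≡j = ⊥-elim (alt (ij , ab))
      ... | inj₁ a<j | yes i<a = ⊥-elim (nc i<a a<j j<b (ij , ab))
      ... | inj₁ a<j | no i≮a  = ab , ℕ.≤-<-trans (ℕ.≮⇒≥ i≮a) i<q , ℕ.≤-trans q≤j (ℕ.<⇒≤ j<b)

    height-represents : Connected G → Represents height G
    height-represents conn = connected-arcs height-generic G conn edge⇒arc

-- The cone of T

sum-mono : ∀ {m} {f g : Fin m → ℕ} → (∀ v → f v ≤ g v) → sum f ≤ sum g
sum-mono {zero}  f≤g = z≤n
sum-mono {suc m} f≤g = ℕ.+-mono-≤ (f≤g zero) (sum-mono (f≤g ∘ suc))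

indicator-≤ : ∀ {P : Set} (d : Dec P) x → indicator d x ≤ x
indicator-≤ (yes _) x = ℕ.≤-refl
indicator-≤ (no _)  x = z≤n

star⇒closure : ∀ {N} (T : Graph N) {i j} → i ≢ j → Star (E T) i j → E (closure T) i j
star⇒closure T i≢j done        = contradiction refl i≢j
star⇒closure T i≢j (e ◅ es) = go e es
  where
  go : ∀ {i k j} → E T i k → Star (E T) k j → TransClosure (E T) i j
  go e done         = [ e ]
  go e (e′ ◅ es) = e ∷ go e′ es

closure⇒star : ∀ {N} (T : Graph N) {i j} → E (closure T) i j → Star (E T) i j
closure⇒star T [ e ]    = e ◅ done
closure⇒star T (e ∷ es) = e ◅ closure⇒star T es

star⇒≤ : ∀ {N} (T : Graph N) {i j} → Star (E T) i j → toℕ i ≤ toℕ j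
star⇒≤ T done        = ℕ.≤-refl
star⇒≤ T (e ◅ es) = ℕ.≤-trans (ℕ.<⇒≤ (E⇒< T e)) (star⇒≤ T es)

module Target {n : ℕ} (T : Graph (suc n)) (nc : Noncrossing T) (conn : Connected T) where

  -- The block consists of the vertices `p, …, q - 1`, those between the gaps `p` and `q`.
  Enters : ℕ → ℕ → Set
  Enters p q = ∃₂ λ u v → E T u v × toℕ u < p × p ≤ toℕ v × toℕ v < q

  Leaves : ℕ → ℕ → Set
  Leaves p q = ∃₂ λ u v → E T u v × p ≤ toℕ u × toℕ u < q × q ≤ toℕ v

  Enters? : ∀ p q → Dec (Enters p q)
  Enters? p q = Fin.any? λ u → Fin.any? λ v →
    E? T u v ×-dec toℕ u ℕ.<? p ×-dec p ℕ.≤? toℕ v ×-dec toℕ v ℕ.<? q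

  Leaves? : ∀ p q → Dec (Leaves p q)
  Leaves? p q = Fin.any? λ u → Fin.any? λ v →
    E? T u v ×-dec p ℕ.≤? toℕ u ×-dec toℕ u ℕ.<? q ×-dec q ℕ.≤? toℕ v

  boundary : ∀ {p q} → p < q → q ≤ suc n → 0 < p ⊎ q ≤ n → Enters p q ⊎ Leaves p q
  boundary {p} {q} p<q q≤N proper = crossing (outside proper)
    where
    Block : Fin (suc n) → Set
    Block v = p ≤ toℕ v × toℕ v < q
    block? : ∀ v → Dec (Block v)
    block? v = p ℕ.≤? toℕ v ×-dec toℕ v ℕ.<? q
    start : Fin (suc n)
    start = fromℕ< (ℕ.<-≤-trans p<q q≤N)
    start≡ : toℕ start ≡ p
    start≡ = Fin.toℕ-fromℕ< _
    outside : 0 < p ⊎ q ≤ n → ∃ λ v → ¬ Block v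
    outside (inj₁ 0<p) = zero , λ (p≤0 , _) → ℕ.<⇒≱ 0<p p≤0
    outside (inj₂ q≤n) = fromℕ< (s≤s q≤n) , λ (_ , q<q) → ℕ.<-irrefl (Fin.toℕ-fromℕ< (s≤s q≤n)) q<q
    crossing : (∃ λ v → ¬ Block v) → Enters p q ⊎ Leaves p q
    crossing (v , v∉) with star-crossing block? (conn start v)
      (ℕ.≤-reflexive (sym start≡) , subst (_< q) (sym start≡) p<q) v∉
    ... | a , b , fwd ab , (p≤a , a<q) , b∉ =
      inj₂ (a , b , ab , p≤a , a<q , ℕ.≮⇒≥ λ b<q → b∉ (ℕ.≤-trans p≤a (ℕ.<⇒≤ (E⇒< T ab)) , b<q))
    ... | a , b , bwd ba , (p≤a , a<q) , b∉ =
      inj₁ (b , a , ba , ℕ.≰⇒> (λ p≤b → b∉ (p≤b , ℕ.<-trans (E⇒< T ba) a<q)) , p≤a , a<q)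

  private
    N M : ℕ
    N = suc n
    M = suc (N * N)

    weight : Fin N → ℕ
    weight u = M ^ (n ∸ toℕ u)

    weight-pos : ∀ u → 0 < weight u
    weight-pos u = ℕ.m^n>0 M (n ∸ toℕ u)

  open Load T weight using (Over; term; load; load-<; load-exceeds; load-zero)

  -- An interior direction of the cone of T. The weight of an edge depends on its
  -- left endpoint, so that the edges entering a block outweigh those leaving it.
  ω : ℕ → ℕ
  ω = load

  ω-first : ω 0 ≡ 0
  ω-first = load-zero 0 λ { (_ , () , _) }

  ω-last : ω (suc n) ≡ 0
  ω-last = load-zero (suc n) λ { {v = v} (_ , _ , N≤v) → ℕ.<⇒≱ (Fin.toℕ<n v) N≤v }

  -- The edges over `q` but not over `p` start at `p` or later, so there are at most `N * N` of
  -- them, each of weight at most `c`. In exchange `q` misses the entering edge, whose weight is at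
  -- least `M * c`; this is more because `M` is `suc (N * N)`.
  ω-enters : ∀ {p q} → Enters p q → ω q < ω p
  ω-enters {p} {q} (u , v , uv , u<p , p≤v , v<q) = ℕ.+-cancelʳ-< (weight u) (ω q) (ω p)
    (ℕ.≤-<-trans (load-exceeds q p bound (uv , u<p , p≤v) λ { (_ , _ , q≤v) → ℕ.<⇒≱ v<q q≤v })
      (subst (N * (N * c) + ω p <_) (ℕ.+-comm (weight u) (ω p)) (ℕ.+-monoˡ-< (ω p) small)))
    where
    c = M ^ (n ∸ p)
    bound : ∀ {a b} → Over q a b → ¬ Over p a b → weight a ≤ c
    bound {a} {b} (ab , a<q , q≤b) ¬o = ℕ.^-monoʳ-≤ M (ℕ.∸-monoʳ-≤ n (ℕ.≮⇒≥ λ a<p →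
      ¬o (ab , a<p , ℕ.≤-trans (ℕ.≤-trans p≤v (ℕ.<⇒≤ v<q)) q≤b)))
    small : N * (N * c) < weight u
    small = ℕ.<-≤-trans
      (subst (_< M * c) (ℕ.*-assoc N N c) (ℕ.m<n+m (N * N * c) (ℕ.m^n>0 M (n ∸ p))))
      (ℕ.^-monoʳ-≤ M (ℕ.∸-monoʳ-< u<p (ℕ.≤-trans p≤v (toℕ≤ v))))

  -- When nothing enters, every edge over `p` continues over `q`. Since `boundary` provides an
  -- entering or a leaving edge for every proper block, the sign of the difference is determined by
  -- `Enters` alone.
  ω-leaves : ∀ {p q} → p < q → ¬ Enters p q → Leaves p q → ω p < ω q
  ω-leaves {p} {q} p<q ¬enters (u , v , uv , p≤u , u<q , q≤v) =
    load-< p q sub (weight-pos u) (uv , u<q , q≤v) λ { (_ , u<p , _) → ℕ.<⇒≱ u<p p≤u }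
    where
    sub : ∀ {a b} → Over p a b → Over q a b
    sub {a} {b} (ab , a<p , p≤b) = ab , ℕ.<-trans a<p p<q , ℕ.≮⇒≥ λ b<q → ¬enters (a , b , ab , a<p , p≤b , b<q)

  ω-rise⇒¬enters : ∀ {p q} → ω p ≤ ω q → ¬ Enters p q
  ω-rise⇒¬enters ωp≤ωq en = ℕ.<⇒≱ (ω-enters en) ωp≤ωq

  ω-fall⇒enters : ∀ {p q} → p < q → q ≤ n → ω q < ω p → Enters p q
  ω-fall⇒enters {p} {q} p<q q≤n lt with Enters? p q
  ... | yes en = en
  ... | no ¬en with boundary p<q (ℕ.m≤n⇒m≤1+n q≤n) (inj₂ q≤n)
  ...   | inj₁ en = en
  ...   | inj₂ lv = contradiction (ω-leaves p<q ¬en lv) (ℕ.<-asym lt)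

  ω-separates : ∀ {p q} → p < q → q ≤ suc n → 0 < p ⊎ q ≤ n → ω p ≢ ω q
  ω-separates {p} {q} p<q q≤N proper with Enters? p q | boundary p<q q≤N proper
  ... | yes en | _       = ℕ.<⇒≢ (ω-enters en) ∘ sym
  ... | no ¬en | inj₁ en = contradiction en ¬en
  ... | no ¬en | inj₂ lv = ℕ.<⇒≢ (ω-leaves p<q ¬en lv)

  ω-injective : ∀ {p q} → Inner n p → Inner n q → ω p ≡ ω q → p ≡ q
  ω-injective {p} {q} (0<p , p≤n) (0<q , q≤n) eq with ℕ.<-cmp p q
  ... | tri≈ _ p≡q _ = p≡q
  ... | tri< p<q _ _ = contradiction eq (ω-separates p<q (ℕ.m≤n⇒m≤1+n q≤n) (inj₁ 0<p))
  ... | tri> _ _ q<p = contradiction (sym eq) (ω-separates q<p (ℕ.m≤n⇒m≤1+n p≤n) (inj₁ 0<q))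

  ω-positive : ∀ {q} → Inner n q → 0 < ω q
  ω-positive {q} (0<q , q≤n) = ℕ.n≢0⇒n>0 λ ωq≡0 →
    ω-separates 0<q (ℕ.m≤n⇒m≤1+n q≤n) (inj₂ q≤n) (trans ω-first (sym ωq≡0))

  private
    K : ℕ
    K = suc (sum {N} λ u → sum {N} λ v → weight u)

    ω<K : ∀ q → ω q < K
    ω<K q = s≤s (sum-mono λ u → sum-mono λ v → indicator-≤ (Load.Over? T weight q u v) (weight u))

  -- What is kept of the inequalities of the cone of `T`, written for prefix sums: a change across a
  -- block must be carried by edges of the matching direction.
  record ConeHeight (W : ℕ → ℕ) : Set where
    field
      first : W 0 ≡ 0
      last  : W (suc n) ≡ 0
      rise  : ∀ {p q} → p < q → q ≤ suc n → W p < W q → Leaves p q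
      fall  : ∀ {p q} → p < q → q ≤ suc n → W q < W p → Enters p q

  -- W pushed slightly towards the interior of the cone; the multiple of W
  -- is so large that ω only breaks ties.
  perturb : (ℕ → ℕ) → ℕ → ℕ
  perturb W q = ω q + W q * K

  perturb-< : ∀ W {p q} → W p < W q → perturb W p < perturb W q
  perturb-< W {p} {q} lt = ℕ.<-≤-trans (ℕ.+-monoˡ-< (W p * K) (ω<K p))
    (ℕ.≤-trans (ℕ.*-monoˡ-≤ K lt) (ℕ.m≤n+m (W q * K) (ω q)))

  perturb-tie : ∀ W {p q} → W p ≡ W q → ω p < ω q → perturb W p < perturb W q
  perturb-tie W {p} {q} eq lt = ℕ.+-mono-<-≤ lt (ℕ.≤-reflexive (cong (_* K) eq))

  perturb-<⁻ : ∀ W {p q} → perturb W p < perturb W q → W p < W q ⊎ (W p ≡ W q × ω p < ω q)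
  perturb-<⁻ W {p} {q} lt with ℕ.<-cmp (W p) (W q)
  ... | tri< Wp<Wq _ _ = inj₁ Wp<Wq
  ... | tri> _ _ Wq<Wp = contradiction (perturb-< W Wq<Wp) (ℕ.<-asym lt)
  ... | tri≈ _ eq _    = inj₂ (eq , ℕ.+-cancelʳ-< (W q * K) (ω p) (ω q)
    (subst (λ x → ω p + x * K < perturb W q) eq lt))

  perturb-≡⁻ : ∀ W {p q} → perturb W p ≡ perturb W q → ω p ≡ ω q
  perturb-≡⁻ W {p} {q} eq with ℕ.<-cmp (W p) (W q) | ℕ.<-cmp (ω p) (ω q)
  ... | tri< lt _ _ | _            = contradiction eq (ℕ.<⇒≢ (perturb-< W lt))
  ... | tri> _ _ gt | _            = contradiction (sym eq) (ℕ.<⇒≢ (perturb-< W gt))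
  ... | tri≈ _ e _  | tri< lt _ _  = contradiction eq (ℕ.<⇒≢ (perturb-tie W e lt))
  ... | tri≈ _ e _  | tri> _ _ gt  = contradiction (sym eq) (ℕ.<⇒≢ (perturb-tie W (sym e) gt))
  ... | tri≈ _ _ _  | tri≈ _ ω≡ _  = ω≡

  perturb-generic : ∀ {W} → W 0 ≡ 0 → W (suc n) ≡ 0 → Generic n (perturb W)
  perturb-generic {W} W0 WN = record
    { injective = λ inp inq eq → ω-injective inp inq (perturb-≡⁻ W eq)
    ; first     = λ {q} inq → subst (_< perturb W q) (sym (cong₂ (λ a b → a + b * K) ω-first W0)) (positive inq)
    ; last      = λ {q} inq → subst (_< perturb W q) (sym (cong₂ (λ a b → a + b * K) ω-last WN)) (positive inq)
    }
    where
    positive : ∀ {q} → Inner n q → 0 < perturb W q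
    positive {q} inq = ℕ.<-≤-trans (ω-positive inq) (ℕ.m≤m+n (ω q) (W q * K))

  -- A step of the path that jumped over `u` would cross the edge from `u` to `v`, as `v` lies
  -- beyond the end of the path. In `passes-right`, `u` lies before its start instead.
  passes-left : ∀ {u v p q} → E T u v → Star (E T) p q →
                toℕ p ≤ toℕ u → toℕ u ≤ toℕ q → toℕ q < toℕ v → Star (E T) p u
  passes-left uv done p≤u u≤p _ with refl ← Fin.toℕ-injective (ℕ.≤-antisym p≤u u≤p) = done
  passes-left {u} uv (_◅_ {j = k} pk kq) p≤u u≤q q<v with ℕ.m≤n⇒m<n∨m≡n p≤u | toℕ k ℕ.≤? toℕ u
  ... | inj₂ p≡u | _       with refl ← Fin.toℕ-injective p≡u = done
  ... | inj₁ p<u | yes k≤u = pk ◅ passes-left uv kq k≤u u≤q q<v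
  ... | inj₁ p<u | no k≰u  = ⊥-elim (nc p<u (ℕ.≰⇒> k≰u) (ℕ.≤-<-trans (star⇒≤ T kq) q<v) (pk , uv))

  passes-right : ∀ {u v p q} → E T u v → Star (E T) p q →
                 toℕ u < toℕ p → toℕ p ≤ toℕ v → toℕ v ≤ toℕ q → Star (E T) p v × Star (E T) v q
  passes-right uv done u<p p≤v v≤p with refl ← Fin.toℕ-injective (ℕ.≤-antisym p≤v v≤p) = done , done
  passes-right {u} {v} uv (_◅_ {j = k} pk kq) u<p p≤v v≤q with ℕ.m≤n⇒m<n∨m≡n p≤v | toℕ k ℕ.≤? toℕ v
  ... | inj₂ p≡v | _       with refl ← Fin.toℕ-injective p≡v = done , pk ◅ kq
  ... | inj₁ p<v | yes k≤v =
    let kv , vq = passes-right uv kq (ℕ.<-trans u<p (E⇒< T pk)) k≤v v≤q in pk ◅ kv , vq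
  ... | inj₁ p<v | no k≰v  = ⊥-elim (nc u<p p<v (ℕ.≰⇒> k≰v) (uv , pk))

  path-enters : ∀ {i j} → Star (E T) i j → ∀ {q} → toℕ i < q → q ≤ toℕ j → Enters q (suc (toℕ j))
  path-enters done i<q q≤i = contradiction q≤i (ℕ.<⇒≱ i<q)
  path-enters (_◅_ {i = i} {j = k} ik kj) {q} i<q q≤j with q ℕ.≤? toℕ k
  ... | yes q≤k = i , k , ik , i<q , q≤k , s≤s (star⇒≤ T kj)
  ... | no q≰k  = path-enters kj (ℕ.≰⇒> q≰k) q≤j

  module _ {W : ℕ → ℕ} (height : ConeHeight W) where
    open ConeHeight height

    perturb-rise : ∀ {p q} → p < q → q ≤ suc n → 0 < p ⊎ q ≤ n → perturb W p < perturb W q → Leaves p q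
    perturb-rise p<q q≤N proper lt with perturb-<⁻ W lt
    ... | inj₁ W< = rise p<q q≤N W<
    ... | inj₂ (_ , ω<) with boundary p<q q≤N proper
    ...   | inj₁ en = contradiction en (ω-rise⇒¬enters (ℕ.<⇒≤ ω<))
    ...   | inj₂ lv = lv

    perturb-fall : ∀ {p q} → p < q → q ≤ suc n → 0 < p ⊎ q ≤ n → perturb W q < perturb W p → Enters p q
    perturb-fall {p} {q} p<q q≤N proper lt with perturb-<⁻ W lt
    ... | inj₁ W< = fall p<q q≤N W<
    ... | inj₂ (_ , ω<) with Enters? p q | boundary p<q q≤N proper
    ...   | yes en | _       = en
    ...   | no _   | inj₁ en = en
    ...   | no ¬en | inj₂ lv = contradiction (ω-leaves p<q ¬en lv) (ℕ.<-asym ω<)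

    private
      -- The gap after `m` is higher than both outer gaps. Hence some edge enters the vertices after
      -- `m` up to `j`, and some edge leaves `i, …, m`. If neither stayed within `i, …, j`, the two
      -- would cross; one that does stay starts at a vertex of the path, by `passes-left`.
      advance : ∀ {i m j} → Arc (perturb W) (toℕ i) (toℕ j) → Star (E T) i m → toℕ m < toℕ j →
                ∃ λ m′ → toℕ m < toℕ m′ × toℕ m′ ≤ toℕ j × Star (E T) i m′
      advance {i} {m} {j} (_ , ij) im m<j
        with perturb-fall {suc (toℕ m)} {suc (toℕ j)} (s≤s m<j) (s≤s (toℕ≤ j)) (inj₁ z<s)
               (proj₂ (ij (s≤s (star⇒≤ T im)) m<j))
           | perturb-rise {toℕ i} {suc (toℕ m)} (s≤s (star⇒≤ T im)) (ℕ.m≤n⇒m≤1+n (ℕ.<-≤-trans m<j (toℕ≤ j)))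
               (inj₂ (ℕ.<-≤-trans m<j (toℕ≤ j))) (proj₁ (ij (s≤s (star⇒≤ T im)) m<j))
      ... | u′ , v′ , uv′ , s≤s u′≤m , m<v′ , s≤s v′≤j | u , v , uv , i≤u , s≤s u≤m , m<v
        with toℕ i ℕ.≤? toℕ u′ | toℕ v ℕ.≤? toℕ j
      ... | yes i≤u′ | _ = v′ , m<v′ , v′≤j , passes-left uv′ im i≤u′ u′≤m m<v′ ◅◅ (uv′ ◅ done)
      ... | no _ | yes v≤j = v , m<v , v≤j , passes-left uv im i≤u u≤m m<v ◅◅ (uv ◅ done)
      ... | no i≰u′ | no v≰j = ⊥-elim (nc (ℕ.<-≤-trans (ℕ.≰⇒> i≰u′) i≤u) (ℕ.≤-<-trans u≤m m<v′)
                                 (ℕ.≤-<-trans v′≤j (ℕ.≰⇒> v≰j)) (uv′ , uv))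

      reach : ∀ {i m j} → Arc (perturb W) (toℕ i) (toℕ j) → Acc _<_ (toℕ j ∸ toℕ m) →
              Star (E T) i m → toℕ m ≤ toℕ j → Star (E T) i j
      reach ij (acc rs) im m≤j with ℕ.m≤n⇒m<n∨m≡n m≤j
      ... | inj₂ m≡j with refl ← Fin.toℕ-injective m≡j = im
      ... | inj₁ m<j with advance ij im m<j
      ...   | m′ , m<m′ , m′≤j , im′ = reach ij (rs (ℕ.∸-monoʳ-< m<m′ m′≤j)) im′ m′≤j

    perturb-arc⇒closure : ∀ {i j} → Arc (perturb W) (toℕ i) (toℕ j) → E (closure T) i j
    perturb-arc⇒closure ij@(i<j , _) =
      star⇒closure T (λ { refl → ℕ.<-irrefl refl i<j }) (reach ij (<-wellFounded _) done (ℕ.<⇒≤ i<j))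

  module Sign {V : ℕ → ℕ} (generic : Generic n V) (Tm : Graph (suc n)) (rep : Represents V Tm)
              (sub : E Tm ⇒ E (closure T)) where
    open Cartesian generic
    open Represented generic Tm rep

    private
      vertex : ∀ {v} → v ≤ n → ∃ λ (x : Fin (suc n)) → toℕ x ≡ v
      vertex v≤n = fromℕ< (s≤s v≤n) , Fin.toℕ-fromℕ< (s≤s v≤n)

      path : ∀ {i j} → E Tm i j → Star (E T) i j
      path ij = closure⇒star T (sub ij)

    left-vertex : ∀ {i j} → E Tm i j → LeftVertex Tm i
    left-vertex ij k (fwd ik) = E⇒< Tm ik
    left-vertex ij k (bwd ki) = ⊥-elim (alternating (ki , ij))

    module _ {p} {i j : Fin (suc n)} (c : Cell (suc p) (toℕ i) (toℕ j)) where

      ij : E Tm i j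
      ij = arc→edge (arc c)

      neighbour-below : ∀ {v} → toℕ v < toℕ j → E Tm i v → toℕ v ≤ p
      neighbour-below {v} v<j iv = ℕ.≮⇒≥ λ p<v → ℕ.<-asym
        (proj₂ (proj₂ (edge→arc iv) (i<q c) p<v))
        (lowest c (ℕ.m≤n⇒m≤1+n (E⇒< Tm iv)) v<j λ { refl → ℕ.<-irrefl refl p<v })

      -- If the parent were the gap `suc j`, its arc would join `i` to a larger neighbour than `j`.
      -- So the parent is the gap `i`, and the path of `T` from `i′` to `j′` enters the block
      -- `i, …, p`, because `i′ < i` and `i ≤ j′ ≤ p`.
      S⇒falls : (i , j) ∈ S[ T ] Tm → ω (suc p) < ω (parent V (toℕ i) (toℕ j))
      S⇒falls ((left , _ , biggest) , ≢top , (i′ , j′) , (((i′<i , _) , _) , case) , i′j′)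
        with V (suc (toℕ j)) ℕ.≤? V (toℕ i)
      ... | yes _ = ω-enters (enter (path-enters (closure⇒star T i′j′) i′<i i≤j′))
        where
        range : ∀ {x} → IsBiggest (λ v → toℕ v < toℕ j × E Tm i v) x ⊎ (∀ v → Adj Tm i v → v ≡ j) × x ≡ i →
                toℕ i ≤ toℕ x × toℕ x ≤ p
        range (inj₁ ((x<j , ix) , _)) = ℕ.<⇒≤ (E⇒< Tm ix) , neighbour-below x<j ix
        range (inj₂ (_ , refl))       = ℕ.≤-refl , ℕ.≤-pred (i<q c)
        i≤j′ = proj₁ (range case)
        enter : Enters (toℕ i) (suc (toℕ j′)) → Enters (toℕ i) (suc p)
        enter (u , v , uv , u<i , i≤v , v≤j′) = u , v , uv , u<i , i≤v , ℕ.<-≤-trans v≤j′ (s≤s (proj₂ (range case)))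
      ... | no j≰i with ascend-right c (ℕ.≰⇒> j≰i)
      ...   | inj₁ (i≡0 , j≡n) = ⊥-elim (≢top (cong₂ _,_ (Fin.toℕ-injective i≡0)
                                   (Fin.toℕ-injective (trans j≡n (sym (Fin.toℕ-fromℕ n))))))
      ...   | inj₂ (k , d) with vertex (j≤n d)
      ...     | x , refl = contradiction (q≤j d) (ℕ.≤⇒≯ (biggest x (fwd (arc→edge (arc d)))))

      -- The fall provides an edge of `T` from some `u < i` to some `v` in `i, …, p`. The candidates
      -- for the image are `i₂`, the left end of the parent arc, and `j₂`, which is `p`. The paths
      -- of `T` behind arcs of `Tm` are forced through `u` or `v` by noncrossing, and their pieces
      -- combine into a path from `i₂` over `v` to `j₂`.
      falls⇒S : ω (suc p) < ω (parent V (toℕ i) (toℕ j)) → (i , j) ∈ S[ T ] Tm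
      falls⇒S falls with V (suc (toℕ j)) ℕ.≤? V (toℕ i)
      -- With the parent on the right, the path of `T` behind the arc itself enters `suc p, …, j`,
      -- so ω rises from the parent to the gap.
      ... | no _ = contradiction (ω-enters (path-enters (path ij) (i<q c) (q≤j c))) (ℕ.<-asym falls)
      ... | yes j≤i with ω-fall⇒enters (i<q c) (proj₂ (inner c)) falls
      ...   | u , v , uv , u<i , i≤v , s≤s v≤p with ascend-left c j≤i
      ...     | inj₁ (i≡0 , _) = contradiction (ℕ.≤-trans (s≤s z≤n) u<i) (λ 0<i → ℕ.<⇒≢ 0<i (sym i≡0))
      ...     | inj₂ (h , d) with vertex (ℕ.<⇒≤ (ℕ.<-≤-trans (i<q d) (toℕ≤ i))) | vertex (ℕ.≤-trans (ℕ.<⇒≤ (q≤j c)) (toℕ≤ j))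
      ...       | i₂ , refl | j₂ , refl =
        (left-vertex ij , fwd ij , biggest) , (λ { refl → contradiction u<i (λ ()) }) ,
        (i₂ , j₂) , ((((i<q d , arc→edge (arc d)) , biggest-i₂) , image-j) , i₂j₂)
        where
        biggest : ∀ k → Adj Tm i k → toℕ k ≤ toℕ j
        biggest k (bwd ki) = ⊥-elim (alternating (ki , ij))
        biggest k (fwd ik) = ℕ.≮⇒≥ λ j<k →
          contradiction (proj₁ (proj₂ (edge→arc ik) (ℕ.m≤n⇒m≤1+n (E⇒< Tm ij)) j<k)) (ℕ.≤⇒≯ j≤i)

        biggest-i₂ : ∀ k → toℕ k < toℕ i × E Tm k j → toℕ k ≤ toℕ i₂
        biggest-i₂ k (k<i , kj) = ℕ.≮⇒≥ λ i₂<k → ℕ.<-asym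
          (lowest d i₂<k (ℕ.<⇒≤ (E⇒< Tm kj)) (ℕ.<⇒≢ k<i))
          (proj₁ (proj₂ (edge→arc kj) k<i (ℕ.<⇒≤ (E⇒< Tm ij))))

        image-j : (IsBiggest (λ v → toℕ v < toℕ j × E Tm i v) j₂) ⊎ ((∀ v → Adj Tm i v → v ≡ j) × j₂ ≡ i)
        image-j with cell-left c
        ... | inj₂ ij₂ = inj₁ ((q≤j c , arc→edge ij₂) , λ k (k<j , ik) → neighbour-below k<j ik)
        ... | inj₁ i≡p = inj₂ (only , sym (Fin.toℕ-injective i≡p))
          where
          only : ∀ v → Adj Tm i v → v ≡ j
          only v adj@(bwd vi) = ⊥-elim (alternating (vi , ij))
          only v adj@(fwd iv) with ℕ.m≤n⇒m<n∨m≡n (biggest v adj)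
          ... | inj₂ v≡j = Fin.toℕ-injective v≡j
          ... | inj₁ v<j = contradiction (neighbour-below v<j iv)
                             (ℕ.<⇒≱ (subst (_< toℕ v) i≡p (E⇒< Tm iv)))

        i₂→v : Star (E T) i₂ v
        i₂→v with toℕ i₂ ℕ.≤? toℕ u
        ... | no i₂≰u = proj₁ (passes-right uv (path (arc→edge (arc d))) (ℕ.≰⇒> i₂≰u)
                          (ℕ.≤-trans (ℕ.<⇒≤ (i<q d)) i≤v) (ℕ.≤-trans v≤p (ℕ.<⇒≤ (q≤j c))))
        ... | yes i₂≤u = through (toℕ i) refl
          where
          -- Matching on a copy of `toℕ i` gives access to the vertex `x` just before `i`, the right
          -- end of the left half of the parent's block.
          through : ∀ m → m ≡ toℕ i → Star (E T) i₂ v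
          through zero    eq = contradiction (subst (toℕ u <_) (sym eq) u<i) λ ()
          through (suc m) eq with vertex (ℕ.<⇒≤ (subst (_≤ n) (sym eq) (toℕ≤ i)))
          ... | x , refl = passes-left uv to-x i₂≤u (ℕ.≤-pred (subst (toℕ u <_) (sym eq) u<i))
                             (subst (_≤ toℕ v) (sym eq) i≤v) ◅◅ (uv ◅ done)
            where
            to-x : Star (E T) i₂ x
            to-x with cell-left (subst (λ m → Cell m (toℕ i₂) (toℕ j)) (sym eq) d)
            ... | inj₁ i₂≡x with refl ← Fin.toℕ-injective i₂≡x = done
            ... | inj₂ i₂x  = path (arc→edge i₂x)

        v→j₂ : Star (E T) v j₂
        v→j₂ with cell-left c
        ... | inj₂ ij₂ = proj₂ (passes-right uv (path (arc→edge ij₂)) u<i i≤v v≤p)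
        ... | inj₁ i≡p = subst (Star (E T) v) (Fin.toℕ-injective (ℕ.≤-antisym v≤p (subst (_≤ toℕ v) i≡p i≤v))) done

        i₂j₂ : E (closure T) i₂ j₂
        i₂j₂ = star⇒closure T (λ { refl → ℕ.<⇒≱ (i<q d) (ℕ.≤-pred (i<q c)) }) (i₂→v ◅◅ v→j₂)

-- Integer combinations of roots

sum-split : ∀ {m} {f g : Fin m → ℕ} {a} k → f k ≡ a + g k → (∀ i → i ≢ k → f i ≡ g i) →
            sum f ≡ a + sum g
sum-split {suc m} {f} {g} {a} zero fk rest = trans
  (cong₂ _+_ fk (sum-cong-≗ λ i → rest (suc i) λ ()))
  (ℕ.+-assoc a (g zero) (sum (g ∘ suc)))
sum-split {suc m} {f} {g} {a} (suc k) fk rest = trans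
  (cong₂ _+_ (rest zero λ ()) (sum-split k fk λ i i≢k → rest (suc i) (i≢k ∘ Fin.suc-injective)))
  (x∙yz≈y∙xz (g zero) a (sum (g ∘ suc)))

δ : ∀ {N} → Fin N → Fin N → ℤ
δ i k = if does (i Fin.≟ k) then 1ℤ else 0ℤ

root : ∀ {N} → Fin N × Fin N → Fin N → ℤ
root (i , j) k = δ i k ℤ.- δ j k

rootSum : ∀ {N} → List (Fin N × Fin N) → Fin N → ℤ
rootSum []       k = 0ℤ
rootSum (e ∷ es) k = root e k ℤ.+ rootSum es k

pairing : ∀ {N} → (Fin N → ℤ) → (Fin N → ℤ) → ℤ
pairing α x = ℤΣ.sum λ k → α k ℤ.* x k

drop : ∀ {N} → (Fin N → ℤ) → Fin N × Fin N → ℤ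
drop α (i , j) = α i ℤ.- α j

weight : ∀ {N} → (Fin N → ℤ) → List (Fin N × Fin N) → ℤ
weight α []       = 0ℤ
weight α (e ∷ es) = drop α e ℤ.+ weight α es

pairing-0 : ∀ {N} (α : Fin N → ℤ) → pairing α (λ _ → 0ℤ) ≡ 0ℤ
pairing-0 {N} α = trans (ℤΣ.sum-cong-≗ λ k → ℤ.*-zeroʳ (α k)) (ℤΣ.sum-replicate-zero N)

pairing-+ : ∀ {N} (α x y : Fin N → ℤ) → pairing α (λ k → x k ℤ.+ y k) ≡ pairing α x ℤ.+ pairing α y
pairing-+ α x y = trans (ℤΣ.sum-cong-≗ λ k → ℤ.*-distribˡ-+ (α k) (x k) (y k))
  (ℤΣ.∑-distrib-+ (λ k → α k ℤ.* x k) (λ k → α k ℤ.* y k))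

pairing-+ˡ : ∀ {N} (α β x : Fin N → ℤ) → pairing (λ k → α k ℤ.+ β k) x ≡ pairing α x ℤ.+ pairing β x
pairing-+ˡ α β x = trans (ℤΣ.sum-cong-≗ λ k → ℤ.*-distribʳ-+ (x k) (α k) (β k))
  (ℤΣ.∑-distrib-+ (λ k → α k ℤ.* x k) (λ k → β k ℤ.* x k))

pairing-*ˡ : ∀ {N} c (α x : Fin N → ℤ) → pairing (λ k → c ℤ.* α k) x ≡ c ℤ.* pairing α x
pairing-*ˡ c α x = trans (ℤΣ.sum-cong-≗ λ k → ℤ.*-assoc c (α k) (x k))
  (sym (ℤΣ.*-distribˡ-sum c (λ k → α k ℤ.* x k)))

pairing-*ʳ : ∀ {N} c (α x : Fin N → ℤ) → pairing α (λ k → c ℤ.* x k) ≡ c ℤ.* pairing α x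
pairing-*ʳ c α x = trans (ℤΣ.sum-cong-≗ λ k → swap (α k) c (x k))
  (sym (ℤΣ.*-distribˡ-sum c (λ k → α k ℤ.* x k)))
  where
  swap : ∀ a c x → a ℤ.* (c ℤ.* x) ≡ c ℤ.* (a ℤ.* x)
  swap = ℤSolver.solve-∀

pairing-δ : ∀ {N} (α : Fin N → ℤ) i → pairing α (δ i) ≡ α i
pairing-δ {suc N} α zero = trans (cong₂ ℤ._+_ (ℤ.*-identityʳ (α zero)) (pairing-0 (α ∘ suc)))
  (ℤ.+-identityʳ (α zero))
pairing-δ {suc N} α (suc i) = trans (cong₂ ℤ._+_ (ℤ.*-zeroʳ (α zero)) (pairing-δ (α ∘ suc) i))
  (ℤ.+-identityˡ (α (suc i)))

pairing-δˡ : ∀ {N} (x : Fin N → ℤ) i → pairing (δ i) x ≡ x i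
pairing-δˡ x i = trans (ℤΣ.sum-cong-≗ λ k → ℤ.*-comm (δ i k) (x k)) (pairing-δ x i)

pairing-neg : ∀ {N} (α x : Fin N → ℤ) → pairing α (λ k → ℤ.- x k) ≡ ℤ.- pairing α x
pairing-neg α x = trans (ℤΣ.sum-cong-≗ λ k → cong (α k ℤ.*_) (sym (ℤ.-1*i≡-i (x k))))
  (trans (pairing-*ʳ ℤ.-1ℤ α x) (ℤ.-1*i≡-i (pairing α x)))

pairing-root : ∀ {N} (α : Fin N → ℤ) e → pairing α (root e) ≡ drop α e
pairing-root α (i , j) = trans (pairing-+ α (δ i) (λ k → ℤ.- δ j k))
  (cong₂ ℤ._+_ (pairing-δ α i) (trans (pairing-neg α (δ j)) (cong ℤ.-_ (pairing-δ α j))))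

pairing-rootSum : ∀ {N} (α : Fin N → ℤ) es → pairing α (rootSum es) ≡ weight α es
pairing-rootSum α []       = pairing-0 α
pairing-rootSum α (e ∷ es) = trans (pairing-+ α (root e) (rootSum es))
  (cong₂ ℤ._+_ (pairing-root α e) (pairing-rootSum α es))

-- The functional whose pairing with a point is its prefix sum at the gap `q`.
below : ∀ {N} → ℕ → Fin N → ℤ
below q k = if toℕ k ℕ.<ᵇ q then 1ℤ else 0ℤ

below-suc : ∀ {N} (k : Fin N) i → below (suc (toℕ k)) i ≡ below (toℕ k) i ℤ.+ δ k i
below-suc zero    zero    = refl
below-suc zero    (suc i) = refl
below-suc (suc k) zero    = refl
below-suc (suc k) (suc i) = below-suc k i

pairing-below-suc : ∀ {N} (x : Fin N → ℤ) k →
                    pairing (below (suc (toℕ k))) x ≡ pairing (below (toℕ k)) x ℤ.+ x k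
pairing-below-suc x k = trans (ℤΣ.sum-cong-≗ λ i → cong (ℤ._* x i) (below-suc k i))
  (trans (pairing-+ˡ (below (toℕ k)) (δ k) x) (cong (ℤ._+_ (pairing (below (toℕ k)) x)) (pairing-δˡ x k)))

pairing-below-injective : ∀ {N} (x y : Fin N → ℤ) → (∀ q → q ≤ N → pairing (below q) x ≡ pairing (below q) y) → x ≗ y
pairing-below-injective x y eq k = ∙-cancelˡ (pairing (below (toℕ k)) x) (x k) (y k)
  (trans (sym (pairing-below-suc x k)) (trans (eq (suc (toℕ k)) (Fin.toℕ<n k))
    (trans (pairing-below-suc y k) (cong (ℤ._+ y k) (sym (eq (toℕ k) (ℕ.<⇒≤ (Fin.toℕ<n k))))))))

pairing-congʳ : ∀ {N} (α : Fin N → ℤ) {x y} → x ≗ y → pairing α x ≡ pairing α y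
pairing-congʳ α x≗y = ℤΣ.sum-cong-≗ λ k → cong (α k ℤ.*_) (x≗y k)

pairing-congˡ : ∀ {N} {α β : Fin N → ℤ} x → α ≗ β → pairing α x ≡ pairing β x
pairing-congˡ x α≗β = ℤΣ.sum-cong-≗ λ k → cong (ℤ._* x k) (α≗β k)

below-< : ∀ {N} {q} {k : Fin N} → toℕ k < q → below q k ≡ 1ℤ
below-< {q = q} {k} k<q with toℕ k ℕ.<ᵇ q | ℕ.<⇒<ᵇ k<q
... | true | _ = refl

below-≮ : ∀ {N} {q} {k : Fin N} → ¬ toℕ k < q → below q k ≡ 0ℤ
below-≮ {q = q} {k} k≮q with toℕ k ℕ.<ᵇ q | ℕ.<ᵇ⇒< (toℕ k) q
... | false | _ = refl
... | true  | f = contradiction (f _) k≮q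

drop-below : ∀ {N} q {i j : Fin N} → toℕ i < toℕ j →
             drop (below q) (i , j) ≡ + indicator (Covers? (toℕ i) (toℕ j) q) 1
drop-below q {i} {j} i<j with toℕ i ℕ.<? q | toℕ j ℕ.<? q
... | yes i<q | yes j<q = trans (cong₂ ℤ._-_ (below-< i<q) (below-< j<q))
      (cong +_ (sym (indicator-no (Covers? (toℕ i) (toℕ j) q) λ { (_ , q≤j) → ℕ.<⇒≱ j<q q≤j })))
... | yes i<q | no j≮q  = trans (cong₂ ℤ._-_ (below-< i<q) (below-≮ j≮q))
      (cong +_ (sym (indicator-yes (Covers? (toℕ i) (toℕ j) q) (i<q , ℕ.≮⇒≥ j≮q))))
... | no i≮q  | yes j<q = contradiction (ℕ.<-trans i<j j<q) i≮q
... | no i≮q  | no j≮q  = trans (cong₂ ℤ._-_ (below-≮ i≮q) (below-≮ j≮q))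
      (cong +_ (sym (indicator-no (Covers? (toℕ i) (toℕ j) q) λ { (i<q , _) → i≮q i<q })))

-- Coefficients become repetitions, so that later all entries of the list can receive the same real
-- coefficient.
expand : ∀ {A : Set} {m} → (Fin m → A) → (Fin m → ℕ) → List A
expand {m = zero}  a f = []
expand {m = suc m} a f = replicate (f zero) (a zero) ++ expand (a ∘ suc) (f ∘ suc)

length-expand : ∀ {A : Set} {m} (a : Fin m → A) f → length (expand a f) ≡ sum f
length-expand {m = zero}  a f = refl
length-expand {m = suc m} a f = trans (List.length-++ (replicate (f zero) (a zero)))
  (cong₂ _+_ (List.length-replicate (f zero)) (length-expand (a ∘ suc) (f ∘ suc)))

All-expand : ∀ {A : Set} {P : A → Set} {m} {a : Fin m → A} (f : Fin m → ℕ) → (∀ k → P (a k)) → All P (expand a f)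
All-expand {m = zero}  f Pa = []
All-expand {m = suc m} f Pa = All.++⁺ (All.replicate⁺ (f zero) (Pa zero)) (All-expand (f ∘ suc) (Pa ∘ suc))

weight-++ : ∀ {N} (α : Fin N → ℤ) es es′ → weight α (es ++ es′) ≡ weight α es ℤ.+ weight α es′
weight-++ α []       es′ = sym (ℤ.+-identityˡ (weight α es′))
weight-++ α (e ∷ es) es′ = trans (cong (ℤ._+_ (drop α e)) (weight-++ α es es′))
  (sym (ℤ.+-assoc (drop α e) (weight α es) (weight α es′)))

weight-replicate : ∀ {N} (α : Fin N → ℤ) {e d} m → drop α e ≡ + d → weight α (replicate m e) ≡ + (m * d)
weight-replicate α zero    eq = refl
weight-replicate α {d = d} (suc m) eq = cong₂ ℤ._+_ eq (weight-replicate α m eq)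

weight-expand : ∀ {N m} (α : Fin N → ℤ) (a : Fin m → Fin N × Fin N) f {d : Fin m → ℕ} →
                (∀ k → drop α (a k) ≡ + d k) → weight α (expand a f) ≡ + sum (λ k → f k * d k)
weight-expand {m = zero}  α a f eq = refl
weight-expand {m = suc m} α a f eq = trans (weight-++ α (replicate (f zero) (a zero)) (expand (a ∘ suc) (f ∘ suc)))
  (cong₂ ℤ._+_ (weight-replicate α (f zero) (eq zero)) (weight-expand α (a ∘ suc) (f ∘ suc) (eq ∘ suc)))

path-edges : ∀ {N} (T : Graph N) {i j} → Star (E T) i j →
             ∃ λ es → All (Edge T) es × root (i , j) ≗ rootSum es
path-edges T {i} done = [] , [] , λ k → ℤ.+-inverseʳ (δ i k)
path-edges T {i} {j} (_◅_ {j = m} im mj) with path-edges T mj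
... | es , edges , eq = (i , m) ∷ es , im ∷ edges , λ k →
  trans (telescope (δ i k) (δ m k) (δ j k)) (cong (ℤ._+_ (root (i , m) k)) (eq k))
  where
  telescope : ∀ a b c → a ℤ.- c ≡ (a ℤ.- b) ℤ.+ (b ℤ.- c)
  telescope = ℤSolver.solve-∀

rootSum-++ : ∀ {N} (es es′ : List (Fin N × Fin N)) k → rootSum (es ++ es′) k ≡ rootSum es k ℤ.+ rootSum es′ k
rootSum-++ []       es′ k = sym (ℤ.+-identityˡ (rootSum es′ k))
rootSum-++ (e ∷ es) es′ k = trans (cong (ℤ._+_ (root e k)) (rootSum-++ es es′ k))
  (sym (ℤ.+-assoc (root e k) (rootSum es k) (rootSum es′ k)))

closure-edges : ∀ {N} (T : Graph N) {es} → All (Edge (closure T)) es →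
                ∃ λ ts → All (Edge T) ts × rootSum es ≗ rootSum ts
closure-edges T [] = [] , [] , λ _ → refl
closure-edges T {e ∷ _} (ij ∷ edges) with path-edges T (closure⇒star T ij) | closure-edges T edges
... | ts , t , eq | ts′ , t′ , eq′ = ts ++ ts′ , All.++⁺ t t′ , λ k →
  trans (cong₂ ℤ._+_ (eq k) (eq′ k)) (sym (rootSum-++ ts ts′ k))

module Levels {n : ℕ} {V : ℕ → ℕ} (generic : Generic n V)
              (arcs : Fin n → Fin (suc n) × Fin (suc n)) where
  open Cartesian generic

  leftEnd rightEnd gap par : Fin n → ℕ
  leftEnd m  = toℕ (proj₁ (arcs m))
  rightEnd m = toℕ (proj₂ (arcs m))
  gap m      = suc (toℕ m)
  par m      = parent V (leftEnd m) (rightEnd m)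

  cover : ℕ → Fin n → ℕ
  cover q m = indicator (Covers? (leftEnd m) (rightEnd m) q) 1

  -- The prefix sums of the combination of the arcs with coefficients `f`, as natural numbers.
  level : (Fin n → ℕ) → ℕ → ℕ
  level f q = sum λ m → f m * cover q m

  level-first : ∀ f → level f 0 ≡ 0
  level-first f = sum-zero λ m → trans (cong (f m *_)
    (indicator-no (Covers? (leftEnd m) (rightEnd m) 0) {1} λ ())) (ℕ.*-zeroʳ (f m))

  level-last : ∀ f → level f (suc n) ≡ 0
  level-last f = sum-zero λ m → trans (cong (f m *_)
    (indicator-no (Covers? (leftEnd m) (rightEnd m) (suc n))
      λ { (_ , N≤r) → ℕ.<⇒≱ (Fin.toℕ<n (proj₂ (arcs m))) N≤r })) (ℕ.*-zeroʳ (f m))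

  module _ (cells : ∀ m → Cell (gap m) (leftEnd m) (rightEnd m)) where

    gap-inner : ∀ m → Inner n (gap m)
    gap-inner m = z<s , Fin.toℕ<n m

    inner-gap : ∀ {q} → Inner n q → ∃ λ m → gap m ≡ q
    inner-gap {suc p} (_ , p<n) = fromℕ< p<n , cong suc (Fin.toℕ-fromℕ< p<n)

    gap-rec : (P : ℕ → Set) → P 0 → P (suc n) → (∀ m → P (par m) → P (gap m)) → ∀ {q} → Inner n q → P q
    gap-rec P P0 PN step = gap-induction P P0 PN λ c → at c (inner-gap (inner c))
      where
      at : ∀ {q i j} → Cell q i j → (∃ λ m → gap m ≡ q) → P (parent V i j) → P q
      at c (m , refl) with cell-arc-unique c (cells m)
      ... | refl , refl = step m

    arcs-injective : ∀ {m k} → arcs m ≡ arcs k → m ≡ k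
    arcs-injective {m} {k} eq = Fin.toℕ-injective (ℕ.suc-injective (cell-gap-unique
      (subst (λ a → Cell (gap m) (toℕ (proj₁ a)) (toℕ (proj₂ a))) eq (cells m)) (cells k)))

    arc-index : ∀ {i j : Fin (suc n)} → Arc V (toℕ i) (toℕ j) → ∃ λ m → arcs m ≡ (i , j)
    arc-index {i} {j} ij with arc⇒cell (toℕ≤ j) ij
    ... | q , c with inner-gap (inner c)
    ...   | m , refl with cell-arc-unique (cells m) c
    ...     | l≡ , r≡ = m , cong₂ _,_ (Fin.toℕ-injective l≡) (Fin.toℕ-injective r≡)

    level-step : ∀ f m → level f (gap m) ≡ f m + level f (par m)
    level-step f m = sum-split m at elsewhere
      where
      self : cover (gap m) m ≡ 1
      self = indicator-yes (Covers? (leftEnd m) (rightEnd m) (gap m)) (covers-self (cells m))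
      parent-self : cover (par m) m ≡ 0
      parent-self = indicator-no (Covers? (leftEnd m) (rightEnd m) (par m)) (parent-uncovered (cells m))
      at : f m * cover (gap m) m ≡ f m + f m * cover (par m) m
      at rewrite self | parent-self | ℕ.*-zeroʳ (f m) | ℕ.*-identityʳ (f m) | ℕ.+-identityʳ (f m) = refl
      elsewhere : ∀ k → k ≢ m → f k * cover (gap m) k ≡ f k * cover (par m) k
      elsewhere k k≢m = cong (f k *_) (same (Covers? (leftEnd k) (rightEnd k) (gap m))
                                            (Covers? (leftEnd k) (rightEnd k) (par m)))
        where
        same : (d : Dec (Covers (leftEnd k) (rightEnd k) (gap m))) (d′ : Dec (Covers (leftEnd k) (rightEnd k) (par m))) →
               indicator d 1 ≡ indicator d′ 1
        same (yes _)  (yes _)  = refl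
        same (no _)   (no _)   = refl
        same (yes o)  (no ¬o)  = contradiction (covers-parent (cells m) (cells k)
                                   (k≢m ∘ Fin.toℕ-injective ∘ ℕ.suc-injective) o) ¬o
        same (no ¬o)  (yes o)  = contradiction (parent-covers (cells m) (cells k) o) ¬o

    level-injective : ∀ {f g} → (∀ q → q ≤ suc n → level f q ≡ level g q) → f ≗ g
    level-injective {f} {g} eq m = ℕ.+-cancelʳ-≡ (level f (par m)) (f m) (g m)
      (trans (sym (level-step f m)) (trans (eq (gap m) (ℕ.m≤n⇒m≤1+n (Fin.toℕ<n m)))
        (trans (level-step g m) (cong (_+_ (g m)) (sym (eq (par m) par≤))))))
      where
      par≤ : par m ≤ suc n
      par≤ with parent-inner (cells m)
      ... | inj₁ eq        = ℕ.≤-trans (ℕ.≤-reflexive eq) z≤n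
      ... | inj₂ (inj₁ eq) = ℕ.≤-reflexive eq
      ... | inj₂ (inj₂ inn) = ℕ.m≤n⇒m≤1+n (proj₂ inn)

    level-solve : ∀ {W : ℕ → ℕ} → W 0 ≡ 0 → W (suc n) ≡ 0 → (∀ m → W (par m) ≤ W (gap m)) →
                  ∀ {q} → Inner n q → level (λ m → W (gap m) ∸ W (par m)) q ≡ W q
    level-solve {W} W0 WN mono = gap-rec (λ q → level f q ≡ W q)
      (trans (level-first f) (sym W0)) (trans (level-last f) (sym WN))
      λ m eq → trans (level-step f m) (trans (cong (_+_ (f m)) eq) (ℕ.m∸n+n≡m (mono m)))
      where f = λ m → W (gap m) ∸ W (par m)

    point : (Fin n → ℕ) → Fin (suc n) → ℤ
    point f = rootSum (expand arcs f)

    pairing-below-point : ∀ f q → pairing (below q) (point f) ≡ + level f q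
    pairing-below-point f q = trans (pairing-rootSum (below q) (expand arcs f))
      (weight-expand (below q) arcs f λ m → drop-below q (proj₁ (arc (cells m))))

    -- Every arc runs from a vertex where V rises to one where V falls.
    rising : Fin (suc n) → ℤ
    rising v = if does (V (toℕ v) ℕ.<? V (suc (toℕ v))) then 1ℤ else 0ℤ

    rising-≤1 : ∀ u v → drop rising (u , v) ℤ.≤ 1ℤ
    rising-≤1 u v with does (V (toℕ u) ℕ.<? V (suc (toℕ u))) | does (V (toℕ v) ℕ.<? V (suc (toℕ v)))
    ... | true  | true  = ℤ.+≤+ z≤n
    ... | true  | false = ℤ.≤-refl
    ... | false | true  = ℤ.-≤+
    ... | false | false = ℤ.+≤+ z≤n

    drop-rising : ∀ m → drop rising (arcs m) ≡ 1ℤ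
    drop-rising m with proj₂ (arc (cells m)) | proj₁ (arc (cells m))
    ... | higher | l<r = at (V (leftEnd m) ℕ.<? V (suc (leftEnd m))) (V (rightEnd m) ℕ.<? V (suc (rightEnd m)))
      where
      at : (d : Dec (V (leftEnd m) < V (suc (leftEnd m)))) (d′ : Dec (V (rightEnd m) < V (suc (rightEnd m)))) →
           (if does d then 1ℤ else 0ℤ) ℤ.- (if does d′ then 1ℤ else 0ℤ) ≡ 1ℤ
      at (yes _)  (no _)  = refl
      at (no ¬lt) _       = contradiction (proj₁ (higher ℕ.≤-refl l<r)) ¬lt
      at (yes _)  (yes lt) = contradiction (proj₂ (higher l<r ℕ.≤-refl)) (ℕ.<-asym lt)

    -- The functional is at most 1 on every root and equal to 1 on every arc of the tree. So it
    -- reads off the sum of the coefficients, and membership in the `t`-fold hull bounds this sum by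
    -- `t`.
    pairing-rising-point : ∀ f → pairing rising (point f) ≡ + sum f
    pairing-rising-point f = trans (pairing-rootSum rising (expand arcs f))
      (trans (weight-expand rising arcs f {d = λ _ → 1} drop-rising)
        (cong +_ (sum-cong-≗ λ m → ℕ.*-identityʳ (f m))))

-- Real inequalities

ι : ℤ → ℚ
ι z = z ℚ./ 1

private
  toℚᵘ-ι : ∀ z → ℚ.toℚᵘ (ι z) ℚᵘ.≃ mkℚᵘ z 0
  toℚᵘ-ι z = ℚ.toℚᵘ-fromℚᵘ (mkℚᵘ z 0)

ι-+ : ∀ a b → ι (a ℤ.+ b) ≡ ι a ℚ.+ ι b
ι-+ a b = ℚ.toℚᵘ-injective (ℚᵘ.≃-trans (toℚᵘ-ι (a ℤ.+ b)) (ℚᵘ.≃-trans (*≡* (lemma a b))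
  (ℚᵘ.≃-sym (ℚᵘ.≃-trans (ℚ.toℚᵘ-homo-+ (ι a) (ι b)) (ℚᵘ.+-cong (toℚᵘ-ι a) (toℚᵘ-ι b))))))
  where
  lemma : ∀ a b → (a ℤ.+ b) ℤ.* 1ℤ ≡ (a ℤ.* 1ℤ ℤ.+ b ℤ.* 1ℤ) ℤ.* 1ℤ
  lemma = ℤSolver.solve-∀

ι-* : ∀ a b → ι (a ℤ.* b) ≡ ι a ℚ.* ι b
ι-* a b = ℚ.toℚᵘ-injective (ℚᵘ.≃-trans (toℚᵘ-ι (a ℤ.* b)) (ℚᵘ.≃-trans (*≡* refl)
  (ℚᵘ.≃-sym (ℚᵘ.≃-trans (ℚ.toℚᵘ-homo-* (ι a) (ι b)) (ℚᵘ.*-cong (toℚᵘ-ι a) (toℚᵘ-ι b))))))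

ι-neg : ∀ a → ι (ℤ.- a) ≡ ℚ.- ι a
ι-neg a = ℚ.toℚᵘ-injective (ℚᵘ.≃-trans (toℚᵘ-ι (ℤ.- a))
  (ℚᵘ.≃-sym (ℚᵘ.≃-trans (ℚ.toℚᵘ-homo‿- (ι a)) (ℚᵘ.-‿cong (toℚᵘ-ι a)))))

ι-cancel-< : ∀ {a b} → ι a ℚ.< ι b → a ℤ.< b
ι-cancel-< {a} {b} lt with ℚᵘ.<-respˡ-≃ (toℚᵘ-ι a) (ℚᵘ.<-respʳ-≃ (toℚᵘ-ι b) (ℚ.toℚᵘ-mono-< lt))
... | *<* a<b = subst₂ ℤ._<_ (ℤ.*-identityʳ a) (ℤ.*-identityʳ b) a<b

ι-sum : ∀ {m} (f : Fin m → ℤ) → ι (ℤΣ.sum f) ≡ ℚΣ.sum (ι ∘ f)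
ι-sum {zero}  f = refl
ι-sum {suc m} f = trans (ι-+ (f zero) (ℤΣ.sum (f ∘ suc))) (cong (ι (f zero) ℚ.+_) (ι-sum (f ∘ suc)))

ι-nonNeg : ∀ k → 0ℚ ℚ.≤ ι (+ k)
ι-nonNeg k = ℚ.nonNegative⁻¹ (ι (+ k)) {{ℚ.normalize-nonNeg k 1}}

seq-sum : ∀ {m} (f : Vector ℝ m) n → seq (sumℝ f) n ≡ ℚΣ.sum (λ a → seq (f a) n)
seq-sum {zero}  f n = refl
seq-sum {suc m} f n = cong (seq (f zero) n ℚ.+_) (seq-sum (f ∘ suc) n)

private
  half-pos : ∀ {ε} → 0ℚ ℚ.< ε → 0ℚ ℚ.< ½ ℚ.* ε
  half-pos {ε} 0<ε = subst (ℚ._< ½ ℚ.* ε) (ℚ.*-zeroʳ ½) (ℚ.*-monoʳ-<-pos ½ 0<ε)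

  two-halves : ∀ ε → ½ ℚ.* ε ℚ.+ ½ ℚ.* ε ≡ ε
  two-halves ε = trans (sym (ℚ.*-distribʳ-+ ε ½ ½)) (ℚ.*-identityˡ ε)

  p≤∣p∣ : ∀ p → p ℚ.≤ ∣ p ∣
  p≤∣p∣ p with ℚ.≤-total 0ℚ p
  ... | inj₁ 0≤p = ℚ.≤-reflexive (sym (ℚ.0≤p⇒∣p∣≡p 0≤p))
  ... | inj₂ p≤0 = ℚ.≤-trans p≤0 (ℚ.0≤∣p∣ p)

≈ℝ-pointwise : ∀ {x y} → (∀ n → seq x n ≡ seq y n) → x ≈ℝ y
≈ℝ-pointwise {x} {y} eq ε 0<ε = 0 , λ n _ → subst (λ d → ∣ d ∣ ℚ.< ε)
  (sym (trans (cong (ℚ._- seq y n) (eq n)) (ℚ.+-inverseʳ (seq y n)))) 0<ε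

≈ℝ-sym : ∀ {x y} → x ≈ℝ y → y ≈ℝ x
≈ℝ-sym {x} {y} x≈y ε 0<ε with x≈y ε 0<ε
... | M , close = M , λ n M≤n → subst (ℚ._< ε)
  (trans (sym (ℚ.∣-p∣≡∣p∣ (seq x n ℚ.- seq y n))) (cong ∣_∣ (flip (seq x n) (seq y n)))) (close n M≤n)
  where
  open +-*-Solver
  flip : ∀ p q → ℚ.- (p ℚ.- q) ≡ q ℚ.- p
  flip = solve 2 (λ p q → :- (p :- q) := q :- p) refl

private
  ∣sum∣< : ∀ {p q ε} → ∣ p ∣ ℚ.< ½ ℚ.* ε → ∣ q ∣ ℚ.< ½ ℚ.* ε → ∣ p ℚ.+ q ∣ ℚ.< ε
  ∣sum∣< {p} {q} {ε} p< q< = ℚ.≤-<-trans (ℚ.∣p+q∣≤∣p∣+∣q∣ p q)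
    (subst (∣ p ∣ ℚ.+ ∣ q ∣ ℚ.<_) (two-halves ε) (ℚ.+-mono-< p< q<))

  both : ∀ {P Q : ℕ → Set} → (∃ λ M → ∀ n → M ≤ n → P n) → (∃ λ M → ∀ n → M ≤ n → Q n) →
         ∃ λ M → ∀ n → M ≤ n → P n × Q n
  both (M , p) (K , q) = M ℕ.⊔ K , λ n M⊔K≤n → p n (ℕ.m⊔n≤o⇒m≤o M K M⊔K≤n) , q n (ℕ.m⊔n≤o⇒n≤o M K M⊔K≤n)

≈ℝ-trans : ∀ {x y z} → x ≈ℝ y → y ≈ℝ z → x ≈ℝ z
≈ℝ-trans {x} {y} {z} x≈y y≈z ε 0<ε
  with both (x≈y (½ ℚ.* ε) (half-pos 0<ε)) (y≈z (½ ℚ.* ε) (half-pos 0<ε))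
... | M , close = M , λ n M≤n → subst (λ d → ∣ d ∣ ℚ.< ε) (join (seq x n) (seq y n) (seq z n))
  (∣sum∣< {seq x n ℚ.- seq y n} {seq y n ℚ.- seq z n} (proj₁ (close n M≤n)) (proj₂ (close n M≤n)))
  where
  open +-*-Solver
  join : ∀ p q r → (p ℚ.- q) ℚ.+ (q ℚ.- r) ≡ p ℚ.- r
  join = solve 3 (λ p q r → (p :- q) :+ (q :- r) := p :- r) refl

+ℝ-cong : ∀ {x x′ y y′} → x ≈ℝ x′ → y ≈ℝ y′ → x +ℝ y ≈ℝ x′ +ℝ y′
+ℝ-cong {x} {x′} {y} {y′} x≈ y≈ ε 0<ε
  with both (x≈ (½ ℚ.* ε) (half-pos 0<ε)) (y≈ (½ ℚ.* ε) (half-pos 0<ε))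
... | M , close = M , λ n M≤n → subst (λ d → ∣ d ∣ ℚ.< ε) (regroup (seq x n) (seq x′ n) (seq y n) (seq y′ n))
  (∣sum∣< {seq x n ℚ.- seq x′ n} {seq y n ℚ.- seq y′ n} (proj₁ (close n M≤n)) (proj₂ (close n M≤n)))
  where
  open +-*-Solver
  regroup : ∀ p p′ q q′ → (p ℚ.- p′) ℚ.+ (q ℚ.- q′) ≡ (p ℚ.+ q) ℚ.- (p′ ℚ.+ q′)
  regroup = solve 4 (λ p p′ q q′ → (p :- p′) :+ (q :- q′) := (p :+ q) :- (p′ :+ q′)) refl

sumℝ-cong : ∀ {m} {f g : Vector ℝ m} → (∀ a → f a ≈ℝ g a) → sumℝ f ≈ℝ sumℝ g
sumℝ-cong {zero}  f≈g = ≈ℝ-pointwise {0ℝ} {0ℝ} λ _ → refl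
sumℝ-cong {suc m} {f} {g} f≈g = +ℝ-cong {f zero} {g zero} {sumℝ (f ∘ suc)} {sumℝ (g ∘ suc)}
  (f≈g zero) (sumℝ-cong {f = f ∘ suc} {g ∘ suc} (f≈g ∘ suc))

private
  eventually-bounded : ∀ x → ∃ λ B → 0ℚ ℚ.< B × ∃ λ M → ∀ n → M ≤ n → ∣ seq x n ∣ ℚ.≤ B
  eventually-bounded x with cauchy x 1ℚ (ℚ.positive⁻¹ 1ℚ)
  ... | M , close = 1ℚ ℚ.+ ∣ seq x M ∣ , ℚ.+-mono-<-≤ (ℚ.positive⁻¹ 1ℚ) (ℚ.0≤∣p∣ (seq x M)) , M , λ n M≤n →
    subst (λ p → ∣ p ∣ ℚ.≤ 1ℚ ℚ.+ ∣ seq x M ∣) (cancel (seq x n) (seq x M))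
      (ℚ.≤-trans (ℚ.∣p+q∣≤∣p∣+∣q∣ (seq x n ℚ.- seq x M) (seq x M))
        (ℚ.+-monoˡ-≤ ∣ seq x M ∣ (ℚ.<⇒≤ (close n M M≤n ℕ.≤-refl))))
    where
    open +-*-Solver
    cancel : ∀ p q → (p ℚ.- q) ℚ.+ q ≡ p
    cancel = solve 2 (λ p q → (p :- q) :+ q := p) refl

private
  shrink : ∀ B ε → 0ℚ ℚ.< B → 0ℚ ℚ.< ε → ∃ λ η → 0ℚ ℚ.< η × B ℚ.* η ≡ ε
  shrink B ε 0<B 0<ε = B⁻¹ ℚ.* ε , 0<η , B*η≡ε
    where
    instance
      B-pos     = ℚ.positive 0<B
      B-nonZero = ℚ.pos⇒nonZero B
    B⁻¹ = ℚ.1/ B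
    0<η : 0ℚ ℚ.< B⁻¹ ℚ.* ε
    0<η = subst (ℚ._< B⁻¹ ℚ.* ε) (ℚ.*-zeroʳ B⁻¹) (ℚ.*-monoʳ-<-pos B⁻¹ {{ℚ.1/pos⇒pos B}} 0<ε)
    B*η≡ε : B ℚ.* (B⁻¹ ℚ.* ε) ≡ ε
    B*η≡ε = trans (sym (ℚ.*-assoc B B⁻¹ ε)) (trans (cong (ℚ._* ε) (ℚ.*-inverseʳ B)) (ℚ.*-identityˡ ε))

  ∣product∣< : ∀ {B η ε} p q r → 0ℚ ℚ.< B → B ℚ.* η ≡ ε → ∣ p ∣ ℚ.≤ B → ∣ q ℚ.- r ∣ ℚ.< η →
               ∣ p ℚ.* q ℚ.- p ℚ.* r ∣ ℚ.< ε
  ∣product∣< {B} {η} {ε} p q r 0<B refl p≤B d<η = subst (ℚ._< B ℚ.* η) (sym factor) (ℚ.≤-<-trans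
    (ℚ.*-monoʳ-≤-nonNeg ∣ q ℚ.- r ∣ {{ℚ.nonNegative (ℚ.0≤∣p∣ (q ℚ.- r))}} p≤B)
    (ℚ.*-monoʳ-<-pos B {{ℚ.positive 0<B}} d<η))
    where
    open +-*-Solver
    factor : ∣ p ℚ.* q ℚ.- p ℚ.* r ∣ ≡ ∣ p ∣ ℚ.* ∣ q ℚ.- r ∣
    factor = trans (cong ∣_∣ (solve 3 (λ p q r → p :* q :- p :* r := p :* (q :- r)) refl p q r))
      (ℚ.∣p*q∣≡∣p∣*∣q∣ p (q ℚ.- r))

*ℝ-congˡ : ∀ x {y y′} → y ≈ℝ y′ → x *ℝ y ≈ℝ x *ℝ y′
*ℝ-congˡ x {y} {y′} y≈y′ ε 0<ε =
  let B , 0<B , bounded = eventually-bounded x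
      η , 0<η , B*η≡ε = shrink B ε 0<B 0<ε
      M , close = both bounded (y≈y′ η 0<η)
  in M , λ n M≤n → ∣product∣< (seq x n) (seq y n) (seq y′ n) 0<B B*η≡ε (proj₁ (close n M≤n)) (proj₂ (close n M≤n))

NonNegℝ : ℝ → Set
NonNegℝ x = 0ℝ ≤ℝ x

nonNeg-≈ : ∀ {x y} → x ≈ℝ y → NonNegℝ x → NonNegℝ y
nonNeg-≈ {x} {y} x≈y 0≤x ε 0<ε with both (x≈y (½ ℚ.* ε) (half-pos 0<ε)) (0≤x (½ ℚ.* ε) (half-pos 0<ε))
... | M , close = M , λ n M≤n → subst (0ℚ ℚ.<_)
  (trans (regroup (seq x n) (seq y n) (½ ℚ.* ε)) (cong (seq y n ℚ.+_) (two-halves ε)))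
  (ℚ.<-trans (subst (0ℚ ℚ.<_) (sym (cancel (seq x n) (½ ℚ.* ε) (seq x n ℚ.- seq y n)))
     (proj₂ (close n M≤n)))
   (ℚ.+-monoʳ-< (seq x n ℚ.+ ½ ℚ.* ε ℚ.- (seq x n ℚ.- seq y n))
     (ℚ.≤-<-trans (p≤∣p∣ (seq x n ℚ.- seq y n)) (proj₁ (close n M≤n)))))
  where
  open +-*-Solver
  cancel : ∀ p h d → p ℚ.+ h ℚ.- d ℚ.+ d ≡ p ℚ.+ h
  cancel = solve 3 (λ p h d → p :+ h :- d :+ d := p :+ h) refl
  regroup : ∀ p q h → p ℚ.+ h ℚ.- (p ℚ.- q) ℚ.+ h ≡ q ℚ.+ (h ℚ.+ h)
  regroup = solve 3 (λ p q h → p :+ h :- (p :- q) :+ h := q :+ (h :+ h)) refl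

nonNeg-+ : ∀ {x y} → NonNegℝ x → NonNegℝ y → NonNegℝ (x +ℝ y)
nonNeg-+ {x} {y} 0≤x 0≤y ε 0<ε with both (0≤x (½ ℚ.* ε) (half-pos 0<ε)) (0≤y (½ ℚ.* ε) (half-pos 0<ε))
... | M , close = M , λ n M≤n → subst (0ℚ ℚ.<_)
  (trans (regroup (seq x n) (seq y n) (½ ℚ.* ε)) (cong (seq x n ℚ.+ seq y n ℚ.+_) (two-halves ε)))
  (ℚ.+-mono-< (proj₁ (close n M≤n)) (proj₂ (close n M≤n)))
  where
  open +-*-Solver
  regroup : ∀ p q h → (p ℚ.+ h) ℚ.+ (q ℚ.+ h) ≡ p ℚ.+ q ℚ.+ (h ℚ.+ h)
  regroup = solve 3 (λ p q h → (p :+ h) :+ (q :+ h) := p :+ q :+ (h :+ h)) refl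

nonNeg-const : ∀ {q} → 0ℚ ℚ.≤ q → NonNegℝ (fromℚ q)
nonNeg-const {q} 0≤q ε 0<ε = 0 , λ _ _ → ℚ.+-mono-≤-< 0≤q 0<ε

nonNeg-sum : ∀ {m} {f : Vector ℝ m} → (∀ a → NonNegℝ (f a)) → NonNegℝ (sumℝ f)
nonNeg-sum {zero}  0≤f = nonNeg-const ℚ.≤-refl
nonNeg-sum {suc m} {f} 0≤f = nonNeg-+ {f zero} {sumℝ (f ∘ suc)} (0≤f zero) (nonNeg-sum {f = f ∘ suc} (0≤f ∘ suc))

nonNeg-scale : ∀ {q x} → 0ℚ ℚ.≤ q → NonNegℝ x → NonNegℝ (fromℚ q *ℝ x)
nonNeg-scale {q} {x} 0≤q 0≤x ε 0<ε =
  -- Dividing by `1ℚ + q` instead of `q` covers `q = 0` and leaves one `η` over for strictness.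
  let η , 0<η , eq = shrink (1ℚ ℚ.+ q) ε (ℚ.+-mono-<-≤ (ℚ.positive⁻¹ 1ℚ) 0≤q) 0<ε
      M , pos = 0≤x η 0<η
  in M , λ n M≤n → bound (seq x n) η 0<η eq (pos n M≤n)
  where
  bound : ∀ p η → 0ℚ ℚ.< η → (1ℚ ℚ.+ q) ℚ.* η ≡ ε → 0ℚ ℚ.< p ℚ.+ η → 0ℚ ℚ.< q ℚ.* p ℚ.+ ε
  bound p η 0<η eq 0<p+η = subst (0ℚ ℚ.<_) (trans regroup (cong (q ℚ.* p ℚ.+_) eq))
    (ℚ.+-mono-<-≤ 0<η (subst (ℚ._≤ q ℚ.* (p ℚ.+ η)) (ℚ.*-zeroʳ q)
      (ℚ.*-monoˡ-≤-nonNeg q {{ℚ.nonNegative 0≤q}} (ℚ.<⇒≤ 0<p+η))))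
    where
    open +-*-Solver
    regroup : η ℚ.+ q ℚ.* (p ℚ.+ η) ≡ q ℚ.* p ℚ.+ (1ℚ ℚ.+ q) ℚ.* η
    regroup = solve 3 (λ q p η → η :+ q :* (p :+ η) := q :* p :+ (con 1ℚ :+ q) :* η) refl q p η

-- The way back from real to integer inequalities: the tolerance 1 gives `0 < z + 1`, which suffices
-- for an integer.
nonNeg-fromℤ⁻ : ∀ {z} → NonNegℝ (fromℤ z) → 0ℤ ℤ.≤ z
nonNeg-fromℤ⁻ {z} 0≤z with 0≤z 1ℚ (ℚ.positive⁻¹ 1ℚ)
... | M , pos = subst (0ℤ ℤ.≤_) (pred z) (ℤ.i<j⇒i≤pred[j]
        (ι-cancel-< {0ℤ} {z ℤ.+ 1ℤ} (subst (0ℚ ℚ.<_) (sym (ι-+ z 1ℤ)) (pos M ℕ.≤-refl))))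
  where
  pred : ∀ z → ℤ.-1ℤ ℤ.+ (z ℤ.+ 1ℤ) ≡ z
  pred = ℤSolver.solve-∀

ι-mono : ∀ {z} → 0ℤ ℤ.≤ z → 0ℚ ℚ.≤ ι z
ι-mono {+ k} _ = ι-nonNeg k

-- Integer functionals on the cone and the hull

functional : ∀ {N} → (Fin N → ℤ) → ℝ^ N → ℝ
functional α x = sumℝ λ k → fromℤ (α k) *ℝ x k

functional-cong : ∀ {N} α {x y : ℝ^ N} → x ≋ y → functional α x ≈ℝ functional α y
functional-cong α {x} {y} x≋y = sumℝ-cong {f = λ k → fromℤ (α k) *ℝ x k} {g = λ k → fromℤ (α k) *ℝ y k}
  λ k → *ℝ-congˡ (fromℤ (α k)) {x k} {y k} (x≋y k)

ι-pairing : ∀ {N} (α z : Fin N → ℤ) → ι (pairing α z) ≡ ℚΣ.sum (λ k → ι (α k) ℚ.* ι (z k))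
ι-pairing α z = trans (ι-sum (λ k → α k ℤ.* z k)) (ℚΣ.sum-cong-≗ λ k → ι-* (α k) (z k))

exchange : ∀ {N m} (A : Fin N → ℚ) τ (C : Fin m → ℚ) (R : Fin m → Fin N → ℚ) →
           ℚΣ.sum (λ k → A k ℚ.* (τ ℚ.* ℚΣ.sum (λ a → C a ℚ.* R a k))) ≡
           τ ℚ.* ℚΣ.sum (λ a → C a ℚ.* ℚΣ.sum (λ k → A k ℚ.* R a k))
exchange A τ C R = sym (trans
  (cong (τ ℚ.*_) (trans (ℚΣ.sum-cong-≗ λ a → ℚΣ.*-distribˡ-sum (C a) (λ k → A k ℚ.* R a k))
    (ℚΣ.∑-comm (λ a k → C a ℚ.* (A k ℚ.* R a k)))))
  (trans (ℚΣ.*-distribˡ-sum τ (λ k → ℚΣ.sum (λ a → C a ℚ.* (A k ℚ.* R a k))))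
    (ℚΣ.sum-cong-≗ λ k → trans
      (cong (τ ℚ.*_) (trans (ℚΣ.sum-cong-≗ λ a → swap (C a) (A k) (R a k))
        (sym (ℚΣ.*-distribˡ-sum (A k) (λ a → C a ℚ.* R a k)))))
      (swap τ (A k) (ℚΣ.sum (λ a → C a ℚ.* R a k))))))
  where
  open +-*-Solver
  swap : ∀ c a r → c ℚ.* (a ℚ.* r) ≡ a ℚ.* (c ℚ.* r)
  swap = solve 3 (λ c a r → c :* (a :* r) := a :* (c :* r)) refl

seq-e : ∀ {N} (i k : Fin N) n → seq (e i k) n ≡ ι (δ i k)
seq-e i k n with does (i Fin.≟ k)
... | true  = refl
... | false = refl

seq-root : ∀ {N} (i j k : Fin N) n → seq (e i k -ℝ e j k) n ≡ ι (root (i , j) k)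
seq-root i j k n = trans (cong₂ (λ p q → p ℚ.- q) (seq-e i k n) (seq-e j k n))
  (sym (trans (ι-+ (δ i k) (ℤ.- δ j k)) (cong (ι (δ i k) ℚ.+_) (ι-neg (δ j k)))))

e-root : ∀ {N} (i j : Fin N) {x : ℝ^ N} → x ≋ (λ k → e i k -ℝ e j k) → x ≋ fromℤ ∘ root (i , j)
e-root i j {x} x≋ k = ≈ℝ-trans {x k} {e i k -ℝ e j k} {fromℤ (root (i , j) k)} (x≋ k)
  (≈ℝ-pointwise {e i k -ℝ e j k} {fromℤ (root (i , j) k)} (seq-root i j k))

module _ {N t : ℕ} {z : Fin N → ℤ} {y : ℝ^ N} (z≋ty : fromℤ ∘ z ≋ (λ k → fromℤ (+ t) *ℝ y k))
         {m} (c : Vector ℝ m) (v : Vector (ℝ^ N) m) (r : Fin m → Fin N → ℤ)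
         (y≋ : y ≋ combination c v) (v≋ : ∀ a → v a ≋ fromℤ ∘ r a) (α : Fin N → ℤ) where

  private
    combined : ℝ^ N
    combined = combination c (λ a → fromℤ ∘ r a)

    total : ℝ
    total = sumℝ λ a → c a *ℝ fromℤ (pairing α (r a))

    scaled : ℝ^ N
    scaled k = fromℤ (+ t) *ℝ combined k

    y≋combined : y ≋ combined
    y≋combined k = ≈ℝ-trans {y k} {combination c v k} {combined k} (y≋ k)
      (sumℝ-cong {f = λ a → c a *ℝ v a k} {g = λ a → c a *ℝ fromℤ (r a k)}
        λ a → *ℝ-congˡ (c a) {v a k} {fromℤ (r a k)} (v≋ a k))

    z≋scaled : fromℤ ∘ z ≋ scaled
    z≋scaled k = ≈ℝ-trans {fromℤ (z k)} {fromℤ (+ t) *ℝ y k} {scaled k} (z≋ty k)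
      (*ℝ-congˡ (fromℤ (+ t)) {y k} {combined k} (y≋combined k))

    seq-scaled : ∀ k n → seq (scaled k) n ≡ ι (+ t) ℚ.* ℚΣ.sum (λ a → seq (c a) n ℚ.* ι (r a k))
    seq-scaled k n = cong (ι (+ t) ℚ.*_) (seq-sum (λ a → c a *ℝ fromℤ (r a k)) n)

    functional-scaled : functional α scaled ≈ℝ fromℤ (+ t) *ℝ total
    functional-scaled = ≈ℝ-pointwise {functional α scaled} {fromℤ (+ t) *ℝ total} λ n →
      trans (seq-sum (λ k → fromℤ (α k) *ℝ scaled k) n)
      (trans (ℚΣ.sum-cong-≗ λ k → cong (ι (α k) ℚ.*_) (seq-scaled k n))
      (trans (exchange (ι ∘ α) (ι (+ t)) (λ a → seq (c a) n) (λ a → ι ∘ r a))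
      (cong (ι (+ t) ℚ.*_) (trans
        (ℚΣ.sum-cong-≗ λ a → cong (seq (c a) n ℚ.*_) (sym (ι-pairing α (r a))))
        (sym (seq-sum (λ a → c a *ℝ fromℤ (pairing α (r a))) n))))))

  -- Both bounds on lattice points rest on this exchange of sums: whatever the real coefficients `c`
  -- are, only the integers `pairing α (r a)` on the generators matter.
  evaluate : fromℤ (pairing α z) ≈ℝ fromℤ (+ t) *ℝ total
  evaluate = ≈ℝ-trans {fromℤ (pairing α z)} {functional α (fromℤ ∘ z)} {fromℤ (+ t) *ℝ total}
    (≈ℝ-pointwise {fromℤ (pairing α z)} {functional α (fromℤ ∘ z)} λ n →
      trans (ι-pairing α z) (sym (seq-sum (λ k → fromℤ (α k) *ℝ fromℤ (z k)) n)))
    (≈ℝ-trans {functional α (fromℤ ∘ z)} {functional α scaled} {fromℤ (+ t) *ℝ total}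
      (functional-cong α {fromℤ ∘ z} {scaled} z≋scaled) functional-scaled)

nonNeg-weighted : ∀ t {m} (c : Vector ℝ m) (h : Fin m → ℤ) →
                  (∀ a → NonNegℝ (c a)) → (∀ a → 0ℤ ℤ.≤ h a) →
                  NonNegℝ (fromℤ (+ t) *ℝ sumℝ λ a → c a *ℝ fromℤ (h a))
nonNeg-weighted t c h 0≤c 0≤h = nonNeg-scale {ι (+ t)} {sumℝ λ a → c a *ℝ fromℤ (h a)} (ι-nonNeg t)
  (nonNeg-sum {f = λ a → c a *ℝ fromℤ (h a)} λ a →
    nonNeg-≈ {fromℤ (h a) *ℝ c a} {c a *ℝ fromℤ (h a)}
      (≈ℝ-pointwise {fromℤ (h a) *ℝ c a} {c a *ℝ fromℤ (h a)} λ n → ℚ.*-comm (ι (h a)) (seq (c a) n))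
      (nonNeg-scale {ι (h a)} {c a} (ι-mono (0≤h a)) (0≤c a)))

cone-pairing : ∀ {N} (T : Graph N) t z → LatticePoint (Dilate t (𝒫 T)) z → ∀ α →
               (∀ {u v} → E T u v → α v ℤ.≤ α u) → 0ℤ ℤ.≤ pairing α z
cone-pairing T t z (y , (_ , m , c , v , roots , 0≤c , y≋) , z≋ty) α mono =
  nonNeg-fromℤ⁻ (nonNeg-≈ {fromℤ (+ t) *ℝ total} {fromℤ (pairing α z)}
    (≈ℝ-sym {fromℤ (pairing α z)} {fromℤ (+ t) *ℝ total} (evaluate {t = t} {z} {y} z≋ty c v r y≋ v≋ α))
    (nonNeg-weighted t c (λ a → pairing α (r a)) 0≤c 0≤g))
  where
  r : Fin m → Fin _ → ℤ
  r a = root (proj₁ (roots a) , proj₁ (proj₂ (roots a)))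
  total = sumℝ λ a → c a *ℝ fromℤ (pairing α (r a))
  v≋ : ∀ a → v a ≋ fromℤ ∘ r a
  v≋ a = e-root (proj₁ (roots a)) (proj₁ (proj₂ (roots a))) {v a} (proj₂ (proj₂ (proj₂ (roots a))))
  0≤g : ∀ a → 0ℤ ℤ.≤ pairing α (r a)
  0≤g a = subst (0ℤ ℤ.≤_) (sym (pairing-root α (proj₁ (roots a) , proj₁ (proj₂ (roots a)))))
    (ℤ.i≤j⇒0≤j-i (mono (proj₁ (proj₂ (proj₂ (roots a))))))

-- As the coefficients sum to 1, a bound by `τ` from above is the nonnegativity of the combination
-- of `1 - g`. So the criterion for nonnegative reals also handles the upper bound.
complement : ∀ τ {m} (c : Vector ℝ m) (g h : Fin m → ℤ) P → (∀ a → h a ℤ.+ g a ≡ 1ℤ) → sumℝ c ≈ℝ 1ℝ →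
             P ≈ℝ fromℤ τ *ℝ sumℝ (λ a → c a *ℝ fromℤ (g a)) →
             fromℤ τ *ℝ sumℝ (λ a → c a *ℝ fromℤ (h a)) ≈ℝ fromℤ τ +ℝ -ℝ P
complement τ c g h P h+g ∑c P≈ = ≈ℝ-trans {D} {(D +ℝ P) +ℝ -ℝ P} {fromℤ τ +ℝ -ℝ P}
  (≈ℝ-pointwise {D} {(D +ℝ P) +ℝ -ℝ P} λ n → cancel (seq D n) (seq P n))
  (+ℝ-cong {D +ℝ P} {fromℤ τ} { -ℝ P} { -ℝ P} D+P≈τ (≈ℝ-pointwise { -ℝ P} { -ℝ P} λ _ → refl))
  where
  open +-*-Solver
  D G : ℝ
  D = fromℤ τ *ℝ sumℝ (λ a → c a *ℝ fromℤ (h a))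
  G = fromℤ τ *ℝ sumℝ (λ a → c a *ℝ fromℤ (g a))
  cancel : ∀ p q → p ≡ p ℚ.+ q ℚ.- q
  cancel = solve 2 (λ p q → p := p :+ q :- q) refl
  D+G : ∀ n → seq (D +ℝ G) n ≡ seq (fromℤ τ *ℝ sumℝ c) n
  D+G n = trans
    (cong₂ (λ p q → ι τ ℚ.* p ℚ.+ ι τ ℚ.* q)
      (seq-sum (λ a → c a *ℝ fromℤ (h a)) n) (seq-sum (λ a → c a *ℝ fromℤ (g a)) n))
    (trans (sym (ℚ.*-distribˡ-+ (ι τ) (ℚΣ.sum (λ a → seq (c a) n ℚ.* ι (h a))) (ℚΣ.sum (λ a → seq (c a) n ℚ.* ι (g a)))))
      (cong (ι τ ℚ.*_) (trans
        (sym (ℚΣ.∑-distrib-+ (λ a → seq (c a) n ℚ.* ι (h a)) (λ a → seq (c a) n ℚ.* ι (g a))))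
        (trans (ℚΣ.sum-cong-≗ λ a → trans (sym (ℚ.*-distribˡ-+ (seq (c a) n) (ι (h a)) (ι (g a))))
          (trans (cong (seq (c a) n ℚ.*_) (trans (sym (ι-+ (h a) (g a))) (cong ι (h+g a)))) (ℚ.*-identityʳ (seq (c a) n))))
          (sym (seq-sum c n))))))
  D+P≈τ : D +ℝ P ≈ℝ fromℤ τ
  D+P≈τ = ≈ℝ-trans {D +ℝ P} {D +ℝ G} {fromℤ τ}
    (+ℝ-cong {D} {D} {P} {G} (≈ℝ-pointwise {D} {D} λ _ → refl) P≈)
    (≈ℝ-trans {D +ℝ G} {fromℤ τ *ℝ sumℝ c} {fromℤ τ}
      (≈ℝ-pointwise {D +ℝ G} {fromℤ τ *ℝ sumℝ c} D+G)
      (≈ℝ-trans {fromℤ τ *ℝ sumℝ c} {fromℤ τ *ℝ 1ℝ} {fromℤ τ}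
        (*ℝ-congˡ (fromℤ τ) {sumℝ c} {1ℝ} ∑c)
        (≈ℝ-pointwise {fromℤ τ *ℝ 1ℝ} {fromℤ τ} λ n → ℚ.*-identityʳ (ι τ))))

hull-vector : ∀ {N} (α : Fin N → ℤ) → (∀ u v → drop α (u , v) ℤ.≤ 1ℤ) → ∀ {x} →
              x ≋ origin ⊎ PositiveRoot x → ∃ λ r → x ≋ fromℤ ∘ r × pairing α r ℤ.≤ 1ℤ
hull-vector α bounded (inj₁ x≋0) = (λ _ → 0ℤ) , x≋0 , subst (ℤ._≤ 1ℤ) (sym (pairing-0 α)) (ℤ.+≤+ z≤n)
hull-vector α bounded {x} (inj₂ (i , j , _ , x≋)) = root (i , j) , e-root i j {x} x≋ ,
  subst (ℤ._≤ 1ℤ) (sym (pairing-root α (i , j))) (bounded i j)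

hull-pairing : ∀ {N} (T : Graph N) t z → LatticePoint (Dilate t (𝒫 T)) z → ∀ α →
               (∀ u v → drop α (u , v) ℤ.≤ 1ℤ) → pairing α z ℤ.≤ + t
hull-pairing {N} T t z (y , ((m , c , v , points , 0≤c , ∑c , y≋) , _) , z≋ty) α bounded =
  at (λ a → proj₁ (vector a)) (λ a → proj₁ (proj₂ (vector a))) (λ a → proj₂ (proj₂ (vector a)))
  where
  vector : ∀ a → ∃ λ r → v a ≋ fromℤ ∘ r × pairing α r ℤ.≤ 1ℤ
  vector a = hull-vector α bounded {v a} (points a)
  at : (r : Fin m → Fin N → ℤ) → (∀ a → v a ≋ fromℤ ∘ r a) → (∀ a → pairing α (r a) ℤ.≤ 1ℤ) → pairing α z ℤ.≤ + t
  at r v≋ g≤1 = ℤ.0≤i-j⇒j≤i (nonNeg-fromℤ⁻ (nonNeg-≈ {slack} {fromℤ (+ t ℤ.- pairing α z)} slack≈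
    (nonNeg-weighted t c (λ a → 1ℤ ℤ.- pairing α (r a)) 0≤c λ a → ℤ.i≤j⇒0≤j-i (g≤1 a))))
    where
    slack : ℝ
    slack = fromℤ (+ t) *ℝ sumℝ λ a → c a *ℝ fromℤ (1ℤ ℤ.- pairing α (r a))
    cancel : ∀ x → (1ℤ ℤ.- x) ℤ.+ x ≡ 1ℤ
    cancel = ℤSolver.solve-∀
    slack≈ : slack ≈ℝ fromℤ (+ t ℤ.- pairing α z)
    slack≈ = ≈ℝ-trans {slack} {fromℤ (+ t) +ℝ -ℝ fromℤ (pairing α z)} {fromℤ (+ t ℤ.- pairing α z)}
      (complement (+ t) c (λ a → pairing α (r a)) (λ a → 1ℤ ℤ.- pairing α (r a)) (fromℤ (pairing α z))
        (λ a → cancel (pairing α (r a))) ∑c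
        (evaluate {t = t} {z} {y} z≋ty c v r y≋ v≋ α))
      (≈ℝ-pointwise {fromℤ (+ t) +ℝ -ℝ fromℤ (pairing α z)} {fromℤ (+ t ℤ.- pairing α z)} λ n →
        sym (trans (ι-+ (+ t) (ℤ.- pairing α z)) (cong (ι (+ t) ℚ.+_) (ι-neg (pairing α z)))))

-- Points of the dilated polytope from lists of roots

lookup-All : ∀ {a p} {A : Set a} {P : A → Set p} {xs : List A} → All P xs → ∀ k → P (lookup xs k)
lookup-All (p ∷ ps) zero    = p
lookup-All (p ∷ ps) (suc k) = lookup-All ps k

rootVector : ∀ {N} → Fin N × Fin N → ℝ^ N
rootVector (i , j) k = e i k -ℝ e j k

ι-rootSum : ∀ {N} (es : List (Fin N × Fin N)) u k →
            ℚΣ.sum (λ a → u ℚ.* ι (root (lookup es a) k)) ≡ u ℚ.* ι (rootSum es k)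
ι-rootSum []       u k = sym (ℚ.*-zeroʳ u)
ι-rootSum (e ∷ es) u k = trans (cong (u ℚ.* ι (root e k) ℚ.+_) (ι-rootSum es u k))
  (trans (sym (ℚ.*-distribˡ-+ u (ι (root e k)) (ι (rootSum es k))))
    (cong (u ℚ.*_) (sym (ι-+ (root e k) (rootSum es k)))))

uniform : ∀ {N} u (es : List (Fin N × Fin N)) k n →
          ℚΣ.sum (λ a → u ℚ.* seq (rootVector (lookup es a) k) n) ≡ u ℚ.* ι (rootSum es k)
uniform u es k n = trans
  (ℚΣ.sum-cong-≗ λ a → cong (u ℚ.*_) (seq-root (proj₁ (lookup es a)) (proj₂ (lookup es a)) k n))
  (ι-rootSum es u k)

sum-constant : ∀ m u → ℚΣ.sum {m} (λ _ → u) ≡ ι (+ m) ℚ.* u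
sum-constant zero    u = sym (ℚ.*-zeroˡ u)
sum-constant (suc m) u = trans (cong (u ℚ.+_) (sum-constant m u))
  (trans (cong (ℚ._+ ι (+ m) ℚ.* u) (sym (ℚ.*-identityˡ u)))
  (trans (sym (ℚ.*-distribʳ-+ u 1ℚ (ι (+ m)))) (cong (ℚ._* u) (sym (ι-+ 1ℤ (+ m))))))

module _ {N : ℕ} (T : Graph N) (z : Fin N → ℤ) where

  private
    multiple : ℚ → ℝ^ N
    multiple u k = fromℚ (u ℚ.* ι (z k))

  multiple∈cone : ∀ {u} → 0ℚ ℚ.≤ u → ∀ {ts} → All (Edge T) ts → z ≗ rootSum ts → multiple u ∈ 𝒞 T
  multiple∈cone {u} 0≤u {ts} edges z≗ = length ts , (λ _ → fromℚ u) , (λ a → rootVector (lookup ts a)) ,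
    (λ a → proj₁ (lookup ts a) , proj₂ (lookup ts a) , lookup-All edges a ,
      λ k → ≈ℝ-pointwise {rootVector (lookup ts a) k} {rootVector (lookup ts a) k} λ _ → refl) ,
    (λ a → nonNeg-const 0≤u) ,
    λ k → ≈ℝ-pointwise {multiple u k} {combination (λ _ → fromℚ u) (λ a → rootVector (lookup ts a)) k}
      λ n → trans (cong (λ z → u ℚ.* ι z) (z≗ k)) (sym (trans (seq-sum (λ a → fromℚ u *ℝ rootVector (lookup ts a) k) n) (uniform u ts k n)))

  -- All roots of the list share the coefficient `u`, and the origin absorbs the remaining weight
  -- `w`.
  multiple∈hull : ∀ {u w} → 0ℚ ℚ.≤ u → 0ℚ ℚ.≤ w → ∀ {es} → All (λ (i , j) → toℕ i < toℕ j) es →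
                  w ℚ.+ ι (+ length es) ℚ.* u ≡ 1ℚ → z ≗ rootSum es → multiple u ∈ 𝒫A⁺
  multiple∈hull {u} {w} 0≤u 0≤w {es} increasing total z≗ = suc (length es) , c , v , points , 0≤c ,
    ≈ℝ-pointwise {sumℝ c} {1ℝ} (λ n → trans (cong (w ℚ.+_) (trans (seq-sum (λ a → c (suc a)) n) (sum-constant (length es) u))) total) ,
    λ k → ≈ℝ-pointwise {multiple u k} {combination c v k} λ n → trans (cong (λ z → u ℚ.* ι z) (z≗ k))
      (trans (sym (ℚ.+-identityˡ (u ℚ.* ι (rootSum es k))))
        (cong₂ ℚ._+_ (sym (ℚ.*-zeroʳ w)) (sym (trans (seq-sum (λ a → c (suc a) *ℝ v (suc a) k) n) (uniform u es k n)))))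
    where
    c : Vector ℝ (suc (length es))
    c zero    = fromℚ w
    c (suc a) = fromℚ u
    v : Vector (ℝ^ N) (suc (length es))
    v zero    = origin
    v (suc a) = rootVector (lookup es a)
    points : ∀ a → v a ≋ origin ⊎ PositiveRoot (v a)
    points zero    = inj₁ λ k → ≈ℝ-pointwise {0ℝ} {0ℝ} λ _ → refl
    points (suc a) = inj₂ (proj₁ (lookup es a) , proj₂ (lookup es a) , lookup-All increasing a ,
      λ k → ≈ℝ-pointwise {rootVector (lookup es a) k} {rootVector (lookup es a) k} λ _ → refl)
    0≤c : ∀ a → 0ℝ ≤ℝ c a
    0≤c zero    = nonNeg-const 0≤w
    0≤c (suc a) = nonNeg-const 0≤u

  private
    dilated : ∀ {t u w} → 0ℚ ℚ.≤ u → 0ℚ ℚ.≤ w → (∀ k → ι (+ t) ℚ.* (u ℚ.* ι (z k)) ≡ ι (z k)) →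
              ∀ {es ts} → All (λ (i , j) → toℕ i < toℕ j) es → All (Edge T) ts →
              w ℚ.+ ι (+ length es) ℚ.* u ≡ 1ℚ → z ≗ rootSum es → z ≗ rootSum ts →
              LatticePoint (Dilate t (𝒫 T)) z
    dilated {t} {u} 0≤u 0≤w t*u increasing edges total z≗es z≗ts =
      multiple u , (multiple∈hull 0≤u 0≤w increasing total z≗es , multiple∈cone 0≤u edges z≗ts) ,
      λ k → ≈ℝ-pointwise {fromℤ (z k)} {fromℤ (+ t) *ℝ multiple u k} λ _ → sym (t*u k)

    reciprocal : ∀ q → 0ℚ ℚ.< q → ∃ λ u → 0ℚ ℚ.≤ u × q ℚ.* u ≡ 1ℚ
    reciprocal q 0<q = ℚ.1/ q , ℚ.<⇒≤ (ℚ.positive⁻¹ (ℚ.1/ q) {{ℚ.1/pos⇒pos q}}) , ℚ.*-inverseʳ q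
      where
      instance
        q-pos     = ℚ.positive 0<q
        q-nonZero = ℚ.pos⇒nonZero q

  -- Two expansions of the same `z` play different roles: `es` has few enough roots for the hull,
  -- but they need not be edges of `T`; `ts` consists of edges of `T` for the cone, and its length
  -- is unrestricted.
  lattice-point : ∀ t {es ts} → All (λ (i , j) → toℕ i < toℕ j) es → All (Edge T) ts → length es ≤ t →
                  z ≗ rootSum es → z ≗ rootSum ts → LatticePoint (Dilate t (𝒫 T)) z
  -- There is no reciprocal of 0, but `es` is empty and `z` vanishes, so the origin carries the
  -- whole weight.
  lattice-point zero {[]} increasing edges _ z≗es z≗ts =
    dilated {0} {0ℚ} {1ℚ} ℚ.≤-refl (ι-nonNeg 1) (λ k → trans (ℚ.*-zeroˡ (0ℚ ℚ.* ι (z k))) (cong ι (sym (z≗es k))))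
      increasing edges (cong (1ℚ ℚ.+_) (ℚ.*-zeroʳ (ι 0ℤ))) z≗es z≗ts
  lattice-point t@(suc t′) {es} increasing edges len≤t z≗es z≗ts
    = at (reciprocal (ι (+ t)) (ℚ.positive⁻¹ (ι (+ t)) {{ℚ.normalize-pos t 1}}))
    where
    len = length es
    at : (∃ λ u → 0ℚ ℚ.≤ u × ι (+ t) ℚ.* u ≡ 1ℚ) → LatticePoint (Dilate t (𝒫 T)) z
    -- The point to be dilated is `z` divided by `t`; the roots use up `length es` times `1 / t` of
    -- the total weight.
    at (u , 0≤u , t*u≡1) = dilated {t} {u} {ι (+ (t ∸ len)) ℚ.* u} 0≤u 0≤w
      (λ k → trans (sym (ℚ.*-assoc (ι (+ t)) u (ι (z k))))
        (trans (cong (ℚ._* ι (z k)) t*u≡1) (ℚ.*-identityˡ (ι (z k)))))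
      increasing edges total z≗es z≗ts
      where
      0≤w : 0ℚ ℚ.≤ ι (+ (t ∸ len)) ℚ.* u
      0≤w = subst (ℚ._≤ ι (+ (t ∸ len)) ℚ.* u) (ℚ.*-zeroʳ (ι (+ (t ∸ len))))
        (ℚ.*-monoˡ-≤-nonNeg (ι (+ (t ∸ len))) {{ℚ.nonNegative (ι-nonNeg (t ∸ len))}} 0≤u)
      total : ι (+ (t ∸ len)) ℚ.* u ℚ.+ ι (+ len) ℚ.* u ≡ 1ℚ
      total = trans (sym (ℚ.*-distribʳ-+ u (ι (+ (t ∸ len))) (ι (+ len))))
        (trans (cong (ℚ._* u) (trans (sym (ι-+ (+ (t ∸ len)) (+ len))) (cong (ι ∘ +_) (ℕ.m∸n+n≡m len≤t)))) t*u≡1)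

-- Enumerations

module _ {a ℓ p} (S : Setoid a ℓ) {P : Pred (Setoid.Carrier S) p} where
  open Setoid S using (Carrier; _≈_) renaming (sym to ≈-sym; trans to ≈-trans; reflexive to ≈-reflexive)

  lookup-distinct : ∀ {xs} → AllPairs (λ x y → ¬ x ≈ y) xs → ∀ i j → lookup xs i ≈ lookup xs j → i ≡ j
  lookup-distinct (x∉ ∷ _)  zero    zero    eq = refl
  lookup-distinct (x∉ ∷ _)  zero    (suc j) eq = contradiction eq (lookup-All x∉ j)
  lookup-distinct (x∉ ∷ _)  (suc i) zero    eq = contradiction (≈-sym eq) (lookup-All x∉ i)
  lookup-distinct (_ ∷ xs!) (suc i) (suc j) eq = cong suc (lookup-distinct xs! i j eq)

  enumerate : ∀ xs → All P xs → AllPairs (λ x y → ¬ x ≈ y) xs →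
              (∀ x → P x → ∃ λ y → y ∈ˡ xs × y ≈ x) → HasSize S P (length xs)
  enumerate xs Pxs xs! complete = record
    { to        = λ k → lookup xs k , lookup-All Pxs k
    ; cong      = λ eq → ≈-reflexive (cong (lookup xs) eq)
    ; bijective = (λ {i} {j} → lookup-distinct xs! i j) , λ (x , Px) → hit x (complete x Px)
    }
    where
    hit : ∀ x → (∃ λ y → y ∈ˡ xs × y ≈ x) → ∃ λ i → ∀ {j} → j ≡ i → lookup xs j ≈ x
    hit x (y , y∈ , y≈x) = index y∈ , λ { refl → ≈-trans (≈-reflexive (sym (lookup-index y∈))) y≈x }

  private
    size-≤ : ∀ {m m′} → HasSize S P m → HasSize S P m′ → ∃ λ (f : Fin m → Fin m′) → ∀ {i j} → f i ≡ f j → i ≡ j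
    size-≤ B B′ = (λ i → proj₁ (β′.surjective (β.to i))) , λ {i} {j} eq → β.injective
      (≈-trans (≈-sym (proj₂ (β′.surjective (β.to i)) refl)) (proj₂ (β′.surjective (β.to j)) eq))
      where
      module β  = Bijection B
      module β′ = Bijection B′

  size-unique : ∀ {m m′} → HasSize S P m → HasSize S P m′ → m ≡ m′
  size-unique B B′ = Fin.cantor-schröder-bernstein (proj₂ (size-≤ B B′)) (proj₂ (size-≤ B′ B))

increment : ∀ {m} → Vec ℕ (suc m) → Vec ℕ (suc m)
increment (x ∷ xs) = suc x ∷ xs

increment-injective : ∀ {m} {xs ys : Vec ℕ (suc m)} → increment xs ≡ increment ys → xs ≡ ys
increment-injective {xs = x ∷ xs} {y ∷ ys} refl = refl

-- The lattice points of the t-fold dilated simplex from which the facets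
-- x k = 0 with σ k = true have been removed.
halfOpen : ∀ {m} → Vec Bool m → ℕ → List (Vec ℕ m)
halfOpen []          t       = [] ∷ []
halfOpen (false ∷ σ) zero    = map (0 ∷_) (halfOpen σ 0)
halfOpen (false ∷ σ) (suc t) = map (0 ∷_) (halfOpen σ (suc t)) ++ map increment (halfOpen (false ∷ σ) t)
halfOpen (true ∷ σ)  zero    = []
halfOpen (true ∷ σ)  (suc t) = map increment (halfOpen (false ∷ σ) t)

Admissible : ∀ {m} → Vec Bool m → ℕ → Vec ℕ m → Set
Admissible σ t b = (∀ k → Vec.lookup σ k ≡ true → 0 < Vec.lookup b k) × sum (Vec.lookup b) ≤ t

private
  zero-admissible : ∀ {m} {σ : Vec Bool m} {t} b → Admissible σ t b → Admissible (false ∷ σ) t (0 ∷ b)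
  zero-admissible b (pos , le) = (λ { (suc k) → pos k }) , le

  suc-admissible : ∀ {m β} {σ : Vec Bool m} {t} b → Admissible (false ∷ σ) t b → Admissible (β ∷ σ) (suc t) (increment b)
  suc-admissible (x ∷ b) (pos , le) = (λ { zero _ → z<s ; (suc k) → pos (suc k) }) , s≤s le

halfOpen-sound : ∀ {m} (σ : Vec Bool m) t → All (Admissible σ t) (halfOpen σ t)
halfOpen-sound []          t       = ((λ ()) , z≤n) ∷ []
halfOpen-sound (false ∷ σ) zero    = All.map⁺ (All.map (λ {b} → zero-admissible {σ = σ} b) (halfOpen-sound σ 0))
halfOpen-sound (false ∷ σ) (suc t) = All.++⁺
  (All.map⁺ (All.map (λ {b} → zero-admissible {σ = σ} b) (halfOpen-sound σ (suc t))))
  (All.map⁺ (All.map (λ {b} → suc-admissible {β = false} {σ} b) (halfOpen-sound (false ∷ σ) t)))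
halfOpen-sound (true ∷ σ)  zero    = []
halfOpen-sound (true ∷ σ)  (suc t) = All.map⁺ (All.map (λ {b} → suc-admissible {β = true} {σ} b) (halfOpen-sound (false ∷ σ) t))

halfOpen-complete : ∀ {m} (σ : Vec Bool m) t b → Admissible σ t b → b ∈ˡ halfOpen σ t
halfOpen-complete []          t       []            _          = here refl
halfOpen-complete (false ∷ σ) zero    (zero ∷ b)    (pos , le) =
  ∈-map⁺ (0 ∷_) (halfOpen-complete σ 0 b ((λ k → pos (suc k)) , le))
halfOpen-complete (false ∷ σ) (suc t) (zero ∷ b)    (pos , le) =
  ∈-++⁺ˡ (∈-map⁺ (0 ∷_) (halfOpen-complete σ (suc t) b ((λ k → pos (suc k)) , le)))
halfOpen-complete (false ∷ σ) (suc t) (suc x ∷ b)   (pos , s≤s le) =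
  ∈-++⁺ʳ (map (0 ∷_) (halfOpen σ (suc t))) (∈-map⁺ increment (halfOpen-complete (false ∷ σ) t (x ∷ b)
    ((λ { (suc k) → pos (suc k) }) , le)))
halfOpen-complete (true ∷ σ)  t       (zero ∷ b)    (pos , le) with () ← pos zero refl
halfOpen-complete (true ∷ σ)  (suc t) (suc x ∷ b)   (pos , s≤s le) =
  ∈-map⁺ increment (halfOpen-complete (false ∷ σ) t (x ∷ b) ((λ { (suc k) → pos (suc k) }) , le))

halfOpen-distinct : ∀ {m} (σ : Vec Bool m) t → AllPairs _≢_ (halfOpen σ t)
halfOpen-distinct []          t       = [] ∷ []
halfOpen-distinct (false ∷ σ) zero    =
  AllPairs.map⁺ (AllPairs.map (λ x≢y eq → x≢y (Vec.∷-injectiveʳ eq)) (halfOpen-distinct σ 0))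
halfOpen-distinct (false ∷ σ) (suc t) = AllPairs.++⁺
  (AllPairs.map⁺ (AllPairs.map (λ x≢y eq → x≢y (Vec.∷-injectiveʳ eq)) (halfOpen-distinct σ (suc t))))
  (AllPairs.map⁺ (AllPairs.map (_∘ increment-injective) (halfOpen-distinct (false ∷ σ) t)))
  (All.map⁺ (All.universal (λ x → All.map⁺ (All.universal (λ { (y ∷ ys) () }) (halfOpen (false ∷ σ) t))) (halfOpen σ (suc t))))
halfOpen-distinct (true ∷ σ)  zero    = []
halfOpen-distinct (true ∷ σ)  (suc t) =
  AllPairs.map⁺ (AllPairs.map (_∘ increment-injective) (halfOpen-distinct (false ∷ σ) t))

-- Finite enumeration of the noncrossing alternating trees

Arc? : ∀ V i j → Dec (Arc V i j)
Arc? V i j = map′ (λ (i<j , h) → i<j , λ {q} i<q q≤j → h {q} (s≤s q≤j) i<q) (λ (i<j , h) → i<j , λ {q} q<1+j i<q → h {q} i<q (ℕ.≤-pred q<1+j))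
  (i ℕ.<? j ×-dec ℕ.allUpTo? (λ q → i ℕ.<? q →-dec (V i ℕ.<? V q ×-dec V (suc j) ℕ.<? V q)) (suc j))

⇔-dec : ∀ {a b} {A : Set a} {B : Set b} → Dec A → Dec B → Dec (A ⇔ B)
⇔-dec A? B? = map′ (λ (f , g) → mk⇔ f g) (λ f → Equivalence.to f , Equivalence.from f) ((A? →-dec B?) ×-dec (B? →-dec A?))

arcGraph : ∀ n → (ℕ → ℕ) → Graph (suc n)
arcGraph n V = record
  { E   = λ i j → Arc V (toℕ i) (toℕ j)
  ; E⇒< = proj₁
  ; E?  = λ i j → Arc? V (toℕ i) (toℕ j)
  }

-- One bit per ordered pair of vertices. Bits of pairs that are not increasing are ignored, so every
-- code is a graph but a graph has several codes; duplicates are removed later.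
codeGraph : ∀ N → Fin (2 ^ (N * N)) → Graph N
codeGraph N k = record
  { E   = λ i j → toℕ i < toℕ j × Fin.finToFun {2} {N * N} k (Fin.combine i j) ≡ suc zero
  ; E⇒< = proj₁
  ; E?  = λ i j → toℕ i ℕ.<? toℕ j ×-dec Fin.finToFun {2} {N * N} k (Fin.combine i j) Fin.≟ suc zero
  }

graphCode : ∀ {N} (G : Graph N) → ∃ λ k → ∀ i j → E (codeGraph N k) i j ⇔ E G i j
graphCode {N} G = Fin.funToFin bit , λ i j → mk⇔
  (λ (_ , eq) → from (E? G i j) (trans (sym (bit≡ i j)) eq))
  (λ ij → E⇒< G ij , trans (bit≡ i j) (to (E? G i j) ij))
  where
  entry : Fin N × Fin N → Fin 2
  entry (i , j) = if does (E? G i j) then suc zero else zero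
  bit : Fin (N * N) → Fin 2
  bit x = entry (Fin.remQuot N x)
  bit≡ : ∀ i j → Fin.finToFun {2} {N * N} (Fin.funToFin bit) (Fin.combine i j) ≡ entry (i , j)
  bit≡ i j = trans (Fin.finToFun-funToFin bit (Fin.combine i j)) (cong entry (Fin.remQuot-combine i j))
  from : ∀ {i j} (d : Dec (E G i j)) → (if does d then suc zero else zero) ≡ suc {n = 1} zero → E G i j
  from (yes ij) _ = ij
  from (no _)  ()
  to : ∀ {i j} (d : Dec (E G i j)) → E G i j → (if does d then suc zero else zero) ≡ suc {n = 1} zero
  to (yes _)  _  = refl
  to (no ¬ij) ij = contradiction ij ¬ij

private
  ⇔-trans : ∀ {A B C : Set} → A ⇔ B → B ⇔ C → A ⇔ C
  ⇔-trans f g = mk⇔ (Equivalence.to g ∘ Equivalence.to f) (Equivalence.from f ∘ Equivalence.from g)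

module Trees {n : ℕ} (T : Graph (suc n)) where

  private
    NAT : Graph (suc n) → Set
    NAT = NoncrossingAlternatingTree T

  represented⇒NAT : ∀ {V} → Generic n V → (G : Graph (suc n)) → Represents V G →
                    (∀ {i j} → E G i j → E (closure T) i j) → NAT G
  represented⇒NAT generic G rep sub = ((connected , forest) , sub) , noncrossing , alternating
    where open Represented generic G rep

  NAT⇒represented : (G : Graph (suc n)) → NAT G → Represents (Height.height G) G
  NAT⇒represented G (((conn , _) , _) , nc , alt) = Height.height-represents G nc alt conn

  NAT-resp : ∀ {G H} → (∀ i j → E G i j ⇔ E H i j) → NAT H → NAT G
  NAT-resp {G} {H} G≈H nat@((_ , sub) , _) = represented⇒NAT (Height.height-generic H) G
    (λ i j → ⇔-trans (G≈H i j) (NAT⇒represented H nat i j)) (sub ∘ Equivalence.to (G≈H _ _))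

  -- Connectedness and acyclicity quantify over walks of any length. Being represented by its own
  -- height function is equivalent for noncrossing alternating trees and is a finite check.
  NAT? : ∀ G → Dec (NAT G)
  NAT? G = map′ (λ (rep , sub) → represented⇒NAT (Height.height-generic G) G rep (λ {i} {j} → sub i j))
    (λ nat@((_ , sub) , _) → NAT⇒represented G nat , λ i j → sub)
    ((Fin.all? λ i → Fin.all? λ j → ⇔-dec (E? G i j) (Arc? (Height.height G) (toℕ i) (toℕ j)))
      ×-dec (Fin.all? λ i → Fin.all? λ j → E? G i j →-dec E? (closure T) i j))

  Tree : Set₁
  Tree = Σ (Graph (suc n)) NAT

  Tree-decSetoid : DecSetoid _ _
  Tree-decSetoid = record
    { isDecEquivalence = record
      { isEquivalence = Setoid.isEquivalence (restrict (Graph-setoid (suc n)) NAT)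
      ; _≟_ = λ (G , _) (H , _) → Fin.all? λ i → Fin.all? λ j → ⇔-dec (E? G i j) (E? H i j)
      }
    }

  open DecSetoid Tree-decSetoid public using () renaming (_≈_ to _≈ᵗ_; _≟_ to _≟ᵗ_)

  private
    candidate : (G : Graph (suc n)) → Dec (NAT G) → List Tree
    candidate G (yes nat) = (G , nat) ∷ []
    candidate G (no _)    = []

    candidates : List Tree
    candidates = concatMap (λ k → candidate (codeGraph (suc n) k) (NAT? (codeGraph (suc n) k))) (allFin _)

    candidate∈ : ∀ G → NAT G → (d : Dec (NAT G)) → ∃ λ nat → (G , nat) ∈ˡ candidate G d
    candidate∈ G _   (yes nat) = nat , here refl
    candidate∈ G nat (no ¬nat) = contradiction nat ¬nat

  trees : List Tree
  trees = deduplicate _≟ᵗ_ candidates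

  trees-distinct : AllPairs (λ x y → ¬ x ≈ᵗ y) trees
  trees-distinct = Unique.deduplicate-! Tree-decSetoid candidates

  trees-complete : ∀ G → NAT G → ∃ λ y → y ∈ˡ trees × (∀ i j → E (proj₁ y) i j ⇔ E G i j)
  trees-complete G nat =
    let k , k≈G = graphCode G
        H = codeGraph (suc n) k
        nat′ , H∈ = candidate∈ H (NAT-resp {H} {G} k≈G nat) (NAT? H)
        member = lose {P = λ y → (H , nat′) ≈ᵗ y}
          (∈-concat⁺′ H∈ (∈-map⁺ (λ k → candidate (codeGraph (suc n) k) (NAT? (codeGraph (suc n) k))) (∈-allFin k)))
          (DecSetoid.refl Tree-decSetoid {H , nat′})
        y , y∈ , H≈y = find {P = λ y → (H , nat′) ≈ᵗ y} (Membership.∈-deduplicate⁺ (DecSetoid.setoid Tree-decSetoid) _≟ᵗ_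
          (λ {x} {y} {z} p q → DecSetoid.trans Tree-decSetoid {x} {y} {z} q (DecSetoid.sym Tree-decSetoid {z} {y} p)) {candidates} {H , nat′} member)
    in y , y∈ , λ i j → ⇔-trans (mk⇔ (Equivalence.from (H≈y i j)) (Equivalence.to (H≈y i j))) (k≈G i j)

-- Generating functions

ones : ∀ {m} → Vec Bool m → ℕ
ones []          = 0
ones (true ∷ σ)  = suc (ones σ)
ones (false ∷ σ) = ones σ

-- Multiplication by `1 - X` and by `X`.
Δ shift : Series → Series
Δ f zero    = f zero
Δ f (suc k) = f (suc k) ℤ.- f k
shift f zero    = 0ℤ
shift f (suc k) = f k

Δ^ : ℕ → Series → Series
Δ^ zero    f = f
Δ^ (suc m) f = Δ (Δ^ m f)

Δ-cong : ∀ {f g} → f ≗ g → Δ f ≗ Δ g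
Δ-cong f≗g zero    = f≗g zero
Δ-cong f≗g (suc k) = cong₂ ℤ._-_ (f≗g (suc k)) (f≗g k)

Δ^-cong : ∀ m {f g} → f ≗ g → Δ^ m f ≗ Δ^ m g
Δ^-cong zero    f≗g = f≗g
Δ^-cong (suc m) f≗g = Δ-cong (Δ^-cong m f≗g)

Δ^-Δ : ∀ m f → Δ^ (suc m) f ≗ Δ^ m (Δ f)
Δ^-Δ zero    f k = refl
Δ^-Δ (suc m) f   = Δ-cong (Δ^-Δ m f)

Δ-shift : ∀ f → Δ (shift f) ≗ shift (Δ f)
Δ-shift f zero          = refl
Δ-shift f (suc zero)    = ℤ.+-identityʳ (f 0)
Δ-shift f (suc (suc k)) = refl

shift-cong : ∀ {f g} → f ≗ g → shift f ≗ shift g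
shift-cong f≗g zero    = refl
shift-cong f≗g (suc k) = f≗g k

Δ^-shift : ∀ m f → Δ^ m (shift f) ≗ shift (Δ^ m f)
Δ^-shift zero    f k = refl
Δ^-shift (suc m) f k = trans (Δ-cong (Δ^-shift m f) k) (Δ-shift (Δ^ m f) k)

Δ-⊕ : ∀ f g → Δ (f ⊕ g) ≗ Δ f ⊕ Δ g
Δ-⊕ f g zero    = refl
Δ-⊕ f g (suc k) = regroup (f (suc k)) (g (suc k)) (f k) (g k)
  where
  regroup : ∀ a b c d → (a ℤ.+ b) ℤ.- (c ℤ.+ d) ≡ (a ℤ.- c) ℤ.+ (b ℤ.- d)
  regroup = ℤSolver.solve-∀

Δ^-⊕ : ∀ m f g → Δ^ m (f ⊕ g) ≗ Δ^ m f ⊕ Δ^ m g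
Δ^-⊕ zero    f g k = refl
Δ^-⊕ (suc m) f g k = trans (Δ-cong (Δ^-⊕ m f g) k) (Δ-⊕ (Δ^ m f) (Δ^ m g) k)

Δ^-0 : ∀ m → Δ^ m 0ˢ ≗ 0ˢ
Δ^-0 zero    k       = refl
Δ^-0 (suc m) k = trans (Δ-cong (Δ^-0 m) k) (Δ-0 k)
  where
  Δ-0 : Δ 0ˢ ≗ 0ˢ
  Δ-0 zero    = refl
  Δ-0 (suc k) = refl

⊛-cong : ∀ {f f′ g g′} → f ≗ f′ → g ≗ g′ → f ⊛ g ≗ f′ ⊛ g′
⊛-cong f≗f′ g≗g′ k = ℤΣ.sum-cong-≗ {suc k} λ i → cong₂ ℤ._*_ (f≗f′ (toℕ i)) (g≗g′ (k ∸ toℕ i))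

1-X : Series
1-X = 1ˢ ⊖ X^ 1

1-X-⊛ : ∀ f → 1-X ⊛ f ≗ Δ f
1-X-⊛ f zero    = trans (ℤ.+-identityʳ (1ℤ ℤ.* f 0)) (ℤ.*-identityˡ (f 0))
1-X-⊛ f (suc k) = trans
  (cong (λ s → 1ℤ ℤ.* f (suc k) ℤ.+ (ℤ.-1ℤ ℤ.* f k ℤ.+ s)) (trans (ℤΣ.sum-cong-≗ {k} λ i → ℤ.*-zeroˡ (f (k ∸ suc (toℕ i))))
    (ℤΣ.sum-replicate-zero k)))
  (tidy (f (suc k)) (f k))
  where
  tidy : ∀ a b → 1ℤ ℤ.* a ℤ.+ (ℤ.-1ℤ ℤ.* b ℤ.+ 0ℤ) ≡ a ℤ.- b
  tidy = ℤSolver.solve-∀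

1ˢ-⊛ : ∀ f → 1ˢ ⊛ f ≗ f
1ˢ-⊛ f k = trans (cong₂ ℤ._+_ (ℤ.*-identityˡ (f k)) (trans (ℤΣ.sum-cong-≗ {k} λ i → ℤ.*-zeroˡ (f (k ∸ suc (toℕ i))))
    (ℤΣ.sum-replicate-zero k))) (ℤ.+-identityʳ (f k))

Δ-⊛ : ∀ f g → Δ f ⊛ g ≗ Δ (f ⊛ g)
Δ-⊛ f g zero    = refl
Δ-⊛ f g (suc k) = trans
  (cong (ℤ._+_ (f 0 ℤ.* g (suc k))) (trans
    (ℤΣ.sum-cong-≗ {suc k} λ i → split (f (suc (toℕ i))) (f (toℕ i)) (g (k ∸ toℕ i)))
    (trans (ℤΣ.∑-distrib-+ {suc k} (λ i → f (suc (toℕ i)) ℤ.* g (k ∸ toℕ i)) (λ i → ℤ.-1ℤ ℤ.* (f (toℕ i) ℤ.* g (k ∸ toℕ i))))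
      (cong (ℤ._+_ (ℤΣ.sum {suc k} (λ i → f (suc (toℕ i)) ℤ.* g (k ∸ toℕ i))))
        (sym (ℤΣ.*-distribˡ-sum {suc k} ℤ.-1ℤ (λ i → f (toℕ i) ℤ.* g (k ∸ toℕ i))))))))
  (tidy (f 0 ℤ.* g (suc k)) (ℤΣ.sum {suc k} (λ i → f (suc (toℕ i)) ℤ.* g (k ∸ toℕ i))) ((f ⊛ g) k))
  where
  split : ∀ a b c → (a ℤ.- b) ℤ.* c ≡ a ℤ.* c ℤ.+ ℤ.-1ℤ ℤ.* (b ℤ.* c)
  split = ℤSolver.solve-∀
  tidy : ∀ a b c → a ℤ.+ (b ℤ.+ ℤ.-1ℤ ℤ.* c) ≡ (a ℤ.+ b) ℤ.- c
  tidy = ℤSolver.solve-∀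

1-X^-⊛ : ∀ m f → (1-X ^ˢ m) ⊛ f ≗ Δ^ m f
1-X^-⊛ zero    f k = 1ˢ-⊛ f k
1-X^-⊛ (suc m) f k = trans (⊛-cong {g = f} (1-X-⊛ (1-X ^ˢ m)) (λ _ → refl) k)
  (trans (Δ-⊛ (1-X ^ˢ m) f k) (Δ-cong (1-X^-⊛ m f) k))

halfOpen-series : ∀ {m} → Vec Bool m → Series
halfOpen-series σ t = + length (halfOpen σ t)

private
  length-step : ∀ a b → + (a + b) ℤ.- + b ≡ + a
  length-step a b = cancel (+ a) (+ b)
    where
    cancel : ∀ x y → x ℤ.+ y ℤ.- y ≡ x
    cancel = ℤSolver.solve-∀

  Δ-point : Δ (halfOpen-series []) ≗ X^ 0
  Δ-point zero    = refl
  Δ-point (suc k) = refl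

  -- Multiplication by `1 - X` cancels the points with positive first coordinate against all points
  -- of the preceding dilation; those with first coordinate 0 remain.
  Δ-closed : ∀ {m} (σ : Vec Bool m) → Δ (halfOpen-series (false ∷ σ)) ≗ halfOpen-series σ
  Δ-closed σ zero    = cong +_ (List.length-map (0 ∷_) (halfOpen σ 0))
  Δ-closed σ (suc t) = trans
    (cong (λ l → + l ℤ.- + length (halfOpen (false ∷ σ) t)) (trans (List.length-++ (map (0 ∷_) (halfOpen σ (suc t))))
      (cong₂ _+_ (List.length-map (0 ∷_) (halfOpen σ (suc t))) (List.length-map increment (halfOpen (false ∷ σ) t)))))
    (length-step (length (halfOpen σ (suc t))) (length (halfOpen (false ∷ σ) t)))

  open-shift : ∀ {m} (σ : Vec Bool m) → halfOpen-series (true ∷ σ) ≗ shift (halfOpen-series (false ∷ σ))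
  open-shift σ zero    = refl
  open-shift σ (suc t) = cong +_ (List.length-map increment (halfOpen (false ∷ σ) t))

  shift-X : ∀ l → shift (X^ l) ≗ X^ (suc l)
  shift-X l zero    = refl
  shift-X l (suc k) = refl

private
  closed-step : ∀ {m} (σ : Vec Bool m) → Δ^ (suc m) (halfOpen-series σ) ≗ X^ (ones σ) →
                Δ^ (suc (suc m)) (halfOpen-series (false ∷ σ)) ≗ X^ (ones σ)
  closed-step {m} σ hyp k = trans (Δ^-Δ (suc m) (halfOpen-series (false ∷ σ)) k)
    (trans (Δ^-cong (suc m) (Δ-closed σ) k) (hyp k))

-- Each of the `m` coordinates uses up one factor `1 - X`, and the constant series of the empty
-- vector uses the last. A removed facet shifts the series by one degree.
Δ^-halfOpen : ∀ {m} (σ : Vec Bool m) → Δ^ (suc m) (halfOpen-series σ) ≗ X^ (ones σ)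
Δ^-halfOpen []                  = Δ-point
Δ^-halfOpen (false ∷ σ)         = closed-step σ (Δ^-halfOpen σ)
Δ^-halfOpen {suc m} (true ∷ σ) k = trans (Δ^-cong (suc (suc m)) (open-shift σ) k)
  (trans (Δ^-shift (suc (suc m)) (halfOpen-series (false ∷ σ)) k)
  (trans (shift-cong (closed-step σ (Δ^-halfOpen σ)) k) (shift-X (ones σ) k)))

module _ {a b} {A : Set a} {B : Set b} {m : ℕ} (σ : A → Vec Bool m) (place : A → Vec ℕ m → B) where

  union : List A → ℕ → List B
  union xs t = concatMap (λ x → map (place x) (halfOpen (σ x) t)) xs

  Δ^-union : ∀ xs → Δ^ (suc m) (λ t → + length (union xs t)) ≗
                    (λ k → + length (filter (λ x → ones (σ x) ℕ.≟ k) xs))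
  Δ^-union []       k = Δ^-0 (suc m) k
  Δ^-union (x ∷ xs) k = trans (Δ^-cong (suc m) separate k)
    (trans (Δ^-⊕ (suc m) (halfOpen-series (σ x)) (λ t → + length (union xs t)) k)
    (trans (cong₂ ℤ._+_ (Δ^-halfOpen (σ x) k) (Δ^-union xs k)) (count (ones (σ x) ℕ.≟ k))))
    where
    separate : (λ t → + length (union (x ∷ xs) t)) ≗ halfOpen-series (σ x) ⊕ (λ t → + length (union xs t))
    separate t = cong +_ (trans (List.length-++ (map (place x) (halfOpen (σ x) t)))
      (cong (_+ length (union xs t)) (List.length-map (place x) (halfOpen (σ x) t))))
    counted? = λ x → ones (σ x) ℕ.≟ k
    count : (d : Dec (ones (σ x) ≡ k)) →
            (if does d then 1ℤ else 0ℤ) ℤ.+ + length (filter counted? xs) ≡ + length (filter counted? (x ∷ xs))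
    count (yes eq) = cong (+_ ∘ length) (sym (List.filter-accept counted? eq))
    count (no neq) = trans (ℤ.+-identityˡ (+ length (filter counted? xs)))
                           (cong (+_ ∘ length) (sym (List.filter-reject counted? neq)))

sumˢ-X : ∀ m (c : ℕ → ℕ) → (∀ k → m ≤ k → c k ≡ 0) → sumˢ {m} (λ l → + c (toℕ l) · X^ (toℕ l)) ≗ (λ k → + c k)
sumˢ-X zero    c tail k = cong +_ (sym (tail k z≤n))
sumˢ-X (suc m) c tail zero = trans (cong₂ ℤ._+_ (ℤ.*-identityʳ (+ c 0)) (higher m (c ∘ suc ∘ toℕ) toℕ)) (ℤ.+-identityʳ (+ c 0))
  where
  higher : ∀ m (h p : Fin m → ℕ) → sumˢ {m} (λ l → + h l · X^ (suc (p l))) 0 ≡ 0ℤ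
  higher zero    h p = refl
  higher (suc m) h p = cong₂ ℤ._+_ (ℤ.*-zeroʳ (+ h zero)) (higher m (h ∘ suc) (p ∘ suc))
sumˢ-X (suc m) c tail (suc k) = trans
  (cong₂ ℤ._+_ (ℤ.*-zeroʳ (+ c 0)) (trans (lower m (c ∘ suc ∘ toℕ) toℕ) (sumˢ-X m (c ∘ suc) (λ k m≤k → tail (suc k) (s≤s m≤k)) k)))
  (ℤ.+-identityˡ (+ c (suc k)))
  where
  lower : ∀ m (h : Fin m → ℕ) (p : Fin m → ℕ) →
          sumˢ {m} (λ l → + h l · X^ (suc (p l))) (suc k) ≡ sumˢ {m} (λ l → + h l · X^ (p l)) k
  lower zero    h p = refl
  lower (suc m) h p = cong (ℤ._+_ (+ h zero ℤ.* (X^ (p zero)) k)) (lower m (h ∘ suc) (p ∘ suc))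

-- The half-open decomposition

ones-filter : ∀ {a p} {A : Set a} {P : Pred A p} (P? : ∀ x → Dec (P x)) {m} (f : Fin m → A) →
              length (filter P? (tabulate f)) ≡ ones (Vec.tabulate (does ∘ P? ∘ f))
ones-filter P? {zero}  f = refl
ones-filter P? {suc m} f with does (P? (f zero))
... | true  = cong suc (ones-filter P? (f ∘ suc))
... | false = ones-filter P? (f ∘ suc)

ones-≤ : ∀ {m} (σ : Vec Bool m) → ones σ ≤ m
ones-≤ []          = z≤n
ones-≤ (true ∷ σ)  = s≤s (ones-≤ σ)
ones-≤ (false ∷ σ) = ℕ.m≤n⇒m≤1+n (ones-≤ σ)

ones-< : ∀ {m} (σ : Vec Bool m) k → Vec.lookup σ k ≢ true → ones σ < m
ones-< (true ∷ σ)  zero    ≢true = contradiction refl ≢true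
ones-< (false ∷ σ) zero    _     = s≤s (ones-≤ σ)
ones-< (true ∷ σ)  (suc k) ≢true = s≤s (ones-< σ k ≢true)
ones-< (false ∷ σ) (suc k) ≢true = ℕ.m≤n⇒m≤1+n (ones-< σ k ≢true)

does-true : ∀ {p} {P : Set p} (d : Dec P) → does d ≡ true → P
does-true (yes p) _ = p
does-true (no _)  ()

expand-cong : ∀ {A : Set} {m} (a : Fin m → A) {f g : Fin m → ℕ} → f ≗ g → expand a f ≡ expand a g
expand-cong {m = zero}  a f≗g = refl
expand-cong {m = suc m} a f≗g = cong₂ (λ k es → replicate k (a zero) ++ es) (f≗g zero) (expand-cong (a ∘ suc) (f≗g ∘ suc))

arc-cong : ∀ {V V′ : ℕ → ℕ} → V ≗ V′ → ∀ {i j} → Arc V i j → Arc V′ i j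
arc-cong V≗V′ {i} {j} (i<j , h) = i<j , λ {q} i<q q≤j →
  subst₂ _<_ (V≗V′ i) (V≗V′ q) (proj₁ (h i<q q≤j)) ,
  subst₂ _<_ (V≗V′ (suc j)) (V≗V′ q) (proj₂ (h i<q q≤j))

module Charts {n : ℕ} (T : Graph (suc n)) (nc : Noncrossing T) (conn : Connected T) where
  open Target T nc conn

  module Chart {V : ℕ → ℕ} (generic : Generic n V) (Tm : Graph (suc n)) (rep : Represents V Tm)
               (sub : ∀ {i j} → E Tm i j → E (closure T) i j)
               (arcs : Fin n → Fin (suc n) × Fin (suc n))
               (cells : ∀ m → Cartesian.Cell generic (suc (toℕ m)) (toℕ (proj₁ (arcs m))) (toℕ (proj₂ (arcs m))))
               where
    open Cartesian generic using (Cell; arc; parent-low; parent-inner; respects⇒arc; arc⇒respects; cell-arc-unique; inner)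
    open Represented generic Tm rep using (edge→arc; arc→edge; connected; whole)
    open Sign generic Tm rep sub using (S⇒falls; falls⇒S)
    private module L = Levels generic arcs
    open L using (gap; par; leftEnd; rightEnd; level-first; level-last)
    open L public using (level)

    falls? : ∀ m → Dec (ω (gap m) < ω (par m))
    falls? m = ω (gap m) ℕ.<? ω (par m)

    σ : Vec Bool n
    σ = Vec.tabulate (does ∘ falls?)

    point : (Fin n → ℕ) → Fin (suc n) → ℤ
    point = L.point cells

    σ-true : ∀ {m} → Vec.lookup σ m ≡ true → ω (gap m) < ω (par m)
    σ-true {m} eq = does-true (falls? m) (trans (sym (Vec.lookup∘tabulate (does ∘ falls?) m)) eq)

    S⇒edge : ∀ {i j} → (i , j) ∈ S[ T ] Tm → E Tm i j
    S⇒edge {i} {j} ((left , adj , _) , _) = oriented adj (left j adj)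
      where
      oriented : Adj Tm i j → toℕ i < toℕ j → E Tm i j
      oriented (fwd ij) _   = ij
      oriented (bwd ji) i<j = contradiction (E⇒< Tm ji) (ℕ.<-asym i<j)

    size : HasSize (Pair-setoid (suc n)) (S[ T ] Tm) (ones σ)
    size = subst (HasSize (Pair-setoid (suc n)) (S[ T ] Tm))
      (trans (List.length-map arcs (filter falls? (allFin n))) (ones-filter falls? id))
      (enumerate (Pair-setoid (suc n)) (map arcs (filter falls? (allFin n)))
        (All.map⁺ (All.map (λ {m} → falls⇒S (cells m)) (All.all-filter falls? (allFin n))))
        (AllPairs.map⁺ (AllPairs.map (λ i≢j eq → i≢j (L.arcs-injective cells eq))
          (AllPairs.filter⁺ falls? (allFin⁺ n))))
        complete)
      where
      complete : ∀ e → e ∈ S[ T ] Tm → ∃ λ y → y ∈ˡ map arcs (filter falls? (allFin n)) × y ≡ e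
      complete e e∈S with L.arc-index cells (edge→arc (S⇒edge e∈S))
      ... | m , refl = arcs m , ∈-map⁺ arcs (∈-filter⁺ falls? (∈-allFin m) (S⇒falls (cells m) e∈S)) , refl

    -- The arc of the whole vertex set is excluded from `S[ T ] Tm` by definition, so its facet is
    -- never removed. This keeps the degrees below `n`.
    ones<n : 0 < n → ones σ < n
    ones<n 0<n with L.arc-index cells {zero} {fromℕ n} (subst (Arc V 0) (sym (Fin.toℕ-fromℕ n)) (whole 0<n))
    ... | m , top = ones-< σ m λ eq → proj₁ (proj₂ (falls⇒S (cells m) (σ-true eq))) top

    Positive : (Fin n → ℕ) → Set
    Positive b = ∀ m → Vec.lookup σ m ≡ true → 0 < b m

    private
      cell-index : ∀ {q i j} → Cell q i j → ∃ λ m → gap m ≡ q × leftEnd m ≡ i × rightEnd m ≡ j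
      cell-index c with L.inner-gap cells (inner c)
      ... | m , refl = m , refl , cell-arc-unique (cells m) c

      ω-parent : ∀ m → ω (par m) ≢ ω (gap m)
      ω-parent m eq with parent-inner (cells m)
      ... | inj₁ par≡0         = ℕ.<⇒≢ (ω-positive (L.gap-inner cells m)) (trans (sym (trans (cong ω par≡0) ω-first)) eq)
      ... | inj₂ (inj₁ par≡N)  = ℕ.<⇒≢ (ω-positive (L.gap-inner cells m)) (trans (sym (trans (cong ω par≡N) ω-last)) eq)
      ... | inj₂ (inj₂ par-in) = ℕ.<⇒≢ (parent-low (cells m)) (cong V (ω-injective par-in (L.gap-inner cells m) eq))

      -- If `b m` is zero, the levels of the gap and its parent tie and ω decides. It cannot fall
      -- there, because a fall sets the bit of `σ` and so makes `b m` positive.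
      respects : ∀ b → Positive b → ∀ m → perturb (level b) (par m) < perturb (level b) (gap m)
      respects b pos m with b m in eq | ℕ.<-cmp (ω (par m)) (ω (gap m))
      ... | suc x | _ = perturb-< (level b) {par m} {gap m} (ℕ.≤-<-trans (ℕ.m≤n+m (level b (par m)) x)
                          (subst (x + level b (par m) <_) (sym (trans (L.level-step cells b m) (cong (_+ level b (par m)) eq))) ℕ.≤-refl))
      ... | zero | tri< lt _ _ = perturb-tie (level b) {par m} {gap m} (sym (trans (L.level-step cells b m) (cong (_+ level b (par m)) eq))) lt
      ... | zero | tri≈ _ ω≡ _ = contradiction ω≡ (ω-parent m)
      ... | zero | tri> _ _ gt = contradiction (subst (0 <_) eq (pos m σ≡true)) λ ()
        where
        σ≡true : Vec.lookup σ m ≡ true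
        σ≡true = trans (Vec.lookup∘tabulate (does ∘ falls?) m) (dec-true (falls? m) gt)

    -- One inclusion is enough: the edges of `Tm` are arcs of the perturbed levels, and a connected
    -- graph of arcs has all of them.
    level-represents : ∀ b → Positive b → Represents (perturb (level b)) Tm
    level-represents b pos = connected-arcs generic′ Tm connected
      λ {i} {j} ij → respects⇒arc generic′ cell-respects (toℕ≤ j) (edge→arc ij)
      where
      generic′ : Generic n (perturb (level b))
      generic′ = perturb-generic {level b} (level-first b) (level-last b)
      cell-respects : ∀ {q i j} → Cell q i j → perturb (level b) (parent V i j) < perturb (level b) q
      cell-respects c with cell-index c
      ... | m , refl , refl , refl = respects b pos m

    lattice : ∀ b {t} → sum b ≤ t → LatticePoint (Dilate t (𝒫 T)) (point b)
    lattice b {t} ∑b≤t = lattice-point T (point b) t {expand arcs b}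
      (All-expand b λ m → proj₁ (arc (cells m))) (proj₁ (proj₂ paths))
      (ℕ.≤-trans (ℕ.≤-reflexive (length-expand arcs b)) ∑b≤t) (λ _ → refl) (proj₂ (proj₂ paths))
      where paths = closure-edges T (All-expand b λ m → sub (arc→edge (arc (cells m))))

    point-injective : ∀ {b b′} → point b ≗ point b′ → b ≗ b′
    point-injective {b} {b′} eq = L.level-injective cells λ q _ → ℤ.+-injective
      (trans (sym (L.pairing-below-point cells b q)) (trans (pairing-congʳ (below q) eq) (L.pairing-below-point cells b′ q)))

    point-level : ∀ b q → pairing (below q) (point b) ≡ + level b q
    point-level = L.pairing-below-point cells

    module Recover (W : ℕ → ℕ) (W-first : W 0 ≡ 0) (W-last : W (suc n) ≡ 0)
                   (rep′ : Represents (perturb W) Tm) where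

      -- The truncated subtraction is exact, by `W-mono`.
      coordinates : Fin n → ℕ
      coordinates m = W (gap m) ∸ W (par m)

      private
        sub′ : ∀ {i j} → j ≤ n → Arc V i j → Arc (perturb W) i j
        sub′ {i} {j} j≤n ij@(i<j , _) = subst₂ (Arc (perturb W)) i≡ j≡
          (Equivalence.to (rep′ x y) (arc→edge (subst₂ (Arc V) (sym i≡) (sym j≡) ij)))
          where
          x = fromℕ< (ℕ.<-≤-trans i<j (ℕ.m≤n⇒m≤1+n j≤n))
          y = fromℕ< (s≤s j≤n)
          i≡ = Fin.toℕ-fromℕ< (ℕ.<-≤-trans i<j (ℕ.m≤n⇒m≤1+n j≤n))
          j≡ = Fin.toℕ-fromℕ< (s≤s j≤n)

        step : ∀ m → W (par m) < W (gap m) ⊎ (W (par m) ≡ W (gap m) × ω (par m) < ω (gap m))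
        step m = perturb-<⁻ W {par m} {gap m} (arc⇒respects sub′ (cells m))

        W-mono : ∀ m → W (par m) ≤ W (gap m)
        W-mono m with step m
        ... | inj₁ lt       = ℕ.<⇒≤ lt
        ... | inj₂ (eq , _) = ℕ.≤-reflexive eq

      positive : Positive coordinates
      positive m σ≡true with step m
      ... | inj₁ lt       = ℕ.m<n⇒0<n∸m lt
      ... | inj₂ (_ , lt) = contradiction lt (ℕ.<-asym (σ-true σ≡true))

      level≡ : ∀ q → q ≤ suc n → level coordinates q ≡ W q
      level≡ zero    _   = trans (level-first coordinates) (sym W-first)
      level≡ (suc p) p≤n with ℕ.m≤n⇒m<n∨m≡n p≤n
      ... | inj₁ q≤n  = L.level-solve cells {W} W-first W-last W-mono (z<s , ℕ.≤-pred q≤n)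
      ... | inj₂ refl = trans (level-last coordinates) (sym W-last)

    point-sum : ∀ {t} b → LatticePoint (Dilate t (𝒫 T)) (point b) → sum b ≤ t
    point-sum {t} b z∈ = ℤ.drop‿+≤+ (subst (ℤ._≤ + t) (L.pairing-rising-point cells b)
      (hull-pairing T t (point b) z∈ (L.rising cells) (L.rising-≤1 cells)))

-- Lattice points and their trees

block : ∀ {N} → ℕ → ℕ → Fin N → ℤ
block p q k = below q k ℤ.- below p k

block-value : ∀ {N p q} → p ≤ q → (k : Fin N) →
              (p ≤ toℕ k × toℕ k < q × block p q k ≡ 1ℤ) ⊎ (¬ (p ≤ toℕ k × toℕ k < q) × block p q k ≡ 0ℤ)
block-value {p = p} {q} p≤q k with toℕ k ℕ.<? p | toℕ k ℕ.<? q
... | yes k<p | no k≮q  = contradiction (ℕ.<-≤-trans k<p p≤q) k≮q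
... | yes k<p | yes k<q = inj₂ ((λ (p≤k , _) → ℕ.<⇒≱ k<p p≤k) , cong₂ ℤ._-_ (below-< k<q) (below-< k<p))
... | no k≮p  | no k≮q  = inj₂ ((λ (_ , k<q) → k≮q k<q) , cong₂ ℤ._-_ (below-≮ k≮q) (below-≮ k≮p))
... | no k≮p  | yes k<q = inj₁ (ℕ.≮⇒≥ k≮p , k<q , cong₂ ℤ._-_ (below-< k<q) (below-≮ k≮p))

concatMap-distinct : ∀ {a b q r} {A : Set a} {B : Set b} {Q : Rel A q} {R : Rel B r} (f : A → List B) →
                     (∀ x → AllPairs R (f x)) → (∀ x y → Q x y → All (λ z → All (R z) (f y)) (f x)) →
                     ∀ {xs} → AllPairs Q xs → AllPairs R (concatMap f xs)
concatMap-distinct f within across []         = []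
concatMap-distinct f within across (x∉ ∷ xs!) = AllPairs.++⁺ (within _) (concatMap-distinct f within across xs!)
  (All.map (λ z# → All.concat⁺ (All.map⁺ z#)) (transpose (All.map (λ {y} → across _ y) x∉)))
  where
  transpose : ∀ {zs ys} → All (λ y → All (λ z → All _ (f y)) zs) ys → All (λ z → All (λ y → All _ (f y)) ys) zs
  transpose p = All.tabulate λ z∈ → All.map (λ h → All.lookup h z∈) p

lattice-cong : ∀ {N} t (P : Pred (ℝ^ N) 0ℓ) {z z′} → z ≗ z′ →
               LatticePoint (Dilate t P) z → LatticePoint (Dilate t P) z′
lattice-cong t P z≗z′ (y , y∈ , z≋) = y , y∈ , λ k → subst (λ w → fromℤ w ≈ℝ fromℤ (+ t) *ℝ y k) (z≗z′ k) (z≋ k)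

module Count {n : ℕ} (T : Graph (suc n)) (nc : Noncrossing T) (conn : Connected T) where
  open Target T nc conn
  open Charts T nc conn
  open Trees T

  -- Only an entering edge runs from value 0 to value 1 of the indicator of the block. Its pairing
  -- with a point is a difference of prefix sums, so `cone-pairing` turns the monotonicity into an
  -- inequality between them.
  block-nonentered : ∀ {p q} → p ≤ q → ¬ Enters p q → ∀ {u v} → E T u v → block p q v ℤ.≤ block p q u
  block-nonentered p≤q ¬en {u} {v} uv with block-value p≤q v | block-value p≤q u
  ... | inj₁ (_ , _ , v≡)     | inj₁ (_ , _ , u≡) = subst₂ ℤ._≤_ (sym v≡) (sym u≡) ℤ.≤-refl
  ... | inj₂ (_ , v≡)         | inj₁ (_ , _ , u≡) = subst₂ ℤ._≤_ (sym v≡) (sym u≡) (ℤ.+≤+ z≤n)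
  ... | inj₂ (_ , v≡)         | inj₂ (_ , u≡)     = subst₂ ℤ._≤_ (sym v≡) (sym u≡) ℤ.≤-refl
  ... | inj₁ (p≤v , v<q , v≡) | inj₂ (u∉ , u≡)    =
    contradiction (u , v , uv , ℕ.≰⇒> (λ p≤u → u∉ (p≤u , ℕ.<-trans (E⇒< T uv) v<q)) , p≤v , v<q) ¬en

  block-nonleft : ∀ {p q} → p ≤ q → ¬ Leaves p q → ∀ {u v} → E T u v → block p q u ℤ.≤ block p q v
  block-nonleft p≤q ¬lv {u} {v} uv with block-value p≤q v | block-value p≤q u
  ... | inj₁ (_ , _ , v≡) | inj₁ (_ , _ , u≡)     = subst₂ ℤ._≤_ (sym u≡) (sym v≡) ℤ.≤-refl
  ... | inj₁ (_ , _ , v≡) | inj₂ (_ , u≡)         = subst₂ ℤ._≤_ (sym u≡) (sym v≡) (ℤ.+≤+ z≤n)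
  ... | inj₂ (_ , v≡)     | inj₂ (_ , u≡)         = subst₂ ℤ._≤_ (sym u≡) (sym v≡) ℤ.≤-refl
  ... | inj₂ (v∉ , v≡)    | inj₁ (p≤u , u<q , u≡) =
    contradiction (u , v , uv , p≤u , u<q , ℕ.≮⇒≥ λ v<q → v∉ (ℕ.≤-trans p≤u (ℕ.<⇒≤ (E⇒< T uv)) , v<q)) ¬lv

  module Heights (t : ℕ) (z : Fin (suc n) → ℤ) (z∈ : LatticePoint (Dilate t (𝒫 T)) z) where

    prefix : ℕ → ℤ
    prefix q = pairing (below q) z

    private
      increasing : ∀ (α : Fin (suc n) → ℤ) → (∀ {u v} → E T u v → α v ℤ.≤ α u) → 0ℤ ℤ.≤ pairing α z
      increasing α = cone-pairing T t z z∈ α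

      decreasing : ∀ (α : Fin (suc n) → ℤ) → (∀ {u v} → E T u v → α u ℤ.≤ α v) → pairing α z ℤ.≤ 0ℤ
      decreasing α mono = subst (ℤ._≤ 0ℤ) (trans (cong ℤ.-_ (trans (pairing-*ˡ ℤ.-1ℤ α z) (ℤ.-1*i≡-i (pairing α z)))) (ℤ.neg-involutive (pairing α z)))
        (ℤ.neg-mono-≤ (increasing (λ k → ℤ.-1ℤ ℤ.* α k) λ {u} {v} uv →
          subst₂ ℤ._≤_ (sym (ℤ.-1*i≡-i (α v))) (sym (ℤ.-1*i≡-i (α u))) (ℤ.neg-mono-≤ (mono uv))))

      difference : ∀ p q → pairing (block p q) z ≡ prefix q ℤ.- prefix p
      difference p q = trans (pairing-congˡ z λ k → cong (ℤ._+_ (below q k)) (sym (ℤ.-1*i≡-i (below p k))))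
        (trans (pairing-+ˡ (below q) (λ k → ℤ.-1ℤ ℤ.* below p k) z)
          (cong (ℤ._+_ (prefix q)) (trans (pairing-*ˡ ℤ.-1ℤ (below p) z) (ℤ.-1*i≡-i (prefix p)))))

    prefix-first : prefix 0 ≡ 0ℤ
    prefix-first = trans (ℤΣ.sum-cong-≗ λ k → ℤ.*-zeroˡ (z k)) (ℤΣ.sum-replicate-zero (suc n))

    -- The functional is constantly 1, hence monotone along the edges in both directions.
    prefix-last : prefix (suc n) ≡ 0ℤ
    prefix-last = trans (pairing-congˡ z λ k → below-< (Fin.toℕ<n k))
      (ℤ.≤-antisym (decreasing (λ _ → 1ℤ) λ _ → ℤ.≤-refl) (increasing (λ _ → 1ℤ) λ _ → ℤ.≤-refl))

    no-entering : ∀ {p q} → p ≤ q → ¬ Enters p q → prefix p ℤ.≤ prefix q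
    no-entering {p} {q} p≤q ¬en = ℤ.0≤i-j⇒j≤i (subst (0ℤ ℤ.≤_) (difference p q)
      (increasing (block p q) (block-nonentered p≤q ¬en)))

    no-leaving : ∀ {p q} → p ≤ q → ¬ Leaves p q → prefix q ℤ.≤ prefix p
    no-leaving {p} {q} p≤q ¬lv = ℤ.i-j≤0⇒i≤j (subst (ℤ._≤ 0ℤ) (difference p q)
      (decreasing (block p q) (block-nonleft p≤q ¬lv)))

    -- The absolute value changes nothing: no edge enters a block that begins at the first vertex,
    -- so the prefix sums are nonnegative.
    W : ℕ → ℕ
    W q = ℤ.∣ prefix q ∣

    W≡prefix : ∀ q → + W q ≡ prefix q
    W≡prefix q = ℤ.0≤i⇒+∣i∣≡i (subst (ℤ._≤ prefix q) prefix-first (no-entering {0} {q} z≤n λ { (_ , _ , _ , () , _) }))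

    coneHeight : ConeHeight W
    coneHeight = record
      { first = cong ℤ.∣_∣ prefix-first
      ; last  = cong ℤ.∣_∣ prefix-last
      ; rise  = λ {p} {q} p<q _ W< → leaves (ℕ.<⇒≤ p<q) W< (Leaves? p q)
      ; fall  = λ {p} {q} p<q _ W< → enters (ℕ.<⇒≤ p<q) W< (Enters? p q)
      }
      where
      leaves : ∀ {p q} → p ≤ q → W p < W q → Dec (Leaves p q) → Leaves p q
      leaves _   _  (yes lv) = lv
      leaves {p} {q} p≤q W< (no ¬lv) = contradiction
        (ℤ.drop‿+≤+ (subst₂ ℤ._≤_ (sym (W≡prefix q)) (sym (W≡prefix p)) (no-leaving p≤q ¬lv))) (ℕ.<⇒≱ W<)
      enters : ∀ {p q} → p ≤ q → W q < W p → Dec (Enters p q) → Enters p q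
      enters _   _  (yes en) = en
      enters {p} {q} p≤q W< (no ¬en) = contradiction
        (ℤ.drop‿+≤+ (subst₂ ℤ._≤_ (sym (W≡prefix p)) (sym (W≡prefix q)) (no-entering p≤q ¬en))) (ℕ.<⇒≱ W<)

  private
    arcCell : ∀ {V} (generic : Generic n V) (m : Fin n) → ∃ λ (a : Fin (suc n) × Fin (suc n)) →
              Cartesian.Cell generic (suc (toℕ m)) (toℕ (proj₁ a)) (toℕ (proj₂ a))
    arcCell generic m =
      let i , j , c = cell {suc (toℕ m)} (z<s , Fin.toℕ<n m)
          i<N = ℕ.<-≤-trans (i<q c) (ℕ.m≤n⇒m≤1+n (Fin.toℕ<n m))
          j<N = s≤s (j≤n c)
      in (fromℕ< i<N , fromℕ< j<N) ,
         subst₂ (Cell (suc (toℕ m))) (sym (Fin.toℕ-fromℕ< i<N)) (sym (Fin.toℕ-fromℕ< j<N)) c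
      where open Cartesian generic

  module TreeChart (x : Tree) where
    arcs : Fin n → Fin (suc n) × Fin (suc n)
    arcs m = proj₁ (arcCell (Height.height-generic (proj₁ x)) m)

    cells : ∀ m → Cartesian.Cell (Height.height-generic (proj₁ x)) (suc (toℕ m)) (toℕ (proj₁ (arcs m))) (toℕ (proj₂ (arcs m)))
    cells m = proj₂ (arcCell (Height.height-generic (proj₁ x)) m)

    open Chart (Height.height-generic (proj₁ x)) (proj₁ x) (NAT⇒represented (proj₁ x) (proj₂ x))
      (proj₂ (proj₁ (proj₂ x))) arcs cells public

  facets : Tree → Vec Bool n
  facets = TreeChart.σ

  place : Tree → Vec ℕ n → Fin (suc n) → ℤ
  place x b = TreeChart.point x (Vec.lookup b)

  points : ℕ → List (Fin (suc n) → ℤ)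
  points = union facets place trees

  -- The tree can be read off from the point: the prefix sums are the levels, and the perturbed
  -- levels represent the tree.
  place-tree : ∀ x y {b b′} → TreeChart.Positive x (Vec.lookup b) → TreeChart.Positive y (Vec.lookup b′) →
               place x b ≗ place y b′ → x ≈ᵗ y
  place-tree x y {b} {b′} pos pos′ eq i j = mk⇔
    (λ xij → Equivalence.from (Y.level-represents f′ pos′ i j) (arc-cong same (Equivalence.to (X.level-represents f pos i j) xij)))
    (λ yij → Equivalence.from (X.level-represents f pos i j) (arc-cong (λ q → sym (same q)) (Equivalence.to (Y.level-represents f′ pos′ i j) yij)))
    where
    module X = TreeChart x
    module Y = TreeChart y
    f  = Vec.lookup b
    f′ = Vec.lookup b′
    same : perturb (X.level f) ≗ perturb (Y.level f′)
    -- `perturb W q` depends on `W` only through `W q`, so a constant function can take the place of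
    -- `W`.
    same q = cong (λ w → perturb (λ _ → w) q) {X.level f q} {Y.level f′ q} (ℤ.+-injective
      (trans (sym (X.point-level f q)) (trans (pairing-congʳ (below q) eq) (Y.point-level f′ q))))

  private
    placed : Tree → ℕ → List (Fin (suc n) → ℤ)
    placed x t = map (place x) (halfOpen (facets x) t)

    placed-sound : ∀ t x → All (LatticePoint (Dilate t (𝒫 T))) (placed x t)
    placed-sound t x = All.map⁺ (All.map (λ {b} → sound {b}) (halfOpen-sound (facets x) t))
      where
      sound : ∀ {b} → Admissible (facets x) t b → LatticePoint (Dilate t (𝒫 T)) (place x b)
      sound {b} (_ , ∑b≤t) = TreeChart.lattice x (Vec.lookup b) ∑b≤t

    lookup-injective : ∀ {m} (b b′ : Vec ℕ m) → Vec.lookup b ≗ Vec.lookup b′ → b ≡ b′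
    lookup-injective b b′ eq = trans (sym (Vec.tabulate∘lookup b)) (trans (Vec.tabulate-cong eq) (Vec.tabulate∘lookup b′))

    Distinct : (z z′ : Fin (suc n) → ℤ) → Set
    Distinct z z′ = ¬ z ≗ z′

    placed-distinct : ∀ t x → AllPairs Distinct (placed x t)
    placed-distinct t x = AllPairs.map⁺ (AllPairs.map (λ {b} {b′} → distinct {b} {b′}) (halfOpen-distinct (facets x) t))
      where
      distinct : ∀ {b b′} → b ≢ b′ → Distinct (place x b) (place x b′)
      distinct {b} {b′} b≢b′ eq = b≢b′ (lookup-injective b b′ (TreeChart.point-injective x {Vec.lookup b} {Vec.lookup b′} eq))

    placed-disjoint : ∀ t x y → ¬ x ≈ᵗ y → All (λ z → All (Distinct z) (placed y t)) (placed x t)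
    placed-disjoint t x y x≉y = All.map⁺ (All.map (λ {b} → outer {b}) (halfOpen-sound (facets x) t))
      where
      outer : ∀ {b} → Admissible (facets x) t b → All (Distinct (place x b)) (placed y t)
      outer {b} (pos , _) = All.map⁺ (All.map (λ {b′} → inner {b′}) (halfOpen-sound (facets y) t))
        where
        inner : ∀ {b′} → Admissible (facets y) t b′ → Distinct (place x b) (place y b′)
        inner {b′} (pos′ , _) eq = x≉y (place-tree x y {b} {b′} pos pos′ eq)

  points-sound : ∀ t → All (LatticePoint (Dilate t (𝒫 T))) (points t)
  points-sound t = All.concat⁺ (All.map⁺ (All.universal (placed-sound t) trees))

  points-distinct : ∀ t → AllPairs Distinct (points t)
  points-distinct t = concatMap-distinct (λ x → placed x t) (placed-distinct t) (placed-disjoint t) trees-distinct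

  private
    placed-complete : ∀ t z (z∈ : LatticePoint (Dilate t (𝒫 T)) z) x →
                      Represents (perturb (Heights.W t z z∈)) (proj₁ x) →
                      ∃ λ b → b ∈ˡ halfOpen (facets x) t × place x b ≗ z
    placed-complete t z z∈ x rep = b , halfOpen-complete (facets x) t b (positive′ , sum≤t) , place≗z
      where
      open Heights t z z∈ using (W; W≡prefix; coneHeight)
      open ConeHeight coneHeight using (first; last)
      open TreeChart x using (point; point-level; point-sum; module Recover)
      open Recover W first last rep using (coordinates; positive; level≡)
      b : Vec ℕ n
      b = Vec.tabulate coordinates
      b≗ : Vec.lookup b ≗ coordinates
      b≗ = Vec.lookup∘tabulate coordinates
      point≗z : point coordinates ≗ z
      point≗z = pairing-below-injective (point coordinates) z λ q q≤N →
        trans (point-level coordinates q) (trans (cong +_ (level≡ q q≤N)) (W≡prefix q))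
      place≗z : place x b ≗ z
      place≗z k = trans (cong (λ es → rootSum es k) (expand-cong _ b≗)) (point≗z k)
      positive′ : TreeChart.Positive x (Vec.lookup b)
      positive′ m eq = subst (0 <_) (sym (b≗ m)) (positive m eq)
      sum≤t : sum (Vec.lookup b) ≤ t
      sum≤t = ℕ.≤-trans (ℕ.≤-reflexive (sum-cong-≗ b≗))
        (point-sum coordinates (lattice-cong t (𝒫 T) (λ k → sym (point≗z k)) z∈))

    tree-complete : ∀ t z (z∈ : LatticePoint (Dilate t (𝒫 T)) z) →
                    ∃ λ x → x ∈ˡ trees × Represents (perturb (Heights.W t z z∈)) (proj₁ x)
    tree-complete t z z∈ = trees-complete (arcGraph n (perturb W))
      (represented⇒NAT (perturb-generic {W} first last) (arcGraph n (perturb W)) (λ i j → mk⇔ id id)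
        (perturb-arc⇒closure coneHeight))
      where
      open Heights t z z∈ using (W; coneHeight)
      open ConeHeight coneHeight using (first; last)

  points-complete : ∀ t z → LatticePoint (Dilate t (𝒫 T)) z → ∃ λ y → y ∈ˡ points t × y ≗ z
  points-complete t z z∈ =
    let x , x∈ , rep = tree-complete t z z∈
        b , b∈ , place≗z = placed-complete t z z∈ x rep
    in place x b , ∈-concat⁺′ (∈-map⁺ (place x) b∈) (∈-map⁺ (λ x → placed x t) x∈) , place≗z

  ehrhart : IsEhrhartFunction (𝒫 T) (length ∘ points)
  ehrhart t = enumerate (ℤ^-setoid (suc n)) (points t) (points-sound t) (points-distinct t) (points-complete t)

-- For `t = 0` a functional that is at most 1 on all roots is at most 0 on the point; this applies
-- to each coordinate and to its negative. It reconciles the value of the Ehrhart function at 0 with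
-- the constant term of `J`.
origin-only : ∀ {N} (T : Graph N) z → LatticePoint (Dilate 0 (𝒫 T)) z → ∀ k → z k ≡ 0ℤ
origin-only T z z∈ k = ℤ.≤-antisym
  (subst (ℤ._≤ 0ℤ) (pairing-δˡ z k) (hull-pairing T 0 z z∈ (δ k) λ u v → δ-drop (does (k Fin.≟ u)) (does (k Fin.≟ v))))
  (subst (0ℤ ℤ.≤_) (ℤ.neg-involutive (z k)) (ℤ.neg-mono-≤ (subst (ℤ._≤ 0ℤ)
    (trans (pairing-*ˡ ℤ.-1ℤ (δ k) z) (trans (ℤ.-1*i≡-i (pairing (δ k) z)) (cong ℤ.-_ (pairing-δˡ z k))))
    (hull-pairing T 0 z z∈ (λ i → ℤ.-1ℤ ℤ.* δ k i) λ u v → neg-δ-drop (does (k Fin.≟ u)) (does (k Fin.≟ v))))))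
  where
  bit : Bool → ℤ
  bit β = if β then 1ℤ else 0ℤ
  δ-drop : ∀ β γ → bit β ℤ.- bit γ ℤ.≤ 1ℤ
  δ-drop true  true  = ℤ.+≤+ z≤n
  δ-drop true  false = ℤ.≤-refl
  δ-drop false true  = ℤ.-≤+
  δ-drop false false = ℤ.+≤+ z≤n
  neg-δ-drop : ∀ β γ → ℤ.-1ℤ ℤ.* bit β ℤ.- ℤ.-1ℤ ℤ.* bit γ ℤ.≤ 1ℤ
  neg-δ-drop true  true  = ℤ.+≤+ z≤n
  neg-δ-drop true  false = ℤ.-≤+
  neg-δ-drop false true  = ℤ.≤-refl
  neg-δ-drop false false = ℤ.+≤+ z≤n

module Final {n : ℕ} (0<n : 0 < n) (T : Graph (suc n)) (nc : Noncrossing T) (conn : Connected T) where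
  open Charts T nc conn
  open Trees T
  open Count T nc conn

  private
    L c : ℕ → ℕ
    L t = length (points t)
    c l = length (filter (λ x → ones (facets x) ℕ.≟ l) trees)

    Counted : ℕ → Graph (suc n) → Set
    Counted l Tm = NoncrossingAlternatingTree T Tm × HasSize (Pair-setoid (suc n)) (S[ T ] Tm) l

    L0≡1 : L 0 ≡ 1
    L0≡1 = size-unique (ℤ^-setoid (suc n)) (ehrhart 0)
      (enumerate (ℤ^-setoid (suc n)) ((λ _ → 0ℤ) ∷ [])
        (lattice-point T (λ _ → 0ℤ) 0 {[]} {[]} [] [] z≤n (λ _ → refl) (λ _ → refl) ∷ []) ([] ∷ [])
        λ z z∈ → (λ _ → 0ℤ) , here refl , λ k → sym (origin-only T z z∈ k))

    -- The bits of `facets x` are computed from the heights and arcs of `x` alone. The chart can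
    -- therefore be read with any graph `Tm` that has the same edges, which avoids transporting
    -- `S[ T ]` along the equality of graphs.
    facets-of : ∀ x Tm → NoncrossingAlternatingTree T Tm → (∀ i j → E (proj₁ x) i j ⇔ E Tm i j) →
                HasSize (Pair-setoid (suc n)) (S[ T ] Tm) (ones (facets x))
    facets-of x Tm ((_ , sub) , _) x≈Tm = Chart.size (Height.height-generic (proj₁ x)) Tm rep sub
      (TreeChart.arcs x) (TreeChart.cells x)
      where
      rep : Represents (Height.height (proj₁ x)) Tm
      rep i j = mk⇔ (Equivalence.to (NAT⇒represented (proj₁ x) (proj₂ x) i j) ∘ Equivalence.from (x≈Tm i j))
        (Equivalence.to (x≈Tm i j) ∘ Equivalence.from (NAT⇒represented (proj₁ x) (proj₂ x) i j))

    counted : ∀ l → HasSize (Graph-setoid (suc n)) (Counted l) (c l)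
    counted l = subst (HasSize (Graph-setoid (suc n)) (Counted l)) (List.length-map proj₁ (filter has-l? trees))
      (enumerate (Graph-setoid (suc n)) (map proj₁ (filter has-l? trees))
        (All.map⁺ (All.map (λ {x} → sound x) (All.all-filter has-l? trees)))
        (AllPairs.map⁺ (AllPairs.filter⁺ has-l? trees-distinct)) complete)
      where
      has-l? : ∀ x → Dec (ones (facets x) ≡ l)
      has-l? x = ones (facets x) ℕ.≟ l
      sound : ∀ x → ones (facets x) ≡ l → Counted l (proj₁ x)
      sound x eq = proj₂ x , subst (HasSize (Pair-setoid (suc n)) (S[ T ] (proj₁ x))) eq
        (facets-of x (proj₁ x) (proj₂ x) λ i j → mk⇔ id id)
      complete : ∀ Tm → Counted l Tm → ∃ λ G → G ∈ˡ map proj₁ (filter has-l? trees) × (∀ i j → E G i j ⇔ E Tm i j)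
      complete Tm (nat , size) =
        let x , x∈ , x≈Tm = trees-complete Tm nat
            eq = size-unique (Pair-setoid (suc n)) (facets-of x Tm nat x≈Tm) size
        in proj₁ x , ∈-map⁺ proj₁ (∈-filter⁺ has-l? x∈ eq) , x≈Tm

    c-tail : ∀ l → n ≤ l → c l ≡ 0
    c-tail l n≤l = cong length (List.filter-none (λ x → ones (facets x) ℕ.≟ l)
      (All.universal (λ x eq → ℕ.<⇒≱ (subst (_< n) eq (TreeChart.ones<n x 0<n)) n≤l) trees))

    J≗L : J L ≗ (λ t → + L t)
    J≗L zero    = cong +_ (sym L0≡1)
    J≗L (suc t) = refl

    series : ((1ˢ ⊖ X^ 1) ^ˢ (suc n) ⊛ J L) ≗ sumˢ {n} (λ l → + c (toℕ l) · X^ (toℕ l))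
    series k = trans (1-X^-⊛ (suc n) (J L) k) (trans (Δ^-cong (suc n) J≗L k)
      (trans (Δ^-union facets place trees k) (sym (sumˢ-X n c c-tail k))))

  result : Σ[ L ∈ (ℕ → ℕ) ] Σ[ c ∈ (ℕ → ℕ) ]
    IsEhrhartFunction (𝒫 T) L ×
    (∀ l → HasSize (Graph-setoid (suc n)) (Counted l) (c l)) ×
    ((1ˢ ⊖ X^ 1) ^ˢ (suc n) ⊛ J L) ≗ sumˢ {n} (λ l → + c (toℕ l) · X^ (toℕ l))
  result = L , c , ehrhart , counted , series

theorem29 : (n : ℕ) → 1 ≤ n → (T : Graph (suc n)) → IsGoodTree T →
    Σ[ L ∈ (ℕ → ℕ) ] Σ[ c ∈ (ℕ → ℕ) ]
    IsEhrhartFunction (𝒫 T) L ×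
    (∀ l → HasSize (Graph-setoid (suc n))
    (λ Tm → NoncrossingAlternatingTree T Tm ×
    HasSize (Pair-setoid (suc n)) (S[ T ] Tm) l)
    (c l)) ×
    ((1ˢ ⊖ X^ 1) ^ˢ (suc n) ⊛ J L) ≗
    sumˢ {n} (λ l → + c (toℕ l) · X^ (toℕ l))
theorem29 n 1≤n T (good , connected , _) = Final.result 1≤n T (IsGoodForest.noncrossing good) connected
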